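{- Let $\Upsilon$ be a gain signed graph. An edge set $B\subseteq E$, regarded as a spanning subgraph, is a basis of $M(\Upsilon)$ if and only if: (I) if $\Upsilon$ is hyperbalanced: for each sign-balanced component $\Upsilon_i$ of $\Upsilon$, $B\cap E(\Upsilon_i)$ is a spanning tree of $\Upsilon_i$; for each sign-unbalanced component $\Upsilon_i$, $B\cap E(\Upsilon_i)$ is a spanning disjoint union of sign-unbalanced unicycles; and $B$ contains no loose edges; (II) if $\Upsilon$ is hyperfrustrated: $B$ is as in (I) except that exactly one of the following holds: $B$ has one edge component that is a non-neutral loose edge; or in one sign-balanced component $\Upsilon_i$ that is not a tree, $B\cap E(\Upsilon_i)$ is a spanning sign-balanced unicycle whose circle is not neutral; or in one sign-unbalanced component $\Upsilon_i$, one component $B_0$ of $B\cap E(\Upsilon_i)$ is a theta graph or a handcuff with at least one negative figure, possibly with attached trees, and the unique sign circuit in $B_0$ is non-neutral.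
   Context: Let $\mathbb{K}$ be a field of characteristic $\ne2$. A graph $\Gamma=(V,E)$ has vertex set $V=\{v_1,\dots,v_n\}$ and finite edge set $E$; edges are links (two ends at distinct vertices), loops (two ends at one vertex), half edges (one end) or loose edges (no ends); parallel edges allowed. A gain signed graph $\Upsilon=(\Gamma,\sigma,\varphi)$: $\sigma:E\to\{\pm1\}$ (half edges negative, loose edges positive); with an orientation $\tau$ (signs $\tau(v,e)\in\{\pm1\}$ on edge ends, $\tau(v,e)\tau(w,e)=-\sigma(e)$ for a link or loop with ends $v,w$) each edge has gain $\varphi(e)\in\mathbb{K}$, negated on reorientation. Neutral = gain $0$. Walk gain of $W=u_0e_1\cdots e_lu_l$: $\varphi(W)=-\sum_i\varphi(e_i)\sigma(W_{0,i-1})\tau(u_{i-1},e_i)$, $\sigma(W_{0,j})=\prod_{i\le j}\sigma(e_i)$. Ultrawalks may begin with a half edge $e_0$ at $u_0$ and/or end with a half edge $e_{l+1}$ at $u_l$; their gain adds $\tau(u_0,e_0)\varphi(e_0)$ and/or $-\varphi(e_{l+1})\sigma(W_{0,l})\tau(u_l,e_{l+1})$ to $\varphi(W_{0,l})$. Circles: connected 2-regular subgraphs, sign = product of edge signs; a negative figure is a negative circle or a half edge. A sign circuit is a positive circle, a loose edge, or a handcuff of two negative figures. Its gain: the edge gain for a loose edge; else $\varphi(W)$ for a circuit walk (once around a positive circle; for a handcuff with figures $C_1,C_2$, connecting path $P$ of length $\ge0$: around $C_1$, along $P$, around $C_2$, back along $P$ if both circles; from half edge $C_1$ along $P$, around $C_2$,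 back, ending with $C_1$ if $C_1$ half edge and $C_2$ circle; from one half edge along $P$ to the other if both half edges); well defined up to sign; neutral if $0$. An edge set (or $\Upsilon$, via $E$) is hyperbalanced if all sign circuits in it are neutral, hyperfrustrated otherwise; sign balanced if it has no negative circle and no half edge. Components: connected components (loose edges excluded); edge components of $B$: each loose edge and each non-trivial component of $(V,B)$. $M(\Upsilon)$: matroid on $E$ with rank $n-b_\Sigma(S)+\delta(S)$ ($b_\Sigma$ = number of sign-balanced components of $(V,S)$, $\delta=0$ if hyperbalanced, $1$ otherwise). A handcuff is two figures (circles or half edges) with at most one common vertex together with a path (length $0$ if they meet) joining them and meeting them only at its ends. A unicycle is a circle or half edge with trees attached; sign balanced if the circle is positive, sign unbalanced if it is a negative circle or half edge. A theta graph is the union of three internally disjoint paths between two vertices. For a component $\Upsilon_i$, $E(\Upsilon_i)$ is its edge set. -}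

module Defs where

open import Level using (Level; _⊔_) renaming (suc to lsuc)
open import Algebra.Bundles using (CommutativeRing)
open import Data.Nat using (ℕ; zero; suc) renaming (_+_ to _+ℕ_)
open import Data.Fin using (Fin)
open import Data.Fin.Subset using (Subset; _∈_; _⊆_; ⁅_⁆; _∪_; _∩_; ∣_∣) renaming (⊥ to ∅)
open import Data.Bool using (Bool; true; false)
open import Data.Bool.ListAction using () renaming (any to anyB)
open import Data.Vec using (lookup; tabulate)
open import Data.List as List using (List; []; _∷_; _++_)
import Data.List.Membership.Propositional as LM
open import Data.List.Relation.Unary.Unique.Propositional using (Unique)
open import Data.Sign using (Sign) renaming (_*_ to _*ˢ_; + to ₊; - to ₋)
open import Data.Product using (Σ; Σ-syntax; ∃; ∃-syntax; _×_; _,_)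
open import Data.Sum using (_⊎_)
open import Data.Empty using (⊥)
open import Relation.Nullary using (¬_)
open import Relation.Binary.PropositionalEquality using (_≡_; _≢_)
open import Relation.Binary.Construct.Closure.ReflexiveTransitive using (Star)
open import Function.Bundles using (_⇔_)
open import Function.Definitions using (Injective)

record Field (c ℓ : Level) : Set (lsuc (c ⊔ ℓ)) where
  field
    commutativeRing : CommutativeRing c ℓ
  open CommutativeRing commutativeRing public
  field
    0≉1     : ¬ (0# ≈ 1#)
    inverse : ∀ x → ¬ (x ≈ 0#) → ∃[ y ] (x * y ≈ 1#)

CharNot2 : ∀ {c ℓ} → Field c ℓ → Set ℓ
CharNot2 F = ¬ (1# + 1# ≈ 0#)
  where open Field F

-- Edges together with an orientation.
--   link v w _ τv τw : a link with ends at v ≠ w, τ(v,e) = τv, τ(w,e) = τw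
--   loop v τ₁ τ₂     : a loop at v whose two ends carry τ₁ and τ₂
--   half v τ         : a half edge at v with τ(v,e) = τ
--   loose            : a loose edge
-- The sign is determined by the orientation through
-- τ(v,e)τ(w,e) = -σ(e) (links, loops); half edges are negative and
-- loose edges positive.

data Ends (n : ℕ) : Set where
  link  : (v w : Fin n) → v ≢ w → (τv τw : Sign) → Ends n
  loop  : (v : Fin n) → (τ₁ τ₂ : Sign) → Ends n
  half  : (v : Fin n) → (τ : Sign) → Ends n
  loose : Ends n

negS : Sign → Sign
negS ₊ = ₋
negS ₋ = ₊

signOf : ∀ {n} → Ends n → Sign
signOf (link v w _ τv τw) = negS (τv *ˢ τw)
signOf (loop v τ₁ τ₂)     = negS (τ₁ *ˢ τ₂)
signOf (half v τ)         = ₋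
signOf loose              = ₊

endVerts : ∀ {n} → Ends n → List (Fin n)
endVerts (link v w _ _ _) = v ∷ w ∷ []
endVerts (loop v _ _)     = v ∷ []
endVerts (half v _)       = v ∷ []
endVerts loose            = []

-- StepE k u t w : an edge with ends k can be traversed from u to w,
-- leaving u through an end whose orientation sign is t.
StepE : ∀ {n} → Ends n → Fin n → Sign → Fin n → Set
StepE (link v w _ τv τw) u t x =
  (u ≡ v × t ≡ τv × x ≡ w) ⊎ (u ≡ w × t ≡ τw × x ≡ v)
StepE (loop v τ₁ τ₂) u t x = u ≡ v × x ≡ v × (t ≡ τ₁ ⊎ t ≡ τ₂)
StepE (half _ _) _ _ _ = ⊥
StepE loose _ _ _ = ⊥

-- traversing the same edge backwards, through its other end
revStepE : ∀ {n} (k : Ends n) {u t x} → StepE k u t x → Σ Sign λ t′ → StepE k x t′ u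
revStepE (link v w _ τv τw) (Data.Sum.inj₁ (p , q , r)) = τw , Data.Sum.inj₂ (r , Relation.Binary.PropositionalEquality.refl , p)
revStepE (link v w _ τv τw) (Data.Sum.inj₂ (p , q , r)) = τv , Data.Sum.inj₁ (r , Relation.Binary.PropositionalEquality.refl , p)
revStepE (loop v τ₁ τ₂) (p , q , Data.Sum.inj₁ _) = τ₂ , (q , p , Data.Sum.inj₂ Relation.Binary.PropositionalEquality.refl)
revStepE (loop v τ₁ τ₂) (p , q , Data.Sum.inj₂ _) = τ₁ , (q , p , Data.Sum.inj₁ Relation.Binary.PropositionalEquality.refl)

record GainSignedGraph {c ℓ} (F : Field c ℓ) (n m : ℕ) : Set c where
  field
    ends : Fin m → Ends n
    gain : Fin m → Field.Carrier F

module GS {c ℓ} (F : Field c ℓ) {n m : ℕ} (G : GainSignedGraph F n m) where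
  open Field F renaming (_+_ to _⊕_; -_ to ⊖_)
  open GainSignedGraph G

  φ = gain

  σ : Fin m → Sign
  σ e = signOf (ends e)

  _·_ : Sign → Carrier → Carrier
  ₊ · x = x
  ₋ · x = ⊖ x

  IsLoose : Fin m → Set
  IsLoose e = ends e ≡ loose

  setOf : List (Fin m) → Subset m
  setOf = List.foldr (λ e S → ⁅ e ⁆ ∪ S) ∅

  E : Subset m
  E = Data.Fin.Subset.⊤

  -- Walks u₀ e₁ u₁ … e_l u_l ; each step records the edge and the sign
  -- τ(u_{i-1}, e_i) of the end through which it is left.

  data Walk : Fin n → Fin n → Set where
    []   : ∀ {u} → Walk u u
    step : ∀ {u w x} (e : Fin m) (t : Sign) → StepE (ends e) u t w → Walk w x → Walk u x

  _++ʷ_ : ∀ {u w x} → Walk u w → Walk w x → Walk u x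
  [] ++ʷ W′ = W′
  step e t s W ++ʷ W′ = step e t s (W ++ʷ W′)

  revApp : ∀ {u w x} → Walk u w → Walk u x → Walk w x
  revApp [] acc = acc
  revApp (step e t s W) acc with revStepE (ends e) s
  ... | t′ , s′ = revApp W (step e t′ s′ acc)

  rev : ∀ {u w} → Walk u w → Walk w u
  rev W = revApp W []

  edges : ∀ {u w} → Walk u w → List (Fin m)
  edges [] = []
  edges (step e _ _ W) = e ∷ edges W

  verts : ∀ {u w} → Walk u w → List (Fin n)
  verts {u} [] = u ∷ []
  verts {u} (step _ _ _ W) = u ∷ verts W

  initVerts : ∀ {u w} → Walk u w → List (Fin n)
  initVerts [] = []
  initVerts {u} (step _ _ _ W) = u ∷ initVerts W

  len : ∀ {u w} → Walk u w → ℕ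
  len [] = 0
  len (step _ _ _ W) = suc (len W)

  wSign : ∀ {u w} → Walk u w → Sign
  wSign [] = ₊
  wSign (step e _ _ W) = σ e *ˢ wSign W

  -- Σ_i φ(e_i) σ(W_{0,i-1}) τ(u_{i-1},e_i), with s = sign accumulated so far
  gainAcc : ∀ {u w} → Sign → Walk u w → Carrier
  gainAcc s [] = 0#
  gainAcc s (step e t _ W) = ((s *ˢ t) · φ e) ⊕ gainAcc (s *ˢ σ e) W

  wGain : ∀ {u w} → Walk u w → Carrier
  wGain W = ⊖ gainAcc ₊ W

  -- gain of an ultrawalk that starts with the half edge e₀ (τ(u₀,e₀) = t₀)
  -- and/or ends with the half edge e₁ (τ(u_l,e₁) = t₁)
  startTerm : Fin m → Sign → Carrier
  startTerm e₀ t₀ = t₀ · φ e₀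

  endTerm : ∀ {u w} → Walk u w → Fin m → Sign → Carrier
  endTerm W e₁ t₁ = ⊖ ((wSign W *ˢ t₁) · φ e₁)

  IsCircleWalk : ∀ {u} → Walk u u → Set
  IsCircleWalk W = (len W ≢ 0) × Unique (edges W) × Unique (initVerts W)

  IsPath : ∀ {u w} → Walk u w → Set
  IsPath W = Unique (verts W)

  data FigureAt (a : Fin n) : Set where
    circ  : (W : Walk a a) → IsCircleWalk W → FigureAt a
    halfF : (e : Fin m) (t : Sign) → ends e ≡ half a t → FigureAt a

  figEdges : ∀ {a} → FigureAt a → List (Fin m)
  figEdges (circ W _) = edges W
  figEdges (halfF e _ _) = e ∷ []

  figVerts : ∀ {a} → FigureAt a → List (Fin n)
  figVerts (circ W _) = initVerts W
  figVerts {a} (halfF _ _ _) = a ∷ []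

  figSign : ∀ {a} → FigureAt a → Sign
  figSign (circ W _) = wSign W
  figSign (halfF _ _ _) = ₋

  Figure : Set
  Figure = Σ (Fin n) FigureAt

  figSet : Figure → Subset m
  figSet (_ , f) = setOf (figEdges f)

  IsCircle : Subset m → Set
  IsCircle C = Σ (Fin n) λ a → Σ (Walk a a) λ W → IsCircleWalk W × setOf (edges W) ≡ C

  -- Handcuffs: figures F₁ at a and F₂ at b with at most one common
  -- vertex, and a path P from a to b meeting them only at its ends
  -- (so P has length 0, i.e. a ≡ b, if they meet).

  record Handcuff : Set where
    field
      a b   : Fin n
      F₁    : FigureAt a
      P     : Walk a b
      F₂    : FigureAt b
      path  : IsPath P
      dis₁  : ∀ x → x LM.∈ figVerts F₁ → x LM.∈ verts P → x ≡ a
      dis₂  : ∀ x → x LM.∈ figVerts F₂ → x LM.∈ verts P → x ≡ b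
      dis₁₂ : ∀ x → x LM.∈ figVerts F₁ → x LM.∈ figVerts F₂ → (x ≡ a × a ≡ b)
      edgesDistinct : Unique (figEdges F₁ ++ edges P ++ figEdges F₂)

  hcEdges : Handcuff → List (Fin m)
  hcEdges h = figEdges F₁ ++ edges P ++ figEdges F₂
    where open Handcuff h

  hcGainAux : ∀ {a b} → FigureAt a → Walk a b → FigureAt b → Carrier
  hcGainAux (circ C₁ _) P (circ C₂ _) = wGain (C₁ ++ʷ (P ++ʷ (C₂ ++ʷ rev P)))
  hcGainAux (halfF e₀ t₀ _) P (circ C₂ _) =
    let W = P ++ʷ (C₂ ++ʷ rev P) in (startTerm e₀ t₀ ⊕ wGain W) ⊕ endTerm W e₀ t₀
  hcGainAux (circ C₁ _) P (halfF e₁ t₁ _) =          -- start from the half edge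
    let W = rev P ++ʷ (C₁ ++ʷ P) in (startTerm e₁ t₁ ⊕ wGain W) ⊕ endTerm W e₁ t₁
  hcGainAux (halfF e₀ t₀ _) P (halfF e₁ t₁ _) =
    (startTerm e₀ t₀ ⊕ wGain P) ⊕ endTerm P e₁ t₁

  hcGain : Handcuff → Carrier
  hcGain h = hcGainAux F₁ P F₂
    where open Handcuff h

  data CircuitWalk : Set where
    posCirc : ∀ {a} (W : Walk a a) → IsCircleWalk W → wSign W ≡ ₊ → CircuitWalk
    looseC  : (e : Fin m) → IsLoose e → CircuitWalk
    hcC     : (h : Handcuff) → figSign (Handcuff.F₁ h) ≡ ₋ → figSign (Handcuff.F₂ h) ≡ ₋ → CircuitWalk

  cwEdges : CircuitWalk → List (Fin m)
  cwEdges (posCirc W _ _) = edges W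
  cwEdges (looseC e _) = e ∷ []
  cwEdges (hcC h _ _) = hcEdges h

  cwGain : CircuitWalk → Carrier
  cwGain (posCirc W _ _) = wGain W
  cwGain (looseC e _) = φ e
  cwGain (hcC h _ _) = hcGain h

  IsSignCircuit : Subset m → Set
  IsSignCircuit C = Σ CircuitWalk λ w → setOf (cwEdges w) ≡ C

  -- a sign circuit is neutral if its gain (computed along any of its
  -- circuit walks; well defined up to sign) is 0
  Neutral : Subset m → Set ℓ
  Neutral C = ∀ (w : CircuitWalk) → setOf (cwEdges w) ≡ C → cwGain w ≈ 0#

  Hyperbalanced : Subset m → Set ℓ
  Hyperbalanced S = ∀ C → IsSignCircuit C → C ⊆ S → Neutral C

  Hyperfrustrated : Subset m → Set ℓ
  Hyperfrustrated S = ¬ Hyperbalanced S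

  SignBalanced : Subset m → Set
  SignBalanced S = ∀ (f : Figure) → figSet f ⊆ S → figSign (Data.Product.proj₂ f) ≡ ₊

  NoFigure : Subset m → Set
  NoFigure S = ∀ (f : Figure) → figSet f ⊆ S → ⊥

  Adj : Subset m → Fin n → Fin n → Set
  Adj S u w = Σ (Fin m) λ e → e ∈ S × u LM.∈ endVerts (ends e) × w LM.∈ endVerts (ends e)

  Conn : Subset m → Fin n → Fin n → Set
  Conn S = Star (Adj S)

  IsComponent : Subset m → Subset n → Set
  IsComponent S X = (∃[ u ] u ∈ X) × (∀ u w → u ∈ X → (w ∈ X ⇔ Conn S u w))

  -- the edges of S with an end in X (loose edges excluded)
  edgesAt : Subset m → Subset n → Subset m
  edgesAt S X = S ∩ tabulate (λ e → anyB (lookup X) (endVerts (ends e)))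

  ConnectedOn : Subset n → Subset m → Set
  ConnectedOn X T = ∀ u w → u ∈ X → w ∈ X → Conn T u w

  SpanningTree : Subset n → Subset m → Set
  SpanningTree X T = ConnectedOn X T × NoFigure T

  UnicycleWith : Subset n → Subset m → Figure → Set
  UnicycleWith X U f = ConnectedOn X U × figSet f ⊆ U × (∀ g → figSet g ⊆ U → figSet g ≡ figSet f)

  SignUnbalancedUnicycle : Subset n → Subset m → Set
  SignUnbalancedUnicycle X U = Σ Figure λ f → UnicycleWith X U f × figSign (Data.Product.proj₂ f) ≡ ₋

  -- the components of (V,T) lying in X (T ⊆ edges at X)
  SubComponent : Subset n → Subset m → Subset n → Set
  SubComponent X T Y = IsComponent T Y × Y ⊆ X

  SpanningUnbalUnicycles : Subset n → Subset m → Set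
  SpanningUnbalUnicycles X T =
    ∀ Y → SubComponent X T Y → SignUnbalancedUnicycle Y (edgesAt T Y)

  record Theta : Set where
    field
      x y : Fin n
      x≢y : x ≢ y
      P₁ P₂ P₃ : Walk x y
      path₁ : IsPath P₁
      path₂ : IsPath P₂
      path₃ : IsPath P₃
      edgesDistinct : Unique (edges P₁ ++ edges P₂ ++ edges P₃)
      int₁₂ : ∀ z → z LM.∈ verts P₁ → z LM.∈ verts P₂ → z ≡ x ⊎ z ≡ y
      int₁₃ : ∀ z → z LM.∈ verts P₁ → z LM.∈ verts P₃ → z ≡ x ⊎ z ≡ y
      int₂₃ : ∀ z → z LM.∈ verts P₂ → z LM.∈ verts P₃ → z ≡ x ⊎ z ≡ y

  thetaEdges : Theta → List (Fin m)
  thetaEdges t = edges P₁ ++ edges P₂ ++ edges P₃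
    where open Theta t

  IsThetaOrHandcuff : Subset m → Set
  IsThetaOrHandcuff H =
    (Σ Theta λ t → setOf (thetaEdges t) ≡ H) ⊎ (Σ Handcuff λ h → setOf (hcEdges h) ≡ H)

  SpecialComponent : Subset n → Subset m → Set ℓ
  SpecialComponent Y B₀ =
    ConnectedOn Y B₀
    × (Σ (Subset m) λ H → IsThetaOrHandcuff H × H ⊆ B₀
         × (Σ Figure λ f → figSet f ⊆ H × figSign (Data.Product.proj₂ f) ≡ ₋)
         × (∀ g → figSet g ⊆ B₀ → figSet g ⊆ H))
    × (Σ (Subset m) λ C → IsSignCircuit C × C ⊆ B₀ × ¬ Neutral C)

  -- The matroid M(Υ): rank S = n - b_Σ(S) + δ(S)

  NumBalancedComponents : Subset m → ℕ → Set
  NumBalancedComponents S b =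
    Σ (Fin b → Subset n) λ f → Injective _≡_ _≡_ f
      × (∀ i → IsComponent S (f i) × SignBalanced (edgesAt S (f i)))
      × (∀ X → IsComponent S X → SignBalanced (edgesAt S X) → ∃[ i ] f i ≡ X)

  RankIs : Subset m → ℕ → Set ℓ
  RankIs S r = Σ ℕ λ b → NumBalancedComponents S b × Σ ℕ λ δ →
    ((δ ≡ 0 × Hyperbalanced S) ⊎ (δ ≡ 1 × Hyperfrustrated S)) × (r +ℕ b ≡ n +ℕ δ)

  Independent : Subset m → Set ℓ
  Independent I = RankIs I ∣ I ∣

  IsBasis : Subset m → Set ℓ
  IsBasis B = Independent B × (∀ B′ → B ⊆ B′ → Independent B′ → B′ ≡ B)

  IsComp : Subset n → Set
  IsComp X = IsComponent E X

  EC : Subset n → Subset m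
  EC X = edgesAt E X

  NoLoose : Subset m → Set
  NoLoose B = ∀ e → e ∈ B → ¬ IsLoose e

  GoodComp : Subset m → Subset n → Set
  GoodComp B X =
    (SignBalanced (EC X) → SpanningTree X (B ∩ EC X))
    × (¬ SignBalanced (EC X) → SpanningUnbalUnicycles X (B ∩ EC X))

  CondI : Subset m → Set
  CondI B = (∀ X → IsComp X → GoodComp B X) × NoLoose B

  ExcLoose : Subset m → Set ℓ
  ExcLoose B =
    (∀ X → IsComp X → GoodComp B X)
    × (Σ (Fin m) λ e → e ∈ B × IsLoose e × ¬ Neutral ⁅ e ⁆
         × (∀ e′ → e′ ∈ B → IsLoose e′ → e′ ≡ e))

  ExcBalanced : Subset m → Set ℓ
  ExcBalanced B = NoLoose B × Σ (Subset n) λ X → IsComp X × SignBalanced (EC X)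
    × ¬ NoFigure (EC X)
    × (Σ Figure λ f → UnicycleWith X (B ∩ EC X) f × figSign (Data.Product.proj₂ f) ≡ ₊
         × IsCircle (figSet f) × ¬ Neutral (figSet f))
    × (∀ X′ → IsComp X′ → X′ ≢ X → GoodComp B X′)

  ExcUnbalanced : Subset m → Set ℓ
  ExcUnbalanced B = NoLoose B × Σ (Subset n) λ X → IsComp X × ¬ SignBalanced (EC X)
    × (Σ (Subset n) λ Y → SubComponent X (B ∩ EC X) Y
         × SpecialComponent Y (edgesAt (B ∩ EC X) Y)
         × (∀ Y′ → SubComponent X (B ∩ EC X) Y′ → Y′ ≢ Y →
              SignUnbalancedUnicycle Y′ (edgesAt (B ∩ EC X) Y′)))
    × (∀ X′ → IsComp X′ → X′ ≢ X → GoodComp B X′)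

  CondII : Subset m → Set ℓ
  CondII B = ExcLoose B ⊎ ExcBalanced B ⊎ ExcUnbalanced B

{-# OPTIONS --safe #-}

-- Half edges act as negative loops in the frame matroid, where S has nullity |S| − n + b_Σ(S).
-- An edge added to S raises this nullity iff its ends are already joined in S by a walk of its
-- own sign, or both lie in sign-unbalanced components.  A set of nullity 0 carries a potential θ
-- with φ(e) = τ(v,e)θ(v) + τ(w,e)θ(w) on its edges, hence is hyperbalanced; so an independent set
-- is either of nullity 0, or of nullity 1 and hyperfrustrated.  If e raises the nullity of a set
-- with potential θ, then some sign circuit through e is neutral only if e satisfies the same
-- equation.  A basis of a hyperfrustrated Υ is therefore a basis B′ of the frame matroid plus an
-- edge e violating the equation of B′, and the three exceptional cases say that e is loose, lies
-- in a sign-balanced component, or in a sign-unbalanced one.  Conversely a theta or handcuff has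
-- at most one more edge than vertices, so that it, and with it the whole of B, has nullity at
-- most 1, whereas a non-neutral sign circuit excludes nullity 0.
module Submission where

open import Defs
open import Level using (Level; _⊔_)
open import Algebra.Bundles using (AbelianGroup)
open import Data.Integer using (ℤ; -[1+_])
import Data.Integer as ℤ
import Data.Integer.Properties as ℤₚ
open import Data.Nat using (ℕ; zero; suc; _+_; _≤_; z≤n; s≤s)
import Data.Nat.Properties as ℕₚ
open import Data.Fin using (Fin; zero; suc)
import Data.Fin.Properties as Finₚ
open import Data.Fin.Subset using (Subset; _∈_; _∉_; _⊆_; ⁅_⁆; _∪_; _∩_; ∣_∣; _-_) renaming (⊥ to ∅)
open import Data.Fin.Subset.Properties
  using (_∈?_; ∉⊥; ∈⊤; ∣⊥∣≡0; x∈⁅x⁆; x∈⁅y⁆⇒x≡y; p⊆p∪q; q⊆p∪q; x∈p∪q⁻; x∈p∩q⁻; x∈p∩q⁺; ⊆-antisym; p─q⊆p; p⊆q⇒∣p∣≤∣q∣; x∈p∧x≢y⇒x∈p-y; p─⊥≡p; ⊆⊤; ∪-identityʳ)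
open import Data.Bool using (Bool; true; false)
open import Data.Bool.ListAction using () renaming (any to anyB)
import Data.Vec as Vec
open import Data.Vec using (_∷_; here; there)
import Data.Vec.Properties as Vecₚ
open import Data.List as List using (List; []; _∷_; _++_; length)
import Data.List.Properties as Listₚ
open import Data.List.Membership.Propositional using (find; lose) renaming (_∈_ to _∈ᴸ_; _∉_ to _∉ᴸ_)
open import Data.List.Membership.Propositional.Properties using (∈-++⁺ˡ; ∈-++⁺ʳ; ∈-++⁻; ∈-∃++; ∈-allFin; ∈-concatMap⁺; ∈-concatMap⁻; ∈-lookup; ∈-tabulate⁺; ∈-tabulate⁻)
open import Data.List.Relation.Unary.Any using (here; there; any?; index)
open import Data.List.Relation.Unary.Any.Properties using (lookup-index)
open import Data.List.Relation.Unary.All as All using (All; []; _∷_)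
import Data.List.Relation.Unary.All.Properties as Allₚ
open import Data.List.Relation.Unary.AllPairs using ([]; _∷_)
open import Data.List.Relation.Unary.Unique.Propositional using (Unique)
import Data.List.Relation.Unary.Unique.Propositional.Properties as Uniqueₚ
open import Data.Sign using (Sign) renaming (_*_ to _*ˢ_; + to ₊; - to ₋)
import Data.Sign.Properties as Signₚ
open import Data.Product using (Σ; Σ-syntax; ∃; ∃-syntax; _×_; _,_; proj₁; proj₂)
open import Data.Sum using (_⊎_; inj₁; inj₂; [_,_]′)
open import Data.Empty using (⊥; ⊥-elim)
open import Relation.Nullary using (¬_; Dec; yes; no; does)
open import Relation.Nullary.Decidable using (map′; _×-dec_; ¬?; True; toWitness; dec-true)
open import Relation.Binary.PropositionalEquality using (_≡_; _≢_; refl; sym; trans; cong; cong₂; subst)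
open import Relation.Binary.Construct.Closure.ReflexiveTransitive using (_◅_) renaming (ε to done)
open import Function.Bundles using (_⇔_; mk⇔; Equivalence)

private variable
  ℓ₁ ℓ₂ ℓ₃ : Level
  Elem : Set ℓ₁

∣p∣≡1+∣p-x∣ : ∀ {k} {p : Subset k} {x} → x ∈ p → ∣ p ∣ ≡ suc ∣ p - x ∣
∣p∣≡1+∣p-x∣ {p = true ∷ p} here = cong (λ q → suc ∣ q ∣) (sym (p─⊥≡p p))
∣p∣≡1+∣p-x∣ {p = true ∷ p} (there x∈p) = cong suc (∣p∣≡1+∣p-x∣ x∈p)
∣p∣≡1+∣p-x∣ {p = false ∷ p} (there x∈p) = ∣p∣≡1+∣p-x∣ x∈p

x∉p-x : ∀ {k} (p : Subset k) {x} → x ∉ p - x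
x∉p-x (_ ∷ p) {suc x} (there x∈) = x∉p-x p x∈
x∉p-x (true ∷ p) {zero} ()
x∉p-x (false ∷ p) {zero} ()

∈-─⁻ : ∀ {k} (p : Subset k) {x y} → x ∈ p - y → x ∈ p × x ≢ y
∈-─⁻ p {x} {y} x∈ = p─q⊆p p ⁅ y ⁆ x∈ , λ { refl → x∉p-x p x∈ }

-mono : ∀ {k} {p q : Subset k} {x} → p ⊆ q → p - x ⊆ q - x
-mono {p = p} p⊆q y∈ = let y∈p , y≢ = ∈-─⁻ p y∈ in x∈p∧x≢y⇒x∈p-y (p⊆q y∈p) y≢

subset-rec : ∀ {k} (P : Subset k → Set ℓ₁) →
  (∀ S → (∀ x → x ∈ S → P (S - x)) → P S) → ∀ S → P S
subset-rec P rec S = go ∣ S ∣ S refl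
  where
  go : ∀ j S → ∣ S ∣ ≡ j → P S
  go j S eq = rec S λ x x∈S → case j eq x∈S
    where
    case : ∀ j → ∣ S ∣ ≡ j → ∀ {x} → x ∈ S → P (S - x)
    case zero eq x∈S with trans (sym eq) (∣p∣≡1+∣p-x∣ x∈S)
    ... | ()
    case (suc j) eq x∈S = go j _ (ℕₚ.suc-injective (trans (sym (∣p∣≡1+∣p-x∣ x∈S)) eq))

empty-or-element : ∀ {k} (S : Subset k) → S ≡ ∅ ⊎ ∃[ x ] x ∈ S
empty-or-element Vec.[] = inj₁ refl
empty-or-element (true ∷ S) = inj₂ (zero , here)
empty-or-element (false ∷ S) with empty-or-element S
... | inj₁ refl = inj₁ refl
... | inj₂ (x , x∈) = inj₂ (suc x , there x∈)

full-or-missing : ∀ {k} (S T : Subset k) → S ⊆ T ⊎ ∃[ x ] (x ∈ S × x ∉ T)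
full-or-missing S T with Finₚ.any? (λ x → (x ∈? S) ×-dec ¬? (x ∈? T))
... | yes p = inj₂ p
... | no ¬p = inj₁ λ {x} x∈S → dec x x∈S
  where
  dec : ∀ x → x ∈ S → x ∈ T
  dec x x∈S with x ∈? T
  ... | yes x∈T = x∈T
  ... | no x∉T = ⊥-elim (¬p (x , x∈S , x∉T))

unique-∉ : ∀ {x : Elem} {xs} → Unique (x ∷ xs) → x ∉ᴸ xs
unique-∉ (px ∷ _) x∈ = All.lookup px x∈ refl

unique-∷ : ∀ {x : Elem} {xs} → x ∉ᴸ xs → Unique xs → Unique (x ∷ xs)
unique-∷ x∉ u = All.tabulate (λ y∈ x≡y → x∉ (subst (_∈ᴸ _) (sym x≡y) y∈)) ∷ u

unique-++ : ∀ {xs ys : List Elem} → Unique xs → Unique ys → (∀ x → x ∈ᴸ xs → x ∈ᴸ ys → ⊥) → Unique (xs ++ ys)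
unique-++ u v d = Uniqueₚ.++⁺ u v (λ (p , q) → d _ p q)

unique-++⁻ : ∀ (xs : List Elem) {ys} → Unique (xs ++ ys) →
  Unique xs × Unique ys × (∀ x → x ∈ᴸ xs → x ∈ᴸ ys → ⊥)
unique-++⁻ [] u = [] , u , λ _ ()
unique-++⁻ (x ∷ xs) {ys} (px ∷ u) with unique-++⁻ xs u
... | uxs , uys , d = Allₚ.++⁻ˡ xs px ∷ uxs , uys ,
  λ { _ (here refl) q → All.lookup (Allₚ.++⁻ʳ xs px) q refl ; y (there p) q → d y p q }

length-≤ : ∀ {B : Set ℓ₂} (R : Elem → B → Set ℓ₃) {xs : List Elem} {ys : List B} → Unique xs →
  (∀ x → x ∈ᴸ xs → ∃[ y ] (y ∈ᴸ ys × R x y)) →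
  (∀ {x x′ y} → x ∈ᴸ xs → x′ ∈ᴸ xs → R x y → R x′ y → x ≡ x′) → length xs ≤ length ys
length-≤ R {[]} _ _ _ = z≤n
length-≤ R {x ∷ xs} {ys} (px ∷ u) tot inj with tot x (here refl)
... | y , y∈ , Rxy with ∈-∃++ y∈
... | ys₁ , ys₂ , refl = subst (suc (length xs) ≤_)
    (trans (cong suc (Listₚ.length-++ ys₁)) (trans (sym (ℕₚ.+-suc (length ys₁) _)) (sym (Listₚ.length-++ ys₁))))
    (s≤s (length-≤ R {xs} {ys₁ ++ ys₂} u tot′ (λ p q → inj (there p) (there q))))
  where
  tot′ : ∀ x′ → x′ ∈ᴸ xs → ∃[ y′ ] (y′ ∈ᴸ ys₁ ++ ys₂ × R x′ y′)
  tot′ x′ x′∈ with tot x′ (there x′∈)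
  ... | y′ , y′∈ , Rx′y′ with ∈-++⁻ ys₁ y′∈
  ...   | inj₁ p = y′ , ∈-++⁺ˡ p , Rx′y′
  ...   | inj₂ (there p) = y′ , ∈-++⁺ʳ ys₁ p , Rx′y′
  ...   | inj₂ (here refl) = ⊥-elim (All.lookup px x′∈ (inj (here refl) (there x′∈) Rxy Rx′y′))

unique-length : ∀ {k} {xs : List (Fin k)} → Unique xs → length xs ≤ k
unique-length {k} {xs} u = subst (length xs ≤_) (Listₚ.length-tabulate {n = k} (λ i → i))
  (length-≤ _≡_ u (λ x _ → x , ∈-allFin x , refl) (λ _ _ p q → trans p (sym q)))

¬¬-∀ : ∀ {k} (P : Fin k → Set ℓ₁) → (∀ i → ¬ ¬ P i) → ¬ ¬ (∀ i → P i)
¬¬-∀ {k = zero} P h c = c λ ()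
¬¬-∀ {k = suc k} P h c = h zero λ p₀ → ¬¬-∀ (λ i → P (suc i)) (λ i → h (suc i))
  λ ps → c λ { zero → p₀ ; (suc i) → ps i }

-- Equality of the labels computed by merging classes one pair at a time decides
-- the equivalence relation generated by finitely many pairs.
module Labels {A : Set ℓ₁} (_≟_ : ∀ (x y : A) → Dec (x ≡ y)) where

  merge : A → A → A → A
  merge p q x with x ≟ q
  ... | yes _ = p
  ... | no _ = x

  merge-pair : ∀ p q → merge p q p ≡ merge p q q
  merge-pair p q with p ≟ q | q ≟ q
  ... | yes _ | yes _ = refl
  ... | no _ | yes _ = refl
  ... | _ | no ¬r = ⊥-elim (¬r refl)

  label : List (A × A) → A → A
  label [] x = x
  label ((p , q) ∷ ps) x = merge (label ps p) (label ps q) (label ps x)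

  label-pair : ∀ {ps p q} → (p , q) ∈ᴸ ps → label ps p ≡ label ps q
  label-pair {_ ∷ ps} (here refl) = merge-pair _ _
  label-pair {(p′ , q′) ∷ ps} (there i) = cong (merge _ _) (label-pair i)

  label-sound : (R : A → A → Set ℓ₃) → (∀ x → R x x) → (∀ {x y} → R x y → R y x) →
    (∀ {x y z} → R x y → R y z → R x z) →
    ∀ ps → (∀ {p q} → (p , q) ∈ᴸ ps → R p q) → ∀ x → R x (label ps x)
  label-sound R rfl sy tr [] h x = rfl x
  label-sound R rfl sy tr ((p , q) ∷ ps) h x with label ps x ≟ label ps q
  ... | no _ = label-sound R rfl sy tr ps (λ i → h (there i)) x
  ... | yes eq = tr (rec x) (tr (subst (λ z → R z q) (sym eq) (sy (rec q))) (tr (sy (h (here refl))) (rec p)))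
    where rec = label-sound R rfl sy tr ps (λ i → h (there i))

without : ∀ {x : Elem} {xs} → x ∈ᴸ xs → Unique xs → ∃[ ys ] (Unique ys × length xs ≡ suc (length ys)
  × (∀ {y} → y ∈ᴸ ys → y ∈ᴸ xs × y ≢ x) × (∀ {y} → y ∈ᴸ xs → y ≢ x → y ∈ᴸ ys))
without (here refl) (px ∷ u) = _ , u , refl , (λ y∈ → there y∈ , λ y≡x → All.lookup px y∈ (sym y≡x))
  , λ { (here refl) ne → ⊥-elim (ne refl) ; (there y∈) _ → y∈ }
without {x = x} {z ∷ _} (there x∈) (pz ∷ u) with without x∈ u
... | ys , uys , len , sub , sup = z ∷ ys , unique-∷ (λ z∈ → All.lookup pz (proj₁ (sub z∈)) refl) uys , cong suc len
  , (λ { (here refl) → here refl , (λ { refl → All.lookup pz x∈ refl }) ; (there y∈) → there (proj₁ (sub y∈)) , proj₂ (sub y∈) })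
  , λ { (here refl) _ → here refl ; (there y∈) ne → there (sup y∈ ne) }

-- The ring solvers cannot cancel x − x over a ring without decidable equality, so linear
-- identities are normalised to integer coefficient vectors.
module Linear {a ℓ} (G : AbelianGroup a ℓ) (_·_ : Sign → AbelianGroup.Carrier G → AbelianGroup.Carrier G)
  (₊· : ∀ x → ₊ · x ≡ x) (₋· : ∀ x → ₋ · x ≡ AbelianGroup._⁻¹ G x) where
  open AbelianGroup G using (Carrier; _≈_; _∙_; ε; _⁻¹; setoid; monoid; identityˡ; identityʳ; inverseʳ; ∙-cong; ∙-congˡ; ∙-congʳ; ⁻¹-cong; comm)
    renaming (refl to ≈-refl; sym to ≈-sym; trans to ≈-trans)
  open import Algebra.Properties.AbelianGroup G using (⁻¹-∙-comm; ⁻¹-involutive; ε⁻¹≈ε)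
  open import Algebra.Properties.Monoid.Mult monoid using (×-homo-+) renaming (_×_ to _·ⁿ_)
  open import Algebra.Properties.CommutativeSemigroup (AbelianGroup.commutativeSemigroup G) using (interchange)
  open import Relation.Binary.Reasoning.Setoid setoid

  act : ℤ → Carrier → Carrier
  act (ℤ.+ k) x = k ·ⁿ x
  act -[1+ k ] x = (suc k ·ⁿ x) ⁻¹

  act-⊖ : ∀ j k x → act (j ℤ.⊖ k) x ≈ (j ·ⁿ x) ∙ (k ·ⁿ x) ⁻¹
  act-⊖ j zero x = ≈-sym (≈-trans (∙-congˡ ε⁻¹≈ε) (identityʳ _))
  act-⊖ zero (suc k) x = ≈-sym (identityˡ _)
  act-⊖ (suc j) (suc k) x rewrite ℤₚ.[1+m]⊖[1+n]≡m⊖n j k = begin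
    act (j ℤ.⊖ k) x ≈⟨ act-⊖ j k x ⟩
    (j ·ⁿ x) ∙ (k ·ⁿ x) ⁻¹ ≈⟨ identityˡ _ ⟨
    ε ∙ ((j ·ⁿ x) ∙ (k ·ⁿ x) ⁻¹) ≈⟨ ∙-congʳ (inverseʳ x) ⟨
    (x ∙ x ⁻¹) ∙ ((j ·ⁿ x) ∙ (k ·ⁿ x) ⁻¹) ≈⟨ interchange _ _ _ _ ⟩
    (x ∙ (j ·ⁿ x)) ∙ (x ⁻¹ ∙ (k ·ⁿ x) ⁻¹) ≈⟨ ∙-congˡ (⁻¹-∙-comm _ _) ⟩
    (x ∙ (j ·ⁿ x)) ∙ (x ∙ (k ·ⁿ x)) ⁻¹       ∎

  act-+ : ∀ i j x → act (i ℤ.+ j) x ≈ act i x ∙ act j x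
  act-+ (ℤ.+ j) (ℤ.+ k) x = ×-homo-+ x j k
  act-+ (ℤ.+ j) -[1+ k ] x = act-⊖ j (suc k) x
  act-+ -[1+ j ] (ℤ.+ k) x = ≈-trans (act-⊖ k (suc j) x) (comm _ _)
  act-+ -[1+ j ] -[1+ k ] x = begin
    (suc (suc (j + k)) ·ⁿ x) ⁻¹ ≡⟨ cong (λ i → (i ·ⁿ x) ⁻¹) (cong suc (sym (ℕₚ.+-suc j k))) ⟩
    ((suc j + suc k) ·ⁿ x) ⁻¹ ≈⟨ ⁻¹-cong (×-homo-+ x (suc j) (suc k)) ⟩
    ((suc j ·ⁿ x) ∙ (suc k ·ⁿ x)) ⁻¹ ≈⟨ ⁻¹-∙-comm _ _ ⟨
    (suc j ·ⁿ x) ⁻¹ ∙ (suc k ·ⁿ x) ⁻¹     ∎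

  act-neg : ∀ i x → act (ℤ.- i) x ≈ act i x ⁻¹
  act-neg (ℤ.+ zero) x = ≈-sym ε⁻¹≈ε
  act-neg (ℤ.+ suc k) x = ≈-refl
  act-neg -[1+ k ] x = ≈-sym (⁻¹-involutive _)

  data Expr (k : ℕ) : Set where
    var : Fin k → Expr k
    _:+_ : Expr k → Expr k → Expr k
    :-_ : Expr k → Expr k
    :0 : Expr k
    _:·_ : Sign → Expr k → Expr k

  infixl 6 _:+_
  infix 8 :-_
  infixr 7 _:·_

  eval : ∀ {k} → Vec.Vec Carrier k → Expr k → Carrier
  eval ρ (var i) = Vec.lookup ρ i
  eval ρ (p :+ q) = eval ρ p ∙ eval ρ q
  eval ρ (:- p) = eval ρ p ⁻¹
  eval ρ :0 = ε
  eval ρ (s :· p) = s · eval ρ p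

  unit : ∀ {k} → Fin k → Vec.Vec ℤ k
  unit zero = ℤ.+ 1 ∷ Vec.replicate _ (ℤ.+ 0)
  unit (suc i) = ℤ.+ 0 ∷ unit i

  normal : ∀ {k} → Expr k → Vec.Vec ℤ k
  normal (var i) = unit i
  normal (p :+ q) = Vec.zipWith ℤ._+_ (normal p) (normal q)
  normal (:- p) = Vec.map ℤ.-_ (normal p)
  normal :0 = Vec.replicate _ (ℤ.+ 0)
  normal (₊ :· p) = normal p
  normal (₋ :· p) = Vec.map ℤ.-_ (normal p)

  combine : ∀ {k} → Vec.Vec ℤ k → Vec.Vec Carrier k → Carrier
  combine Vec.[] Vec.[] = ε
  combine (i ∷ is) (x ∷ ρ) = act i x ∙ combine is ρ

  combine-0 : ∀ {k} (ρ : Vec.Vec Carrier k) → combine (Vec.replicate _ (ℤ.+ 0)) ρ ≈ ε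
  combine-0 Vec.[] = ≈-refl
  combine-0 (x ∷ ρ) = ≈-trans (identityˡ _) (combine-0 ρ)

  combine-unit : ∀ {k} (i : Fin k) ρ → combine (unit i) ρ ≈ Vec.lookup ρ i
  combine-unit zero (x ∷ ρ) = ≈-trans (∙-cong (identityʳ x) (combine-0 ρ)) (identityʳ x)
  combine-unit (suc i) (x ∷ ρ) = ≈-trans (identityˡ _) (combine-unit i ρ)

  combine-+ : ∀ {k} (is js : Vec.Vec ℤ k) ρ → combine (Vec.zipWith ℤ._+_ is js) ρ ≈ combine is ρ ∙ combine js ρ
  combine-+ Vec.[] Vec.[] Vec.[] = ≈-sym (identityˡ ε)
  combine-+ (i ∷ is) (j ∷ js) (x ∷ ρ) = ≈-trans (∙-cong (act-+ i j x) (combine-+ is js ρ)) (interchange _ _ _ _)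

  combine-neg : ∀ {k} (is : Vec.Vec ℤ k) ρ → combine (Vec.map ℤ.-_ is) ρ ≈ combine is ρ ⁻¹
  combine-neg Vec.[] Vec.[] = ≈-sym ε⁻¹≈ε
  combine-neg (i ∷ is) (x ∷ ρ) = ≈-trans (∙-cong (act-neg i x) (combine-neg is ρ)) (⁻¹-∙-comm _ _)

  normal-sound : ∀ {k} (p : Expr k) ρ → combine (normal p) ρ ≈ eval ρ p
  normal-sound (var i) ρ = combine-unit i ρ
  normal-sound (p :+ q) ρ = ≈-trans (combine-+ (normal p) (normal q) ρ) (∙-cong (normal-sound p ρ) (normal-sound q ρ))
  normal-sound (:- p) ρ = ≈-trans (combine-neg (normal p) ρ) (⁻¹-cong (normal-sound p ρ))
  normal-sound :0 ρ = combine-0 ρ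
  normal-sound (₊ :· p) ρ = subst (λ y → combine (normal p) ρ ≈ y) (sym (₊· _)) (normal-sound p ρ)
  normal-sound (₋ :· p) ρ = subst (λ y → combine (Vec.map ℤ.-_ (normal p)) ρ ≈ y) (sym (₋· _))
    (≈-trans (combine-neg (normal p) ρ) (⁻¹-cong (normal-sound p ρ)))

  SignFun : ℕ → Set → Set
  SignFun zero X = X
  SignFun (suc j) X = Sign → SignFun j X

  Claim : ∀ {k} j → Vec.Vec Carrier k → SignFun j (Expr k) → SignFun j (Expr k) → Set ℓ
  Claim zero ρ p q = eval ρ p ≈ eval ρ q
  Claim (suc j) ρ p q = ∀ s → Claim j ρ (p s) (q s)

  SameNormal : ∀ {k} j → SignFun j (Expr k) → SignFun j (Expr k) → Set
  SameNormal zero p q = normal p ≡ normal q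
  SameNormal (suc j) p q = SameNormal j (p ₊) (q ₊) × SameNormal j (p ₋) (q ₋)

  sameNormal? : ∀ {k} j (p q : SignFun j (Expr k)) → Dec (SameNormal j p q)
  sameNormal? zero p q = Vecₚ.≡-dec ℤₚ._≟_ (normal p) (normal q)
  sameNormal? (suc j) p q = sameNormal? j (p ₊) (q ₊) ×-dec sameNormal? j (p ₋) (q ₋)

  prove : ∀ {k} j (ρ : Vec.Vec Carrier k) (p q : SignFun j (Expr k)) → SameNormal j p q → Claim j ρ p q
  prove zero ρ p q eq = ≈-trans (≈-sym (normal-sound p ρ)) (subst (λ v → combine v ρ ≈ eval ρ q) (sym eq) (normal-sound q ρ))
  prove (suc j) ρ p q (e₊ , e₋) ₊ = prove j ρ (p ₊) (q ₊) e₊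
  prove (suc j) ρ p q (e₊ , e₋) ₋ = prove j ρ (p ₋) (q ₋) e₋

  solve : ∀ {k} j (ρ : Vec.Vec Carrier k) (p q : SignFun j (Expr k)) → {True (sameNormal? j p q)} → Claim j ρ p q
  solve j ρ p q {t} = prove j ρ p q (toWitness t)

∈-++⁻³ : ∀ {P : Set ℓ₂} (xs ys : List Elem) {zs x} → (x ∈ᴸ xs → P) → (x ∈ᴸ ys → P) → (x ∈ᴸ zs → P) → x ∈ᴸ xs ++ ys ++ zs → P
∈-++⁻³ xs ys f g h i = [ f , (λ j → [ g , h ]′ (∈-++⁻ ys j)) ]′ (∈-++⁻ xs i)

module Main {κ ℓ : Level} (F : Field κ ℓ) (char≠2 : CharNot2 F) {n m : ℕ} (Υ : GainSignedGraph F n m) where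
  open GainSignedGraph Υ
  open GS F Υ

  -- Signed connectivity

  HopE : Ends n → Fin n → Fin n → Set
  HopE (link v w _ _ _) u x = (u ≡ v × x ≡ w) ⊎ (u ≡ w × x ≡ v)
  HopE (loop v _ _) u x = u ≡ v × x ≡ v
  HopE (half v _) u x = u ≡ v × x ≡ v
  HopE loose _ _ = ⊥

  Hop : Fin m → Fin n → Fin n → Set
  Hop e = HopE (ends e)

  hop-symE : ∀ k {u x} → HopE k u x → HopE k x u
  hop-symE (link _ _ _ _ _) (inj₁ (p , q)) = inj₂ (q , p)
  hop-symE (link _ _ _ _ _) (inj₂ (p , q)) = inj₁ (q , p)
  hop-symE (loop _ _ _) (p , q) = q , p
  hop-symE (half _ _) (p , q) = q , p

  hop-sym : ∀ {e u x} → Hop e u x → Hop e x u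
  hop-sym {e} = hop-symE (ends e)

  hop-uniqueE : ∀ k {v w u x} → HopE k v w → HopE k u x → (u ≡ v × x ≡ w) ⊎ (u ≡ w × x ≡ v)
  hop-uniqueE (link _ _ _ _ _) (inj₁ (refl , refl)) h = h
  hop-uniqueE (link _ _ _ _ _) (inj₂ (refl , refl)) (inj₁ h) = inj₂ h
  hop-uniqueE (link _ _ _ _ _) (inj₂ (refl , refl)) (inj₂ h) = inj₁ h
  hop-uniqueE (loop _ _ _) (refl , refl) h = inj₁ h
  hop-uniqueE (half _ _) (refl , refl) h = inj₁ h

  hop-unique : ∀ e {v w u x} → Hop e v w → Hop e u x → (u ≡ v × x ≡ w) ⊎ (u ≡ w × x ≡ v)
  hop-unique e = hop-uniqueE (ends e)

  loose-or-hopE : ∀ k → k ≡ loose ⊎ ∃[ v ] ∃[ w ] HopE k v w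
  loose-or-hopE (link v w _ _ _) = inj₂ (v , w , inj₁ (refl , refl))
  loose-or-hopE (loop v _ _) = inj₂ (v , v , refl , refl)
  loose-or-hopE (half v _) = inj₂ (v , v , refl , refl)
  loose-or-hopE loose = inj₁ refl

  loose-or-hop : ∀ e → IsLoose e ⊎ ∃[ v ] ∃[ w ] Hop e v w
  loose-or-hop e = loose-or-hopE (ends e)

  loose-no-hop : ∀ {e u x} → IsLoose e → Hop e u x → ⊥
  loose-no-hop {e} {u} {x} l h = subst (λ k → HopE k u x) l h

  -- SC S u s w: some walk of sign s joins u to w in S, where half edges may be
  -- traversed like negative loops.
  data SC (S : Subset m) : Fin n → Sign → Fin n → Set where
    nil : ∀ {u} → SC S u ₊ u
    cons : ∀ {e u w s x} → e ∈ S → Hop e u w → SC S w s x → SC S u (σ e *ˢ s) x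

  Joined : Subset m → Fin n → Fin n → Set
  Joined S u w = ∃[ s ] SC S u s w

  Unb : Subset m → Fin n → Set
  Unb S u = SC S u ₋ u

  sc-mono : ∀ {S T} → S ⊆ T → ∀ {u s w} → SC S u s w → SC T u s w
  sc-mono i nil = nil
  sc-mono i (cons e∈ h c) = cons (i e∈) h (sc-mono i c)

  sc-cast : ∀ {S u a b w} → a ≡ b → SC S u a w → SC S u b w
  sc-cast refl c = c

  sc-trans : ∀ {S u a w b x} → SC S u a w → SC S w b x → SC S u (a *ˢ b) x
  sc-trans nil d = d
  sc-trans (cons {e} {s = s} e∈ h c) d = sc-cast (sym (Signₚ.*-assoc (σ e) s _)) (cons e∈ h (sc-trans c d))

  sc-hop : ∀ {S e u w} → e ∈ S → Hop e u w → SC S u (σ e) w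
  sc-hop {e = e} e∈ h = sc-cast (Signₚ.*-identityʳ (σ e)) (cons e∈ h nil)

  sc-sym : ∀ {S u a w} → SC S u a w → SC S w a u
  sc-sym nil = nil
  sc-sym (cons {e} {s = s} e∈ h c) = sc-cast (Signₚ.*-comm s (σ e)) (sc-trans (sc-sym c) (sc-hop e∈ (hop-sym {e} h)))

  joined-trans : ∀ {S u w x} → Joined S u w → Joined S w x → Joined S u x
  joined-trans (_ , c) (_ , d) = _ , sc-trans c d

  joined-sym : ∀ {S u w} → Joined S u w → Joined S w u
  joined-sym (_ , c) = _ , sc-sym c

  joined-mono : ∀ {S T} → S ⊆ T → ∀ {u w} → Joined S u w → Joined T u w
  joined-mono i (_ , c) = _ , sc-mono i c

  sign-conj : ∀ a → a *ˢ (₋ *ˢ a) ≡ ₋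
  sign-conj ₊ = refl
  sign-conj ₋ = refl

  unb-resp : ∀ {S u w} → Joined S u w → Unb S w → Unb S u
  unb-resp (a , c) d = sc-cast (sign-conj a) (sc-trans c (sc-trans d (sc-sym c)))

  ≡-or-opposite : ∀ a b → a ≡ b ⊎ a *ˢ b ≡ ₋
  ≡-or-opposite ₊ ₊ = inj₁ refl
  ≡-or-opposite ₊ ₋ = inj₂ refl
  ≡-or-opposite ₋ ₊ = inj₂ refl
  ≡-or-opposite ₋ ₋ = inj₁ refl

  sc-sign : ∀ {S u w a b} → SC S u a w → SC S u b w → a ≡ b ⊎ Unb S u
  sc-sign {a = a} {b} c d with ≡-or-opposite a b
  ... | inj₁ eq = inj₁ eq
  ... | inj₂ eq = inj₂ (sc-cast eq (sc-trans c (sc-sym d)))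

  Node : Set
  Node = Fin n × Sign

  node≟ : ∀ (x y : Node) → Dec (x ≡ y)
  node≟ (u , s) (w , t) = map′ (λ { (refl , refl) → refl }) (λ { refl → refl , refl }) ((u Finₚ.≟ w) ×-dec (s Signₚ.≟ t))

  open Labels node≟

  lifts : Fin n → Sign → Fin n → List (Node × Node)
  lifts v s w = ((v , ₊) , (w , s)) ∷ ((v , ₋) , (w , ₋ *ˢ s)) ∷ []

  pairsE : Ends n → List (Node × Node)
  pairsE k@(link v w _ _ _) = lifts v (signOf k) w
  pairsE k@(loop v _ _) = lifts v (signOf k) v
  pairsE k@(half v _) = lifts v (signOf k) v
  pairsE loose = []

  pairsOf : Subset m → Fin m → List (Node × Node)
  pairsOf S e with e ∈? S
  ... | yes _ = pairsE (ends e)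
  ... | no _ = []

  pairs : Subset m → List (Node × Node)
  pairs S = List.concatMap (pairsOf S) (List.allFin m)

  Cover : Subset m → Node → Node → Set
  Cover S (u , s) (w , t) = SC S u (s *ˢ t) w

  lifts-step : ∀ v s w t → ∃[ p ] ∃[ q ] ((p , q) ∈ᴸ lifts v s w × p ≡ (v , t) × q ≡ (w , t *ˢ s))
  lifts-step v s w ₊ = _ , _ , here refl , refl , refl
  lifts-step v s w ₋ = _ , _ , there (here refl) , refl , refl

  pairsE-hop : ∀ k {u w} t → HopE k u w → ((u , t) , (w , t *ˢ signOf k)) ∈ᴸ pairsE k ⊎ ((w , t *ˢ signOf k) , (u , t)) ∈ᴸ pairsE k
  pairsE-hop k@(link v w _ _ _) t (inj₁ (refl , refl)) with lifts-step v (signOf k) w t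
  ... | _ , _ , i , refl , refl = inj₁ i
  pairsE-hop k@(link v w _ _ _) t (inj₂ (refl , refl)) with lifts-step v (signOf k) w (t *ˢ signOf k)
  ... | _ , _ , i , refl , refl = inj₂ (subst (λ z → ((v , t *ˢ signOf k) , (w , z)) ∈ᴸ pairsE k) (aux t (signOf k)) i)
    where
    aux : ∀ a b → (a *ˢ b) *ˢ b ≡ a
    aux ₊ ₊ = refl
    aux ₊ ₋ = refl
    aux ₋ ₊ = refl
    aux ₋ ₋ = refl
  pairsE-hop k@(loop v _ _) t (refl , refl) with lifts-step v (signOf k) v t
  ... | _ , _ , i , refl , refl = inj₁ i
  pairsE-hop k@(half v _) t (refl , refl) with lifts-step v (signOf k) v t
  ... | _ , _ , i , refl , refl = inj₁ i

  lifts-sound : ∀ {v s w p q} → (p , q) ∈ᴸ lifts v s w → proj₁ p ≡ v × proj₁ q ≡ w × proj₂ p *ˢ proj₂ q ≡ s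
  lifts-sound (here refl) = refl , refl , refl
  lifts-sound {s = ₊} (there (here refl)) = refl , refl , refl
  lifts-sound {s = ₋} (there (here refl)) = refl , refl , refl

  pairsE-sound : ∀ k {p q} → (p , q) ∈ᴸ pairsE k → HopE k (proj₁ p) (proj₁ q) × proj₂ p *ˢ proj₂ q ≡ signOf k
  pairsE-sound k@(link v w _ _ _) i with lifts-sound i
  ... | refl , refl , eq = inj₁ (refl , refl) , eq
  pairsE-sound k@(loop v _ _) i with lifts-sound i
  ... | refl , refl , eq = (refl , refl) , eq
  pairsE-sound k@(half v _) i with lifts-sound i
  ... | refl , refl , eq = (refl , refl) , eq

  pairsOf-sound : ∀ S e {p q} → (p , q) ∈ᴸ pairsOf S e → Cover S p q
  pairsOf-sound S e i with e ∈? S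
  ... | yes e∈ with pairsE-sound (ends e) i
  ...   | h , eq = sc-cast (sym eq) (sc-hop e∈ h)

  pairs-∋ : ∀ S {e} → e ∈ S → ∀ {pq} → pq ∈ᴸ pairsE (ends e) → pq ∈ᴸ pairs S
  pairs-∋ S {e} e∈ i = ∈-concatMap⁺ (pairsOf S) (lose (∈-allFin e) (aux i))
    where
    aux : ∀ {pq} → pq ∈ᴸ pairsE (ends e) → pq ∈ᴸ pairsOf S e
    aux i with e ∈? S
    ... | yes _ = i
    ... | no e∉ = ⊥-elim (e∉ e∈)

  label-sc : ∀ {S u s w} → SC S u s w → ∀ t → label (pairs S) (u , t) ≡ label (pairs S) (w , t *ˢ s)
  label-sc {S} {u} nil t = cong (λ z → label (pairs S) (u , z)) (sym (Signₚ.*-identityʳ t))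
  label-sc {S} {w = w} (cons {e} {s = s} e∈ h c) t =
    trans (hop-label (pairsE-hop (ends e) t h)) (trans (label-sc c _) (cong (λ z → label (pairs S) (w , z)) (Signₚ.*-assoc t (σ e) s)))
    where
    hop-label : ∀ {p q} → (p , q) ∈ᴸ pairsE (ends e) ⊎ (q , p) ∈ᴸ pairsE (ends e) → label (pairs S) p ≡ label (pairs S) q
    hop-label (inj₁ i) = label-pair (pairs-∋ S e∈ i)
    hop-label (inj₂ i) = sym (label-pair (pairs-∋ S e∈ i))

  cover-refl : ∀ {S} x → Cover S x x
  cover-refl (u , s) = sc-cast (sym (Signₚ.s*s≡+ s)) nil

  cover-sym : ∀ {S} x y → Cover S x y → Cover S y x
  cover-sym (u , s) (w , t) c = sc-cast (Signₚ.*-comm s t) (sc-sym c)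

  cover-trans : ∀ {S} x y z → Cover S x y → Cover S y z → Cover S x z
  cover-trans (_ , s) (_ , t) (_ , r) c d = sc-cast (aux s t r) (sc-trans c d)
    where
    aux : ∀ a b c → (a *ˢ b) *ˢ (b *ˢ c) ≡ a *ˢ c
    aux a b c = trans (Signₚ.*-assoc a b _) (cong (a *ˢ_) (trans (sym (Signₚ.*-assoc b b c)) (cong (_*ˢ c) (Signₚ.s*s≡+ b))))

  cover-label : ∀ S x → Cover S x (label (pairs S) x)
  cover-label S = label-sound (Cover S) cover-refl (λ {x} {y} → cover-sym x y) (λ {x} {y} {z} → cover-trans x y z) (pairs S) λ i →
    let e , _ , j = find (∈-concatMap⁻ (pairsOf S) {xs = List.allFin m} i) in pairsOf-sound S e j

  sc? : ∀ S u s w → Dec (SC S u s w)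
  sc? S u s w = map′ to (λ c → label-sc c ₊) (node≟ (label (pairs S) (u , ₊)) (label (pairs S) (w , s)))
    where
    to : label (pairs S) (u , ₊) ≡ label (pairs S) (w , s) → SC S u s w
    to eq = cover-trans (u , ₊) _ (w , s) (cover-label S (u , ₊))
      (subst (λ y → Cover S y (w , s)) (sym eq) (cover-sym (w , s) _ (cover-label S (w , s))))

  joined? : ∀ S u w → Dec (Joined S u w)
  joined? S u w with sc? S u ₊ w | sc? S u ₋ w
  ... | yes c | _ = yes (₊ , c)
  ... | no _ | yes c = yes (₋ , c)
  ... | no ¬c | no ¬d = no λ { (₊ , c) → ¬c c ; (₋ , d) → ¬d d }

  unb? : ∀ S u → Dec (Unb S u)
  unb? S u = sc? S u ₋ u

  -- Adding e to S leaves the rank of the frame matroid unchanged.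
  NoDrop : Subset m → Fin m → Set
  NoDrop S e = ∀ {u w} → Hop e u w → SC S u (σ e) w ⊎ (Unb S u × Unb S w)

  record Drop (S : Subset m) (e : Fin m) : Set where
    constructor mkDrop
    field
      {v w} : Fin n
      hop : Hop e v w
      ¬sc : ¬ SC S v (σ e) w
      ¬unb : ¬ Unb S v

  noDrop-mono : ∀ {S T e} → S ⊆ T → NoDrop S e → NoDrop T e
  noDrop-mono i nd h with nd h
  ... | inj₁ c = inj₁ (sc-mono i c)
  ... | inj₂ (c , d) = inj₂ (sc-mono i c , sc-mono i d)

  noDrop-hop : ∀ {S e v w} → Hop e v w → SC S v (σ e) w ⊎ (Unb S v × Unb S w) → NoDrop S e
  noDrop-hop {e = e} h r g with hop-unique e h g
  ... | inj₁ (refl , refl) = r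
  noDrop-hop h (inj₁ c) g | inj₂ (refl , refl) = inj₁ (sc-sym c)
  noDrop-hop h (inj₂ (c , d)) g | inj₂ (refl , refl) = inj₂ (d , c)

  noDrop-or-drop : ∀ S e → NoDrop S e ⊎ Drop S e
  noDrop-or-drop S e with loose-or-hop e
  ... | inj₁ l = inj₁ λ h → ⊥-elim (loose-no-hop {e} l h)
  ... | inj₂ (v , w , h) with sc? S v (σ e) w | unb? S v | unb? S w
  ...   | yes c | _ | _ = inj₁ (noDrop-hop h (inj₁ c))
  ...   | no _ | yes p | yes q = inj₁ (noDrop-hop h (inj₂ (p , q)))
  ...   | no ¬c | no ¬p | _ = inj₂ (mkDrop h ¬c ¬p)
  ...   | no ¬c | yes _ | no ¬q = inj₂ (mkDrop (hop-sym {e} h) (λ c → ¬c (sc-sym c)) ¬q)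

  sc-spanned : ∀ {S T} → (∀ {e} → e ∈ T → e ∉ S → NoDrop S e) →
    ∀ {u s x} → SC T u s x → SC S u s x ⊎ (Unb S u × Unb S x)
  sc-spanned sp nil = inj₁ nil
  sc-spanned {S} sp (cons {e} e∈ h c) with e ∈? S | sc-spanned sp c
  ... | yes e∈S | inj₁ c′ = inj₁ (cons e∈S h c′)
  ... | yes e∈S | inj₂ (p , q) = inj₂ (unb-resp (_ , sc-hop e∈S h) p , q)
  ... | no e∉S | r with sp e∈ e∉S h
  ...   | inj₁ d with r
  ...     | inj₁ c′ = inj₁ (sc-trans d c′)
  ...     | inj₂ (p , q) = inj₂ (unb-resp (_ , d) p , q)
  sc-spanned sp (cons e∈ h c) | no e∉S | r | inj₂ (p , q) with r
  ...     | inj₁ c′ = inj₂ (p , unb-resp (_ , sc-sym c′) q)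
  ...     | inj₂ (_ , q′) = inj₂ (p , q′)

  ∈-split : ∀ {T : Subset m} {x} e → x ∈ T → x ≡ e ⊎ x ∈ T - e
  ∈-split {T} {x} e x∈ with x Finₚ.≟ e
  ... | yes eq = inj₁ eq
  ... | no ne = inj₂ (x∈p∧x≢y⇒x∈p-y x∈ ne)

  ∉-split : ∀ {T : Subset m} {x e} → x ∈ T → x ∉ T - e → x ≡ e
  ∉-split {e = e} x∈ x∉ with ∈-split e x∈
  ... | inj₁ eq = eq
  ... | inj₂ i = ⊥-elim (x∉ i)

  T-x⊆T : ∀ {T : Subset m} {e} → T - e ⊆ T
  T-x⊆T {T} {e} = p─q⊆p T ⁅ e ⁆

  Through : Subset m → Sign → Fin n → Fin n → Fin n → Sign → Fin n → Set
  Through S σe v w u s x = SC S u s x ⊎ ∃[ a ] ∃[ b ] (SC S u a w × SC S v b x × s ≡ a *ˢ (σe *ˢ b))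

  -- A walk leaving a component that e joins to the balanced component of v uses e
  -- only to enter the latter and to come back from v itself.
  sc-drop : ∀ {T e} (d : Drop (T - e) e) {u} → ¬ Joined (T - e) u (Drop.v d) →
    ∀ {s x} → SC T u s x → Through (T - e) (σ e) (Drop.v d) (Drop.w d) u s x
  sc-drop {T} {e} (mkDrop {v} {w} hop ¬sc ¬unb) {u} ¬j c = go (inj₁ nil) c
    where
    S = T - e
    R = Through S (σ e) v w u
    eq₁ : ∀ a b c d → (a *ˢ (b *ˢ c)) *ˢ d ≡ a *ˢ (b *ˢ (c *ˢ d))
    eq₁ a b c d = trans (Signₚ.*-assoc a _ d) (cong (a *ˢ_) (Signₚ.*-assoc b c d))
    eq₂ : ∀ a b → (a *ˢ (b *ˢ ₊)) *ˢ b ≡ a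
    eq₂ ₊ ₊ = refl
    eq₂ ₊ ₋ = refl
    eq₂ ₋ ₊ = refl
    eq₂ ₋ ₋ = refl
    hopR : ∀ {s x y f} → R s x → f ∈ T → Hop f x y → R (s *ˢ σ f) y
    hopR {f = f} r f∈ h with ∈-split e f∈
    hopR (inj₁ c) f∈ h | inj₂ f∈S = inj₁ (sc-trans c (sc-hop f∈S h))
    hopR {f = f} (inj₂ (a , b , c , d , refl)) f∈ h | inj₂ f∈S =
      inj₂ (a , b *ˢ σ f , c , sc-trans d (sc-hop f∈S h) , eq₁ a (σ e) b (σ f))
    hopR r f∈ h | inj₁ refl with hop-unique e hop h
    hopR (inj₁ c) f∈ h | inj₁ refl | inj₁ (refl , refl) = ⊥-elim (¬j (_ , c))
    hopR {s} (inj₁ c) f∈ h | inj₁ refl | inj₂ (refl , refl) =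
      inj₂ (s , ₊ , c , nil , cong (s *ˢ_) (sym (Signₚ.*-identityʳ (σ e))))
    hopR (inj₂ (a , ₊ , c , d , refl)) f∈ h | inj₁ refl | inj₁ (refl , refl) =
      inj₁ (sc-cast (sym (eq₂ a (σ e))) c)
    hopR (inj₂ (a , ₋ , c , d , refl)) f∈ h | inj₁ refl | inj₁ (refl , refl) = ⊥-elim (¬unb d)
    hopR (inj₂ (a , b , c , d , refl)) f∈ h | inj₁ refl | inj₂ (refl , refl) = ⊥-elim (¬j (_ , sc-trans c (sc-sym d)))
    go : ∀ {s t x y} → R s x → SC T x t y → R (s *ˢ t) y
    go {s} r nil = subst (λ t → R t _) (sym (Signₚ.*-identityʳ s)) r
    go {s} r (cons {f} {s = t} f∈ h c) = subst (λ t → R t _) (Signₚ.*-assoc s (σ f) t) (go (hopR r f∈ h) c)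

  -- Frame nullity

  -- The length of a transversal is b_Σ(S).
  record Transversal (S : Subset m) (L : List (Fin n)) : Set where
    field
      unique : Unique L
      balanced : ∀ {u} → u ∈ᴸ L → ¬ Unb S u
      apart : ∀ {u w} → u ∈ᴸ L → w ∈ᴸ L → Joined S u w → u ≡ w
      covers : ∀ {u} → ¬ Unb S u → ∃[ w ] (w ∈ᴸ L × Joined S u w)

  transversal-length : ∀ {S L L′} → Transversal S L → Transversal S L′ → length L ≡ length L′
  transversal-length {S} t t′ = ℕₚ.≤-antisym (le t t′) (le t′ t)
    where
    le : ∀ {L L′} → Transversal S L → Transversal S L′ → length L ≤ length L′
    le t t′ = length-≤ (Joined S) (Transversal.unique t)
      (λ x x∈ → Transversal.covers t′ (Transversal.balanced t x∈))
      λ x∈ x′∈ p q → Transversal.apart t x∈ x′∈ (joined-trans p (joined-sym q))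

  transversal-noDrop : ∀ {T e L} → NoDrop (T - e) e → Transversal (T - e) L → Transversal T L
  transversal-noDrop {T} {e} {L} nd t = record
    { unique = unique
    ; balanced = λ u∈ c → balanced u∈ ([ (λ d → d) , proj₁ ]′ (spanned c))
    ; apart = λ u∈ w∈ (_ , c) → [ (λ d → apart u∈ w∈ (_ , d)) , (λ d → ⊥-elim (balanced u∈ (proj₁ d))) ]′ (spanned c)
    ; covers = λ ¬unb → let w , w∈ , j = covers (λ c → ¬unb (sc-mono T-x⊆T c)) in w , w∈ , joined-mono T-x⊆T j }
    where
    open Transversal t
    spanned : ∀ {u s x} → SC T u s x → SC (T - e) u s x ⊎ (Unb (T - e) u × Unb (T - e) x)
    spanned = sc-spanned λ f∈ f∉ → subst (NoDrop _) (sym (∉-split f∈ f∉)) nd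

  transversal-drop : ∀ {T e L} → e ∈ T → Drop (T - e) e → Transversal (T - e) L →
    ∃[ L′ ] (Transversal T L′ × length L ≡ suc (length L′))
  transversal-drop {T} {e} {L} e∈ d@(mkDrop {v} {w} hop ¬sc ¬unbv) t
    with Transversal.covers t ¬unbv
  ... | r , r∈ , v~r with without r∈ (Transversal.unique t)
  ... | L′ , uniq′ , len , sub , sup = L′ , record
    { unique = uniq′ ; balanced = bal′ ; apart = apart′ ; covers = covers′ } , len
    where
    open Transversal t
    S = T - e
    far : ∀ {u} → u ∈ᴸ L′ → ¬ Joined S u v
    far u∈ j = proj₂ (sub u∈) (apart (proj₁ (sub u∈)) r∈ (joined-trans j v~r))
    bal′ : ∀ {u} → u ∈ᴸ L′ → ¬ Unb T u
    bal′ u∈ c with sc-drop d (far u∈) c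
    ... | inj₁ c′ = balanced (proj₁ (sub u∈)) c′
    ... | inj₂ (_ , _ , _ , d′ , _) = far u∈ (_ , sc-sym d′)
    apart′ : ∀ {u x} → u ∈ᴸ L′ → x ∈ᴸ L′ → Joined T u x → u ≡ x
    apart′ u∈ x∈ (_ , c) with sc-drop d (far u∈) c
    ... | inj₁ c′ = apart (proj₁ (sub u∈)) (proj₁ (sub x∈)) (_ , c′)
    ... | inj₂ (_ , _ , _ , d′ , _) = ⊥-elim (far x∈ (_ , sc-sym d′))
    v~w : Joined T v w
    v~w = _ , sc-hop e∈ hop
    covers′ : ∀ {u} → ¬ Unb T u → ∃[ x ] (x ∈ᴸ L′ × Joined T u x)
    covers′ {u} ¬unb with covers (λ c → ¬unb (sc-mono T-x⊆T c))
    ... | x , x∈ , u~x with x Finₚ.≟ r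
    ...   | no x≢r = x , sup x∈ x≢r , joined-mono T-x⊆T u~x
    ...   | yes refl with joined? S v w
    ...     | yes (s , c) = ⊥-elim (¬unb (unb-resp u~v (opp (≡-or-opposite s (σ e)))))
      where
      u~v = joined-mono T-x⊆T (joined-trans u~x (joined-sym v~r))
      opp : s ≡ σ e ⊎ s *ˢ σ e ≡ ₋ → Unb T v
      opp (inj₁ refl) = ⊥-elim (¬sc c)
      opp (inj₂ eq) = sc-cast eq (sc-trans (sc-mono T-x⊆T c) (sc-hop e∈ (hop-sym {e} hop)))
    ...     | no ¬v~w with covers {w} (λ c → ¬unb (unb-resp (joined-trans u~v v~w) (sc-mono T-x⊆T c)))
      where u~v = joined-mono T-x⊆T (joined-trans u~x (joined-sym v~r))
    ...       | y , y∈ , w~y = y , sup y∈ (λ { refl → ¬v~w (joined-trans v~r (joined-sym w~y)) })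
      , joined-trans (joined-mono T-x⊆T (joined-trans u~x (joined-sym v~r))) (joined-trans v~w (joined-mono T-x⊆T w~y))

  -- The nullity of S in the frame matroid, of rank n − b_Σ(S), is k.
  Nullity : Subset m → ℕ → Set
  Nullity S k = ∃[ L ] (Transversal S L × ∣ S ∣ + length L ≡ n + k)

  sc-∅ : ∀ {u s w} → SC ∅ u s w → u ≡ w × s ≡ ₊
  sc-∅ nil = refl , refl
  sc-∅ (cons e∈ _ _) = ⊥-elim (∉⊥ e∈)

  nullity-∅ : Nullity ∅ 0
  nullity-∅ = List.allFin n , record
    { unique = Uniqueₚ.allFin⁺ n
    ; balanced = λ _ c → aux (proj₂ (sc-∅ c))
    ; apart = λ _ _ (_ , c) → proj₁ (sc-∅ c)
    ; covers = λ {u} _ → u , ∈-allFin u , ₊ , nil }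
    , trans (cong₂ _+_ (∣⊥∣≡0 m) (Listₚ.length-tabulate {n = n} (λ i → i))) (sym (ℕₚ.+-identityʳ n))
    where
    aux : ₋ ≡ ₊ → ⊥
    aux ()

  nullity-unique : ∀ {S j k} → Nullity S j → Nullity S k → j ≡ k
  nullity-unique {S} {j} {k} (L , t , p) (L′ , t′ , q) = ℕₚ.+-cancelˡ-≡ n j k
    (trans (sym p) (trans (cong (∣ S ∣ +_) (transversal-length t t′)) q))

  nullity-noDrop : ∀ {T e k} → e ∈ T → NoDrop (T - e) e → Nullity (T - e) k → Nullity T (suc k)
  nullity-noDrop {k = k} e∈ nd (L , t , p) = L , transversal-noDrop nd t ,
    trans (cong (_+ length L) (∣p∣≡1+∣p-x∣ e∈)) (trans (cong suc p) (sym (ℕₚ.+-suc n k)))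

  nullity-drop : ∀ {T e k} → e ∈ T → Drop (T - e) e → Nullity (T - e) k → Nullity T k
  nullity-drop {T} {e} e∈ d (L , t , p) with transversal-drop e∈ d t
  ... | L′ , t′ , len = L′ , t′ , trans (cong (_+ length L′) (∣p∣≡1+∣p-x∣ e∈))
    (trans (sym (ℕₚ.+-suc ∣ T - e ∣ (length L′))) (trans (cong (∣ T - e ∣ +_) (sym len)) p))

  nullity-exists : ∀ S → ∃[ k ] Nullity S k
  nullity-exists = subset-rec _ go
    where
    go : ∀ S → (∀ x → x ∈ S → ∃[ k ] Nullity (S - x) k) → ∃[ k ] Nullity S k
    go S rec with empty-or-element S
    ... | inj₁ refl = 0 , nullity-∅
    ... | inj₂ (e , e∈) with rec e e∈ | noDrop-or-drop (S - e) e
    ...   | k , N | inj₁ nd = suc k , nullity-noDrop e∈ nd N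
    ...   | k , N | inj₂ d = k , nullity-drop e∈ d N

  nullity-noDrop⁻ : ∀ {T e k} → e ∈ T → NoDrop (T - e) e → Nullity T k → ∃[ j ] (k ≡ suc j × Nullity (T - e) j)
  nullity-noDrop⁻ {T} {e} e∈ nd N with nullity-exists (T - e)
  ... | j , N′ = j , nullity-unique N (nullity-noDrop e∈ nd N′) , N′

  nullity-drop⁻ : ∀ {T e k} → e ∈ T → Drop (T - e) e → Nullity T k → Nullity (T - e) k
  nullity-drop⁻ {T} {e} e∈ d N with nullity-exists (T - e)
  ... | j , N′ = subst (Nullity (T - e)) (nullity-unique (nullity-drop e∈ d N′) N) N′

  nullity-0 : ∀ {T e} → e ∈ T → NoDrop (T - e) e → ¬ Nullity T 0
  nullity-0 e∈ nd N with nullity-noDrop⁻ e∈ nd N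
  ... | _ , () , _

  nullity-1 : ∀ {T e} → e ∈ T → NoDrop (T - e) e → Nullity T 1 → Nullity (T - e) 0
  nullity-1 e∈ nd N with nullity-noDrop⁻ e∈ nd N
  ... | _ , refl , N′ = N′

  nullity-extend : ∀ {A S k} → A ⊆ S → (∀ {x} → x ∈ S → x ∉ A → ¬ NoDrop (S - x) x) → Nullity A k → Nullity S k
  nullity-extend {A} {S} {k} A⊆S ¬nd N = subset-rec P go S A⊆S ¬nd
    where
    P : Subset m → Set
    P S = A ⊆ S → (∀ {x} → x ∈ S → x ∉ A → ¬ NoDrop (S - x) x) → Nullity S k
    go : ∀ S → (∀ x → x ∈ S → P (S - x)) → P S
    go S rec A⊆S ¬nd with full-or-missing S A
    ... | inj₁ S⊆A = subst (λ X → Nullity X k) (⊆-antisym A⊆S S⊆A) N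
    ... | inj₂ (x , x∈S , x∉A) with noDrop-or-drop (S - x) x
    ...   | inj₁ nd = ⊥-elim (¬nd x∈S x∉A nd)
    ...   | inj₂ d = nullity-drop x∈S d (rec x x∈S
              (λ {y} y∈A → x∈p∧x≢y⇒x∈p-y (A⊆S y∈A) (λ y≡x → x∉A (subst (_∈ A) y≡x y∈A)))
              λ y∈ y∉A nd → ¬nd (T-x⊆T y∈) y∉A (noDrop-mono (-mono T-x⊆T) nd))

  nullity-removable : ∀ S {k} → Nullity S (suc k) → ∃[ e ] (e ∈ S × NoDrop (S - e) e)
  nullity-removable = subset-rec _ go
    where
    go : ∀ S → (∀ x → x ∈ S → ∀ {k} → Nullity (S - x) (suc k) → ∃[ e ] (e ∈ S - x × NoDrop (S - x - e) e)) →
      ∀ {k} → Nullity S (suc k) → ∃[ e ] (e ∈ S × NoDrop (S - e) e)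
    go S rec N with empty-or-element S
    ... | inj₁ refl with nullity-unique nullity-∅ N
    ...   | ()
    go S rec N | inj₂ (e , e∈) with noDrop-or-drop (S - e) e
    ... | inj₁ nd = e , e∈ , nd
    ... | inj₂ d with rec e e∈ (nullity-drop⁻ e∈ d N)
    ...   | f , f∈ , nd = f , T-x⊆T f∈ , noDrop-mono (-mono T-x⊆T) nd

  -- Walks and figures

  step-hopE : ∀ k {u t w} → StepE k u t w → HopE k u w
  step-hopE (link _ _ _ _ _) (inj₁ (p , _ , q)) = inj₁ (p , q)
  step-hopE (link _ _ _ _ _) (inj₂ (p , _ , q)) = inj₂ (p , q)
  step-hopE (loop _ _ _) (p , q , _) = p , q

  step-hop : ∀ {e u t w} → StepE (ends e) u t w → Hop e u w
  step-hop {e} = step-hopE (ends e)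

  data HopView (k : Ends n) (u w : Fin n) : Set where
    isStep : ∀ t → StepE k u t w → HopView k u w
    isHalf : ∀ t → k ≡ half u t → u ≡ w → HopView k u w

  hop-view : ∀ k {u w} → HopE k u w → HopView k u w
  hop-view (link _ _ _ τv τw) (inj₁ (p , q)) = isStep τv (inj₁ (p , refl , q))
  hop-view (link _ _ _ τv τw) (inj₂ (p , q)) = isStep τw (inj₂ (p , refl , q))
  hop-view (loop _ τ₁ _) (p , q) = isStep τ₁ (p , q , inj₁ refl)
  hop-view (half v τ) (refl , refl) = isHalf τ refl refl

  half-hop : ∀ {e v t} → ends e ≡ half v t → Hop e v v
  half-hop {e} {v} eq = subst (λ k → HopE k v v) (sym eq) (refl , refl)

  half-sign : ∀ {e v t} → ends e ≡ half v t → σ e ≡ ₋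
  half-sign eq = cong signOf eq

  _∈ᴸ?_ : ∀ {k} (x : Fin k) xs → Dec (x ∈ᴸ xs)
  x ∈ᴸ? xs = any? (x Finₚ.≟_) xs

  Within : Subset m → List (Fin m) → Set
  Within S xs = ∀ {e} → e ∈ᴸ xs → e ∈ S

  infix 4 _⊑_ _⊑ʷ_

  _⊑_ : ∀ {a} → FigureAt a → Subset m → Set
  f ⊑ S = Within S (figEdges f)

  _⊑ʷ_ : ∀ {u w} → Walk u w → Subset m → Set
  W ⊑ʷ S = Within S (edges W)

  start∈ : ∀ {u w} (W : Walk u w) → u ∈ᴸ verts W
  start∈ [] = here refl
  start∈ (step _ _ _ _) = here refl

  end∈ : ∀ {u w} (W : Walk u w) → w ∈ᴸ verts W
  end∈ [] = here refl
  end∈ (step _ _ _ W) = there (end∈ W)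

  init⊆verts : ∀ {u w} (W : Walk u w) {x} → x ∈ᴸ initVerts W → x ∈ᴸ verts W
  init⊆verts (step _ _ _ W) (here eq) = here eq
  init⊆verts (step _ _ _ W) (there p) = there (init⊆verts W p)

  verts⊆init : ∀ {u w} (W : Walk u w) {x} → x ∈ᴸ verts W → x ∈ᴸ initVerts W ⊎ x ≡ w
  verts⊆init [] (here eq) = inj₂ eq
  verts⊆init (step _ _ _ W) (here eq) = inj₁ (here eq)
  verts⊆init (step _ _ _ W) (there p) with verts⊆init W p
  ... | inj₁ q = inj₁ (there q)
  ... | inj₂ eq = inj₂ eq

  edges-++ : ∀ {u w x} (A : Walk u w) (D : Walk w x) → edges (A ++ʷ D) ≡ edges A ++ edges D
  edges-++ [] D = refl
  edges-++ (step e _ _ A) D = cong (e ∷_) (edges-++ A D)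

  ∈-edges-++⁻ : ∀ {u w x} (A : Walk u w) (D : Walk w x) {e} → e ∈ᴸ edges (A ++ʷ D) → e ∈ᴸ edges A ⊎ e ∈ᴸ edges D
  ∈-edges-++⁻ A D i = ∈-++⁻ (edges A) (subst (_ ∈ᴸ_) (edges-++ A D) i)

  ∈-edges-++ˡ : ∀ {u w x} (A : Walk u w) (D : Walk w x) {e} → e ∈ᴸ edges A → e ∈ᴸ edges (A ++ʷ D)
  ∈-edges-++ˡ A D i = subst (_ ∈ᴸ_) (sym (edges-++ A D)) (∈-++⁺ˡ i)

  ∈-edges-++ʳ : ∀ {u w x} (A : Walk u w) (D : Walk w x) {e} → e ∈ᴸ edges D → e ∈ᴸ edges (A ++ʷ D)
  ∈-edges-++ʳ A D i = subst (_ ∈ᴸ_) (sym (edges-++ A D)) (∈-++⁺ʳ (edges A) i)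

  init-++ : ∀ {u w x} (A : Walk u w) (D : Walk w x) → initVerts (A ++ʷ D) ≡ initVerts A ++ initVerts D
  init-++ [] D = refl
  init-++ {u} (step _ _ _ A) D = cong (u ∷_) (init-++ A D)

  wSign-++ : ∀ {u w x} (A : Walk u w) (D : Walk w x) → wSign (A ++ʷ D) ≡ wSign A *ˢ wSign D
  wSign-++ [] D = refl
  wSign-++ (step e _ _ A) D = trans (cong (σ e *ˢ_) (wSign-++ A D)) (sym (Signₚ.*-assoc (σ e) (wSign A) (wSign D)))

  verts-++⁻ : ∀ {u w x} (A : Walk u w) (D : Walk w x) {z} → z ∈ᴸ verts (A ++ʷ D) → z ∈ᴸ verts A ⊎ z ∈ᴸ verts D
  verts-++⁻ [] D p = inj₂ p
  verts-++⁻ (step _ _ _ A) D (here eq) = inj₁ (here eq)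
  verts-++⁻ (step _ _ _ A) D (there p) with verts-++⁻ A D p
  ... | inj₁ q = inj₁ (there q)
  ... | inj₂ q = inj₂ q

  verts-++ˡ : ∀ {u w x} (A : Walk u w) (D : Walk w x) {z} → z ∈ᴸ verts A → z ∈ᴸ verts (A ++ʷ D)
  verts-++ˡ [] D (here refl) = start∈ D
  verts-++ˡ (step _ _ _ A) D (here eq) = here eq
  verts-++ˡ (step _ _ _ A) D (there p) = there (verts-++ˡ A D p)

  verts-++ʳ : ∀ {u w x} (A : Walk u w) (D : Walk w x) {z} → z ∈ᴸ verts D → z ∈ᴸ verts (A ++ʷ D)
  verts-++ʳ [] D p = p
  verts-++ʳ (step _ _ _ A) D p = there (verts-++ʳ A D p)

  walk-sc : ∀ {S u w} (W : Walk u w) → W ⊑ʷ S → SC S u (wSign W) w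
  walk-sc [] _ = nil
  walk-sc (step e t s W) i = cons (i (here refl)) (step-hop {e} s) (walk-sc W (λ p → i (there p)))

  edge-ends : ∀ {u w} (W : Walk u w) {e} → e ∈ᴸ edges W →
    ∃[ y ] ∃[ z ] (Hop e y z × y ∈ᴸ initVerts W × y ∈ᴸ verts W × z ∈ᴸ verts W)
  edge-ends (step e t s W) (here refl) = _ , _ , step-hop {e} s , here refl , here refl , there (start∈ W)
  edge-ends (step e t s W) (there p) with edge-ends W p
  ... | y , z , h , i , j , k = y , z , h , there i , there j , there k

  split-at : ∀ {u w} (W : Walk u w) {z} → z ∈ᴸ verts W → Σ[ A ∈ Walk u z ] Σ[ D ∈ Walk z w ] W ≡ A ++ʷ D
  split-at [] (here refl) = [] , [] , refl
  split-at (step e t s W) (here refl) = [] , step e t s W , refl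
  split-at (step e t s W) (there p) with split-at W p
  ... | A , D , refl = step e t s A , D , refl

  record EdgeSplit {u w} (W : Walk u w) (e : Fin m) : Set where
    constructor edgeSplit
    field
      {y z} : Fin n
      {t} : Sign
      front : Walk u y
      hop : StepE (ends e) y t z
      back : Walk z w
      eq : W ≡ front ++ʷ step e t hop back

  split-edge : ∀ {u w} (W : Walk u w) {e} → e ∈ᴸ edges W → EdgeSplit W e
  split-edge (step e t s W) (here refl) = edgeSplit [] s W refl
  split-edge (step e t s W) (there p) with split-edge W p
  ... | edgeSplit A h D refl = edgeSplit (step e t s A) h D refl

  record OnceSplit {u w} (W : Walk u w) (e : Fin m) : Set where
    field
      split : EdgeSplit W e
    open EdgeSplit split public
    field
      front⊆ : ∀ {g} → g ∈ᴸ edges front → g ∈ᴸ edges W × g ≢ e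
      back⊆ : ∀ {g} → g ∈ᴸ edges back → g ∈ᴸ edges W × g ≢ e

  split-once : ∀ {u w} (W : Walk u w) → Unique (edges W) → ∀ {e} → e ∈ᴸ edges W → OnceSplit W e
  split-once W ue {e} e∈ with split-edge W e∈
  ... | edgeSplit {t = t} A s D refl with unique-++⁻ (edges A) (subst Unique (edges-++ A (step e t s D)) ue)
  ...   | _ , uD , disj = record
    { split = edgeSplit A s D refl
    ; front⊆ = λ i → ∈-edges-++ˡ A _ i , λ { refl → disj e i (here refl) }
    ; back⊆ = λ i → ∈-edges-++ʳ A _ (there i) , λ { refl → unique-∉ uD i } }

  path-++ : ∀ {u w x} {A : Walk u w} {D : Walk w x} → IsPath A → IsPath D →
    (∀ {z} → z ∈ᴸ verts A → z ∈ᴸ verts D → z ≡ w) → IsPath (A ++ʷ D)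
  path-++ {A = []} _ pd _ = pd
  path-++ {A = step e t s A} {D} pa@(_ ∷ pa′) pd meet = unique-∷
    (λ u∈ → [ unique-∉ pa , (λ u∈D → unique-∉ pa (subst (_∈ᴸ verts A) (sym (meet (here refl) u∈D)) (end∈ A))) ]′ (verts-++⁻ A D u∈))
    (path-++ pa′ pd (λ p q → meet (there p) q))

  path-++⁻ : ∀ {u w x} (A : Walk u w) {D : Walk w x} → IsPath (A ++ʷ D) →
    IsPath A × IsPath D × (∀ {z} → z ∈ᴸ verts A → z ∈ᴸ verts D → z ≡ w)
  path-++⁻ [] p = ([] ∷ []) , p , λ { (here eq) _ → eq }
  path-++⁻ (step e t s A) {D} p@(_ ∷ p′) with path-++⁻ A p′
  ... | pa , pd , meet = unique-∷ (λ i → unique-∉ p (verts-++ˡ A D i)) pa , pd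
    , λ { (here refl) q → ⊥-elim (unique-∉ p (verts-++ʳ A D q)) ; (there i) q → meet i q }

  path-edges-unique : ∀ {u w} (W : Walk u w) → IsPath W → Unique (edges W)
  path-edges-unique [] _ = []
  path-edges-unique (step e t s W) p@(_ ∷ p′) = unique-∷ e∉ (path-edges-unique W p′)
    where
    e∉ : e ∉ᴸ edges W
    e∉ i with edge-ends W i
    ... | y , z , h , _ , y∈ , z∈ with hop-unique e h (step-hop {e} s)
    ...   | inj₁ (refl , _) = unique-∉ p y∈
    ...   | inj₂ (refl , _) = unique-∉ p z∈

  closed-path : ∀ {u} (W : Walk u u) → IsPath W → W ≡ []
  closed-path [] _ = refl
  closed-path (step _ _ _ W) p = ⊥-elim (unique-∉ p (end∈ W))

  revʷ : ∀ {u w} → Walk u w → Walk w u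
  revʷ [] = []
  revʷ (step e t s W) = revʷ W ++ʷ step e (proj₁ (revStepE (ends e) s)) (proj₂ (revStepE (ends e) s)) []

  rev-edges : ∀ {u w} (W : Walk u w) {e} → e ∈ᴸ edges (revʷ W) → e ∈ᴸ edges W
  rev-edges (step e t s W) i with ∈-edges-++⁻ (revʷ W) _ i
  ... | inj₁ j = there (rev-edges W j)
  ... | inj₂ (here refl) = here refl

  rev-edges⁺ : ∀ {u w} (W : Walk u w) {e} → e ∈ᴸ edges W → e ∈ᴸ edges (revʷ W)
  rev-edges⁺ (step e t s W) (here refl) = ∈-edges-++ʳ (revʷ W) _ (here refl)
  rev-edges⁺ (step e t s W) (there i) = ∈-edges-++ˡ (revʷ W) _ (rev-edges⁺ W i)

  rev-verts : ∀ {u w} (W : Walk u w) {x} → x ∈ᴸ verts (revʷ W) → x ∈ᴸ verts W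
  rev-verts [] i = i
  rev-verts (step e t s W) i with verts-++⁻ (revʷ W) _ i
  ... | inj₁ j = there (rev-verts W j)
  ... | inj₂ (here refl) = there (start∈ W)
  ... | inj₂ (there (here refl)) = here refl

  rev-path : ∀ {u w} {W : Walk u w} → IsPath W → IsPath (revʷ W)
  rev-path {W = []} p = p
  rev-path {W = step e t s W} p@(_ ∷ p′) = path-++ (rev-path p′)
    (unique-∷ (λ { (here refl) → unique-∉ p (start∈ W) }) ([] ∷ []))
    λ { i (here refl) → refl ; i (there (here refl)) → ⊥-elim (unique-∉ p (rev-verts W i)) }

  rev-sign : ∀ {u w} (W : Walk u w) → wSign (revʷ W) ≡ wSign W
  rev-sign [] = refl
  rev-sign (step e t s W) = trans (wSign-++ (revʷ W) _) (trans (cong₂ _*ˢ_ (rev-sign W) (Signₚ.*-identityʳ (σ e))) (Signₚ.*-comm (wSign W) (σ e)))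

  record Path (S : Subset m) (u w : Fin n) : Set where
    constructor mkPath
    field
      walk : Walk u w
      isPath : IsPath walk
      within : walk ⊑ʷ S

  record FigureIn (S : Subset m) (a : Fin n) : Set where
    constructor mkFig
    field
      fig : FigureAt a
      within : fig ⊑ S

  -- Every figure with an edge e is e together with a path back; a loop or half edge
  -- is the case of an empty path.
  record Closing {u w} (e : Fin m) (P : Walk w u) : Set where
    field
      fig : FigureAt u
      figEdges≡ : figEdges fig ≡ e ∷ edges P
      figSign≡ : figSign fig ≡ σ e *ˢ wSign P
      figVerts⊆ : ∀ {x} → x ∈ᴸ figVerts fig → x ∈ᴸ verts P
      figVerts⊇ : ∀ {x} → x ∈ᴸ verts P → x ∈ᴸ figVerts fig

  closed-by-path : ∀ {e t u w} (s : StepE (ends e) u t w) (P : Walk w u) → IsPath P → e ∉ᴸ edges P → IsCircleWalk (step e t s P)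
  closed-by-path {e} s P p e∉ = (λ ()) , unique-∷ e∉ (path-edges-unique P p) , init-unique P p
    where
    init-unique : ∀ {y z} (P : Walk y z) → IsPath P → Unique (z ∷ initVerts P)
    init-unique [] _ = [] ∷ []
    init-unique (step _ _ _ P) p@(_ ∷ p′) with init-unique P p′
    ... | ih@(_ ∷ ih′) = unique-∷ (λ { (here refl) → unique-∉ p (end∈ P) ; (there i) → unique-∉ ih i })
      (unique-∷ (λ i → unique-∉ p (init⊆verts P i)) ih′)

  closing : ∀ {e u w} → Hop e u w → (P : Walk w u) → IsPath P → e ∉ᴸ edges P → Closing e P
  closing {e} h P p e∉ with hop-view (ends e) h
  ... | isStep t s = record
    { fig = circ (step e t s P) (closed-by-path s P p e∉) ; figEdges≡ = refl ; figSign≡ = refl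
    ; figVerts⊆ = λ { (here refl) → end∈ P ; (there i) → init⊆verts P i }
    ; figVerts⊇ = λ i → [ there , here ]′ (verts⊆init P i) }
  ... | isHalf t eq refl with closed-path P p
  ...   | refl = record
    { fig = halfF e t eq ; figEdges≡ = refl
    ; figSign≡ = sym (trans (Signₚ.*-identityʳ (σ e)) (half-sign {e} eq)) ; figVerts⊆ = λ i → i ; figVerts⊇ = λ i → i }

  NegFigure : Subset m → Fin n → Set
  NegFigure S u = ∃[ a ] Σ[ f ∈ FigureIn S a ] (figSign (FigureIn.fig f) ≡ ₋ × Joined S u a)

  negFigure-resp : ∀ {S u w} → Joined S u w → NegFigure S w → NegFigure S u
  negFigure-resp j (a , f , s , j′) = a , f , s , joined-trans j j′

  back-sign : ∀ {e t u y} → u ≢ y → StepE (ends e) u t y → (P : Walk y u) → IsPath P → e ∈ᴸ edges P → wSign P ≡ σ e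
  back-sign {e} u≢y s (step e t′ s′ P) p (here refl) with hop-unique e (step-hop {e} s) (step-hop {e} s′)
  ... | inj₁ (refl , _) = ⊥-elim (u≢y refl)
  back-sign {e} u≢y s (step e t′ s′ P) (_ ∷ p) (here refl) | inj₂ (_ , refl) with closed-path P p
  ...   | refl = Signₚ.*-identityʳ (σ e)
  back-sign {e} u≢y s (step f t′ s′ P) p (there i) with edge-ends P i
  ... | y , z , h , _ , y∈ , z∈ with hop-unique e h (step-hop {e} s)
  ...   | inj₁ (_ , refl) = ⊥-elim (unique-∉ p z∈)
  ...   | inj₂ (_ , refl) = ⊥-elim (unique-∉ p y∈)

  -- Loop erasure: an erased loop is positive or provides a negative figure.
  erase : ∀ {S u s x} → SC S u s x → Σ[ P ∈ Path S u x ] (wSign (Path.walk P) ≡ s ⊎ NegFigure S u)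
  erase nil = mkPath [] ([] ∷ []) (λ ()) , inj₁ refl
  erase {S} {u} (cons {e} {w = y} {s = s′} {x} e∈ h c) with erase c
  ... | mkPath P p i , r with hop-view (ends e) h
  ...   | isHalf t eq refl = mkPath P p i , inj₂ (u , mkFig (halfF e t eq) (λ { (here refl) → e∈ }) , refl , _ , nil)
  ...   | isStep t s with u ∈ᴸ? verts P
  ...     | no u∉ = mkPath (step e t s P) (unique-∷ u∉ p) (λ { (here refl) → e∈ ; (there j) → i j })
            , [ (λ eq → inj₁ (cong (σ e *ˢ_) eq)) , (λ f → inj₂ (negFigure-resp (_ , sc-hop e∈ h) f)) ]′ r
  ...     | yes u∈ with split-at P u∈
  ...       | P₁ , P₂ , refl with path-++⁻ P₁ p
  ...         | p₁ , p₂ , _ = mkPath P₂ p₂ i₂ , [ positive , (λ f → inj₂ (negFigure-resp (_ , sc-hop e∈ h) f)) ]′ r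
    where
    i₁ : P₁ ⊑ʷ S
    i₁ j = i (∈-edges-++ˡ P₁ P₂ j)
    i₂ : P₂ ⊑ʷ S
    i₂ j = i (∈-edges-++ʳ P₁ P₂ j)
    cancel : ∀ {b} a c d → a *ˢ c ≡ ₊ → c *ˢ d ≡ b → d ≡ a *ˢ b
    cancel ₊ ₊ d _ refl = refl
    cancel ₋ ₋ ₊ _ refl = refl
    cancel ₋ ₋ ₋ _ refl = refl
    circleCase : e ∉ᴸ edges P₁ → ∀ r → σ e *ˢ wSign P₁ ≡ r → wSign (P₁ ++ʷ P₂) ≡ s′ → wSign P₂ ≡ σ e *ˢ s′ ⊎ NegFigure S u
    circleCase e∉ ₊ eq eq′ = inj₁ (cancel (σ e) (wSign P₁) (wSign P₂) eq (trans (sym (wSign-++ P₁ P₂)) eq′))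
    circleCase e∉ ₋ eq eq′ = inj₂ (u , mkFig (circ (step e t s P₁) (closed-by-path s P₁ p₁ e∉)) (λ { (here refl) → e∈ ; (there j) → i₁ j }) , eq , _ , nil)
    positive : wSign (P₁ ++ʷ P₂) ≡ s′ → wSign P₂ ≡ σ e *ˢ s′ ⊎ NegFigure S u
    positive eq with e ∈ᴸ? edges P₁
    ... | no e∉ = circleCase e∉ _ refl eq
    ... | yes e∈₁ with u Finₚ.≟ y
    ...   | no u≢y = circle′ (back-sign u≢y s P₁ p₁ e∈₁)
      where
      circle′ : wSign P₁ ≡ σ e → wSign P₂ ≡ σ e *ˢ s′ ⊎ NegFigure S u
      circle′ eq′ = inj₁ (cancel (σ e) (wSign P₁) (wSign P₂) (trans (cong (σ e *ˢ_) eq′) (Signₚ.s*s≡+ (σ e))) (trans (sym (wSign-++ P₁ P₂)) eq))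
    positive eq | yes e∈₁ | yes refl with closed-path P₁ p₁
    positive eq | yes () | yes refl | refl

  joined-path : ∀ {S u x} → Joined S u x → Path S u x
  joined-path (_ , c) = proj₁ (erase c)

  unb-figure : ∀ {S u} → Unb S u → NegFigure S u
  unb-figure c with erase c
  ... | _ , inj₂ f = f
  ... | mkPath P p _ , inj₁ eq with closed-path P p
  unb-figure c | _ , inj₁ () | refl

  figure-sc : ∀ {S a} (f : FigureAt a) → f ⊑ S → SC S a (figSign f) a
  figure-sc (circ W _) i = walk-sc W i
  figure-sc (halfF e t eq) i = sc-cast (half-sign {e} eq) (sc-hop (i (here refl)) (half-hop {e} eq))

  negFigure-unb : ∀ {S u} → NegFigure S u → Unb S u
  negFigure-unb (a , mkFig f i , eq , j) = unb-resp j (sc-cast eq (figure-sc f i))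

  signed-path : ∀ {S u s x} → ¬ Unb S u → SC S u s x → Σ[ P ∈ Path S u x ] wSign (Path.walk P) ≡ s
  signed-path ¬unb c with erase c
  ... | P , inj₁ eq = P , eq
  ... | _ , inj₂ f = ⊥-elim (¬unb (negFigure-unb f))

  within-minus : ∀ {S e xs} → Within S xs → e ∉ᴸ xs → Within (S - e) xs
  within-minus {xs = xs} i e∉ j = x∈p∧x≢y⇒x∈p-y (i j) (λ eq → e∉ (subst (_∈ᴸ xs) eq j))

  figure-cut : ∀ {S a} (f : FigureAt a) → f ⊑ S → ∀ {e} → e ∈ᴸ figEdges f → ∀ {u w} → Hop e u w →
    ∃[ s ] (SC (S - e) u s w × (figSign f ≡ ₊ → s ≡ σ e))
  figure-cut {S} (halfF e t eq) i (here refl) h with subst (λ k → HopE k _ _) eq h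
  ... | refl , refl = ₊ , nil , λ ()
  figure-cut {S} {a} (circ W (_ , ue , _)) i {e} e∈ {u} {w} h with split-once W ue e∈
  ... | record { split = edgeSplit {y} {z} {t} A s D refl ; front⊆ = A⊆ ; back⊆ = D⊆ } = finish (hop-unique e (step-hop {e} s) h)
    where
    around : SC (S - e) z (wSign D *ˢ wSign A) y
    around = sc-trans (walk-sc D (λ j → x∈p∧x≢y⇒x∈p-y (i (proj₁ (D⊆ j))) (proj₂ (D⊆ j))))
      (walk-sc A (λ j → x∈p∧x≢y⇒x∈p-y (i (proj₁ (A⊆ j))) (proj₂ (A⊆ j))))
    signs : ∀ a b c → a *ˢ (b *ˢ c) ≡ ₊ → c *ˢ a ≡ b
    signs ₊ ₊ ₊ _ = refl
    signs ₊ ₋ ₋ _ = refl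
    signs ₋ ₊ ₋ _ = refl
    signs ₋ ₋ ₊ _ = refl
    sign : wSign (A ++ʷ step e t s D) ≡ ₊ → wSign D *ˢ wSign A ≡ σ e
    sign eq = signs (wSign A) (σ e) (wSign D) (trans (sym (wSign-++ A (step e t s D))) eq)
    finish : (u ≡ y × w ≡ z) ⊎ (u ≡ z × w ≡ y) → _
    finish (inj₁ (refl , refl)) = _ , sc-sym around , sign
    finish (inj₂ (refl , refl)) = _ , around , sign

  joined-cut : ∀ {S a} (f : FigureAt a) → f ⊑ S → ∀ {e} → e ∈ᴸ figEdges f → ∀ {u w} → Joined S u w → Joined (S - e) u w
  joined-cut {S} f i {e} e∈ (_ , c) = go c
    where
    go : ∀ {u s w} → SC S u s w → Joined (S - e) u w
    go nil = _ , nil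
    go (cons {g} g∈ h c) with ∈-split e g∈
    ... | inj₂ g∈′ = joined-trans (_ , sc-hop g∈′ h) (go c)
    ... | inj₁ refl = let s , d , _ = figure-cut f i e∈ h in joined-trans (s , d) (go c)

  -- Gains and potentials

  open Field F using (Carrier; _≈_; 0#; 1#; +-abelianGroup; +-cong; +-congˡ; +-congʳ; -‿cong; *-congˡ; *-congʳ;
    *-identityˡ; distribʳ; distribˡ; +-identityˡ; inverse; setoid)
    renaming (_+_ to _⊕_; -_ to ⊖_; _*_ to _⊗_; refl to ≈-refl; sym to ≈-sym; trans to ≈-trans)
  open Linear +-abelianGroup _·_ (λ _ → refl) (λ _ → refl)
  import Relation.Binary.Reasoning.Setoid as SetoidReasoning
  open SetoidReasoning setoid

  #0 : ∀ {k} → Expr (suc k)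
  #0 = var zero
  #1 : ∀ {k} → Expr (suc (suc k))
  #1 = var (suc zero)
  #2 : ∀ {k} → Expr (suc (suc (suc k)))
  #2 = var (suc (suc zero))
  #3 : ∀ {k} → Expr (suc (suc (suc (suc k))))
  #3 = var (suc (suc (suc zero)))

  two-inverse : ∃[ h ] (∀ y → (h ⊗ y) ⊕ (h ⊗ y) ≈ y)
  two-inverse with inverse (1# ⊕ 1#) char≠2
  ... | h , eq = h , λ y → begin
    (h ⊗ y) ⊕ (h ⊗ y) ≈⟨ distribʳ y h h ⟨
    (h ⊕ h) ⊗ y ≈⟨ *-congʳ (+-cong (*-identityˡ h) (*-identityˡ h)) ⟨
    ((1# ⊗ h) ⊕ (1# ⊗ h)) ⊗ y ≈⟨ *-congʳ (distribʳ h 1# 1#) ⟨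
    ((1# ⊕ 1#) ⊗ h) ⊗ y ≈⟨ *-congʳ eq ⟩
    1# ⊗ y ≈⟨ *-identityˡ y ⟩
    y ∎

  double-injective : ∀ {x y} → x ⊕ x ≈ y ⊕ y → x ≈ y
  double-injective {x} {y} eq with two-inverse
  ... | h , halve = begin
    x ≈⟨ halve x ⟨
    (h ⊗ x) ⊕ (h ⊗ x) ≈⟨ distribˡ h x x ⟨
    h ⊗ (x ⊕ x) ≈⟨ *-congˡ eq ⟩
    h ⊗ (y ⊕ y) ≈⟨ distribˡ h y y ⟩
    (h ⊗ y) ⊕ (h ⊗ y) ≈⟨ halve y ⟩
    y ∎

  ·-cong : ∀ s {x y} → x ≈ y → s · x ≈ s · y
  ·-cong ₊ eq = eq
  ·-cong ₋ eq = -‿cong eq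

  G : ∀ {u w} → Walk u w → Carrier
  G W = gainAcc ₊ W

  gainAcc-scale : ∀ s {u w} (W : Walk u w) → gainAcc s W ≈ s · G W
  gainAcc-scale s [] = solve 1 Vec.[] (λ _ → :0) (λ s → s :· :0) s
  gainAcc-scale s (step e t st W) = begin
    ((s *ˢ t) · φ e) ⊕ gainAcc (s *ˢ σ e) W ≈⟨ +-congˡ (gainAcc-scale (s *ˢ σ e) W) ⟩
    ((s *ˢ t) · φ e) ⊕ ((s *ˢ σ e) · G W)
      ≈⟨ solve 3 (φ e ∷ G W ∷ Vec.[]) (λ s t r → ((s *ˢ t) :· #0) :+ ((s *ˢ r) :· #1)) (λ s t r → s :· ((t :· #0) :+ (r :· #1))) s t (σ e) ⟩
    s · ((t · φ e) ⊕ (σ e · G W)) ≈⟨ ·-cong s (+-congˡ (gainAcc-scale (σ e) W)) ⟨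
    s · G (step e t st W) ∎

  G-step : ∀ {u w x} e t (s : StepE (ends e) u t w) (W : Walk w x) → G (step e t s W) ≈ (t · φ e) ⊕ (σ e · G W)
  G-step e t s W = +-congˡ (gainAcc-scale (σ e) W)

  G-++ : ∀ {u w x} (A : Walk u w) (D : Walk w x) → G (A ++ʷ D) ≈ G A ⊕ (wSign A · G D)
  G-++ [] D = solve 0 (G D ∷ Vec.[]) #0 (:0 :+ #0)
  G-++ (step e t s A) D = begin
    G (step e t s (A ++ʷ D)) ≈⟨ G-step e t s (A ++ʷ D) ⟩
    (t · φ e) ⊕ (σ e · G (A ++ʷ D)) ≈⟨ +-congˡ (·-cong (σ e) (G-++ A D)) ⟩
    (t · φ e) ⊕ (σ e · (G A ⊕ (wSign A · G D)))
      ≈⟨ solve 2 ((t · φ e) ∷ G A ∷ G D ∷ Vec.[]) (λ r q → #0 :+ (r :· (#1 :+ (q :· #2)))) (λ r q → (#0 :+ (r :· #1)) :+ ((r *ˢ q) :· #2)) (σ e) (wSign A) ⟩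
    ((t · φ e) ⊕ (σ e · G A)) ⊕ ((σ e *ˢ wSign A) · G D) ≈⟨ +-congʳ (G-step e t s A) ⟨
    G (step e t s A) ⊕ ((σ e *ˢ wSign A) · G D) ∎

  ++ʷ-assoc : ∀ {u w x y} (A : Walk u w) (C : Walk w x) (D : Walk x y) → (A ++ʷ C) ++ʷ D ≡ A ++ʷ (C ++ʷ D)
  ++ʷ-assoc [] C D = refl
  ++ʷ-assoc (step e t s A) C D = cong (step e t s) (++ʷ-assoc A C D)

  ++ʷ-[] : ∀ {u w} (A : Walk u w) → A ++ʷ [] ≡ A
  ++ʷ-[] [] = refl
  ++ʷ-[] (step e t s A) = cong (step e t s) (++ʷ-[] A)

  revApp-revʷ : ∀ {u w x} (W : Walk u w) (D : Walk u x) → revApp W D ≡ revʷ W ++ʷ D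
  revApp-revʷ [] D = refl
  revApp-revʷ (step e t s W) D = trans (revApp-revʷ W _) (sym (++ʷ-assoc (revʷ W) _ D))

  rev-revʷ : ∀ {u w} (W : Walk u w) → rev W ≡ revʷ W
  rev-revʷ W = trans (revApp-revʷ W []) (++ʷ-[] (revʷ W))

  opposite-end : ∀ a b → b ≡ ₋ *ˢ (negS (a *ˢ b) *ˢ a)
  opposite-end ₊ ₊ = refl
  opposite-end ₊ ₋ = refl
  opposite-end ₋ ₊ = refl
  opposite-end ₋ ₋ = refl

  opposite-end′ : ∀ a b → a ≡ ₋ *ˢ (negS (a *ˢ b) *ˢ b)
  opposite-end′ a b rewrite Signₚ.*-comm a b = opposite-end b a

  revStep-sign : ∀ (k : Ends n) {u t x} (s : StepE k u t x) → proj₁ (revStepE k s) ≡ ₋ *ˢ (signOf k *ˢ t)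
  revStep-sign (link v w _ τv τw) (inj₁ (_ , refl , _)) = opposite-end τv τw
  revStep-sign (link v w _ τv τw) (inj₂ (_ , refl , _)) = opposite-end′ τv τw
  revStep-sign (loop v τ₁ τ₂) (_ , _ , inj₁ refl) = opposite-end τ₁ τ₂
  revStep-sign (loop v τ₁ τ₂) (_ , _ , inj₂ refl) = opposite-end′ τ₁ τ₂

  G-rev : ∀ {u w} (W : Walk u w) → G (rev W) ≈ ⊖ (wSign W · G W)
  G-rev W rewrite rev-revʷ W = go W
    where
    go : ∀ {u w} (W : Walk u w) → G (revʷ W) ≈ ⊖ (wSign W · G W)
    go [] = solve 0 Vec.[] :0 (:- :0)
    go (step e t s W) = begin
      G (revʷ W ++ʷ step e t′ s′ []) ≈⟨ G-++ (revʷ W) _ ⟩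
      G (revʷ W) ⊕ (wSign (revʷ W) · ((t′ · φ e) ⊕ 0#)) ≡⟨ cong₂ (λ a b → G (revʷ W) ⊕ (a · ((b · φ e) ⊕ 0#))) (rev-sign W) (revStep-sign (ends e) s) ⟩
      G (revʷ W) ⊕ (wSign W · (((₋ *ˢ (σ e *ˢ t)) · φ e) ⊕ 0#)) ≈⟨ +-congʳ (go W) ⟩
      (⊖ (wSign W · G W)) ⊕ (wSign W · (((₋ *ˢ (σ e *ˢ t)) · φ e) ⊕ 0#))
        ≈⟨ solve 3 (φ e ∷ G W ∷ Vec.[]) (λ q r t → (:- (q :· #1)) :+ (q :· (((₋ *ˢ (r *ˢ t)) :· #0) :+ :0)))
             (λ q r t → :- ((r *ˢ q) :· ((t :· #0) :+ (r :· #1)))) (wSign W) (σ e) t ⟩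
      ⊖ ((σ e *ˢ wSign W) · ((t · φ e) ⊕ (σ e · G W))) ≈⟨ -‿cong (·-cong (σ e *ˢ wSign W) (G-step e t s W)) ⟨
      ⊖ ((σ e *ˢ wSign W) · G (step e t s W)) ∎
      where
      t′ = proj₁ (revStepE (ends e) s)
      s′ = proj₂ (revStepE (ends e) s)

  wSign-rev : ∀ {u w} (W : Walk u w) → wSign (rev W) ≡ wSign W
  wSign-rev W = trans (cong wSign (rev-revʷ W)) (rev-sign W)

  -- The gains of the edges satisfying Sat θ are, up to switching, differences of θ.
  record Sat (θ : Fin n → Carrier) (e : Fin m) : Set ℓ where
    field
      onStep : ∀ {u t w} → StepE (ends e) u t w → t · φ e ≈ θ u ⊕ (⊖ (σ e · θ w))
      onHalf : ∀ {v t} → ends e ≡ half v t → t · φ e ≈ θ v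
      onLoose : IsLoose e → φ e ≈ 0#

  SatIn : (Fin n → Carrier) → Subset m → Set ℓ
  SatIn θ S = ∀ {e} → e ∈ S → Sat θ e

  loose≢half : ∀ {v t} → loose {n} ≢ half v t
  loose≢half ()

  sat-loose : ∀ {θ e} → IsLoose e → φ e ≈ 0# → Sat θ e
  sat-loose {θ} {e} l eq = record
    { onStep = λ s → ⊥-elim (loose-no-hop {e} l (step-hop {e} s)) ; onHalf = λ h → ⊥-elim (loose≢half (trans (sym l) h)) ; onLoose = λ _ → eq }

  sat-half : ∀ {θ e v t} → ends e ≡ half v t → t · φ e ≈ θ v → Sat θ e
  sat-half {θ} {e} {v} {t} h eq = record
    { onStep = λ {u} {s} {w} st → ⊥-elim (subst (λ k → StepE k u s w) h st)
    ; onHalf = λ h′ → same (trans (sym h) h′) eq ; onLoose = λ l → ⊥-elim (loose≢half (trans (sym l) h)) }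
    where
    same : ∀ {v′ t′} → half v t ≡ half v′ t′ → t · φ e ≈ θ v → t′ · φ e ≈ θ v′
    same refl p = p

  sat-step : ∀ {θ e u t w} → StepE (ends e) u t w → t · φ e ≈ θ u ⊕ (⊖ (σ e · θ w)) → Sat θ e
  sat-step {θ} {e} {u} {t} {w} s eq = record
    { onStep = go (ends e) s eq ; onHalf = λ {v} {r} h → ⊥-elim (subst (λ k → StepE k u t w) h s)
    ; onLoose = λ l → ⊥-elim (loose-no-hop {e} l (step-hop {e} s)) }
    where
    flip : ∀ a b x y {z} → a · z ≈ x ⊕ (⊖ (negS (a *ˢ b) · y)) → b · z ≈ y ⊕ (⊖ (negS (a *ˢ b) · x))
    flip a b x y {z} eq = begin
      b · z ≈⟨ solve 2 (z ∷ Vec.[]) (λ a b → b :· #0) (λ a b → (a *ˢ b) :· (a :· #0)) a b ⟩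
      (a *ˢ b) · (a · z) ≈⟨ ·-cong (a *ˢ b) eq ⟩
      (a *ˢ b) · (x ⊕ (⊖ (negS (a *ˢ b) · y)))
        ≈⟨ solve 2 (x ∷ y ∷ Vec.[]) (λ a b → (a *ˢ b) :· (#0 :+ (:- (negS (a *ˢ b) :· #1)))) (λ a b → #1 :+ (:- (negS (a *ˢ b) :· #0))) a b ⟩
      y ⊕ (⊖ (negS (a *ˢ b) · x)) ∎
    flip′ : ∀ a b x y {z} → b · z ≈ x ⊕ (⊖ (negS (a *ˢ b) · y)) → a · z ≈ y ⊕ (⊖ (negS (a *ˢ b) · x))
    flip′ a b x y h rewrite Signₚ.*-comm a b = flip b a x y h
    go : ∀ k {u t w z} → StepE k u t w → t · z ≈ θ u ⊕ (⊖ (signOf k · θ w)) →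
      ∀ {u′ t′ w′} → StepE k u′ t′ w′ → t′ · z ≈ θ u′ ⊕ (⊖ (signOf k · θ w′))
    go (link v w _ τv τw) (inj₁ (refl , refl , refl)) h (inj₁ (refl , refl , refl)) = h
    go (link v w _ τv τw) (inj₁ (refl , refl , refl)) h (inj₂ (refl , refl , refl)) = flip τv τw _ _ h
    go (link v w _ τv τw) (inj₂ (refl , refl , refl)) h (inj₁ (refl , refl , refl)) = flip′ τv τw _ _ h
    go (link v w _ τv τw) (inj₂ (refl , refl , refl)) h (inj₂ (refl , refl , refl)) = h
    go (loop v τ₁ τ₂) (refl , refl , inj₁ refl) h (refl , refl , inj₁ refl) = h
    go (loop v τ₁ τ₂) (refl , refl , inj₁ refl) h (refl , refl , inj₂ refl) = flip τ₁ τ₂ _ _ h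
    go (loop v τ₁ τ₂) (refl , refl , inj₂ refl) h (refl , refl , inj₁ refl) = flip′ τ₁ τ₂ _ _ h
    go (loop v τ₁ τ₂) (refl , refl , inj₂ refl) h (refl , refl , inj₂ refl) = h

  sat-walk : ∀ {θ u w} (W : Walk u w) → (∀ {e} → e ∈ᴸ edges W → Sat θ e) → G W ≈ θ u ⊕ (⊖ (wSign W · θ w))
  sat-walk {θ} {u} [] _ = solve 0 (θ u ∷ Vec.[]) :0 (#0 :+ (:- #0))
  sat-walk {θ} {u} {x} (step {w = w} e t s W) sat = begin
    G (step e t s W) ≈⟨ G-step e t s W ⟩
    (t · φ e) ⊕ (σ e · G W) ≈⟨ +-cong (Sat.onStep (sat (here refl)) s) (·-cong (σ e) (sat-walk W (λ i → sat (there i)))) ⟩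
    (θ u ⊕ (⊖ (σ e · θ w))) ⊕ (σ e · (θ w ⊕ (⊖ (wSign W · θ x))))
      ≈⟨ solve 2 (θ u ∷ θ w ∷ θ x ∷ Vec.[]) (λ r q → (#0 :+ (:- (r :· #1))) :+ (r :· (#1 :+ (:- (q :· #2))))) (λ r q → #0 :+ (:- ((r *ˢ q) :· #2))) (σ e) (wSign W) ⟩
    θ u ⊕ (⊖ ((σ e *ˢ wSign W) · θ x)) ∎

  sat-from-walk : ∀ {θ u y z x e t} (A : Walk u y) (s : StepE (ends e) y t z) (D : Walk z x) →
    (∀ {f} → f ∈ᴸ edges A → Sat θ f) → (∀ {f} → f ∈ᴸ edges D → Sat θ f) →
    G (A ++ʷ step e t s D) ≈ θ u ⊕ (⊖ (wSign (A ++ʷ step e t s D) · θ x)) → Sat θ e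
  sat-from-walk {θ} {u} {y} {z} {x} {e} {t} A s D satA satD eq = sat-step s (begin
    t · φ e
      ≈⟨ solve 2 ((t · φ e) ∷ G A ∷ G D ∷ Vec.[]) (λ _ _ → #0)
           (λ a r → (a :· ((#1 :+ (a :· (#0 :+ (r :· #2)))) :+ (:- #1))) :+ (:- (r :· #2))) (wSign A) (σ e) ⟩
    (wSign A · ((G A ⊕ (wSign A · ((t · φ e) ⊕ (σ e · G D)))) ⊕ (⊖ G A))) ⊕ (⊖ (σ e · G D))
      ≈⟨ +-congʳ (·-cong (wSign A) (+-congʳ total)) ⟩
    (wSign A · ((θ u ⊕ (⊖ ((wSign A *ˢ (σ e *ˢ wSign D)) · θ x))) ⊕ (⊖ G A))) ⊕ (⊖ (σ e · G D))
      ≈⟨ +-cong (·-cong (wSign A) (+-congˡ (-‿cong (sat-walk A satA)))) (-‿cong (·-cong (σ e) (sat-walk D satD))) ⟩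
    (wSign A · ((θ u ⊕ (⊖ ((wSign A *ˢ (σ e *ˢ wSign D)) · θ x))) ⊕ (⊖ (θ u ⊕ (⊖ (wSign A · θ y)))))) ⊕ (⊖ (σ e · (θ z ⊕ (⊖ (wSign D · θ x)))))
      ≈⟨ solve 3 (θ u ∷ θ y ∷ θ z ∷ θ x ∷ Vec.[])
           (λ a r d → (a :· ((#0 :+ (:- ((a *ˢ (r *ˢ d)) :· #3))) :+ (:- (#0 :+ (:- (a :· #1)))))) :+ (:- (r :· (#2 :+ (:- (d :· #3))))))
           (λ a r d → #1 :+ (:- (r :· #2))) (wSign A) (σ e) (wSign D) ⟩
    θ y ⊕ (⊖ (σ e · θ z)) ∎)
    where
    total : G A ⊕ (wSign A · ((t · φ e) ⊕ (σ e · G D))) ≈ θ u ⊕ (⊖ ((wSign A *ˢ (σ e *ˢ wSign D)) · θ x))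
    total = begin
      G A ⊕ (wSign A · ((t · φ e) ⊕ (σ e · G D))) ≈⟨ +-congˡ (·-cong (wSign A) (G-step e t s D)) ⟨
      G A ⊕ (wSign A · G (step e t s D)) ≈⟨ G-++ A (step e t s D) ⟨
      G (A ++ʷ step e t s D) ≈⟨ eq ⟩
      θ u ⊕ (⊖ (wSign (A ++ʷ step e t s D) · θ x)) ≡⟨ cong (λ a → θ u ⊕ (⊖ (a · θ x))) (wSign-++ A (step e t s D)) ⟩
      θ u ⊕ (⊖ ((wSign A *ˢ (σ e *ˢ wSign D)) · θ x)) ∎

  figGain : ∀ {a} → FigureAt a → Carrier
  figGain (circ W _) = G W
  figGain (halfF e t _) = (t · φ e) ⊕ (t · φ e)

  discrepancy : ∀ {a b} → FigureAt a → Walk a b → FigureAt b → Carrier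
  discrepancy F₁ P F₂ = (figGain F₁ ⊕ (⊖ (G P ⊕ G P))) ⊕ (⊖ (wSign P · figGain F₂))

  G-detour : ∀ {a b} (P : Walk a b) (C : Walk b b) → wSign C ≡ ₋ →
    G (P ++ʷ (C ++ʷ rev P)) ≈ (G P ⊕ G P) ⊕ (wSign P · G C)
  G-detour P C neg = begin
    G (P ++ʷ (C ++ʷ rev P)) ≈⟨ G-++ P _ ⟩
    G P ⊕ (wSign P · G (C ++ʷ rev P)) ≈⟨ +-congˡ (·-cong (wSign P) (G-++ C (rev P))) ⟩
    G P ⊕ (wSign P · (G C ⊕ (wSign C · G (rev P)))) ≡⟨ cong (λ s → G P ⊕ (wSign P · (G C ⊕ (s · G (rev P))))) neg ⟩
    G P ⊕ (wSign P · (G C ⊕ (⊖ G (rev P)))) ≈⟨ +-congˡ (·-cong (wSign P) (+-congˡ (-‿cong (G-rev P)))) ⟩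
    G P ⊕ (wSign P · (G C ⊕ (⊖ (⊖ (wSign P · G P)))))
      ≈⟨ solve 1 (G P ∷ G C ∷ Vec.[]) (λ p → #0 :+ (p :· (#1 :+ (:- (:- (p :· #0)))))) (λ p → (#0 :+ #0) :+ (p :· #1)) (wSign P) ⟩
    (G P ⊕ G P) ⊕ (wSign P · G C) ∎

  sign-detour : ∀ {a b} (P : Walk a b) (C : Walk b b) → wSign C ≡ ₋ → wSign (P ++ʷ (C ++ʷ rev P)) ≡ ₋
  sign-detour P C neg rewrite wSign-++ P (C ++ʷ rev P) | wSign-++ C (rev P) | wSign-rev P | neg = sign-conj (wSign P)

  hc-gain : ∀ {a b} (F₁ : FigureAt a) (P : Walk a b) (F₂ : FigureAt b) → figSign F₁ ≡ ₋ → figSign F₂ ≡ ₋ →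
    (∃[ s ] hcGainAux F₁ P F₂ ≈ s · discrepancy F₁ P F₂) ⊎ hcGainAux F₁ P F₂ ⊕ hcGainAux F₁ P F₂ ≈ discrepancy F₁ P F₂
  hc-gain (circ C₁ i₁) P (circ C₂ i₂) neg₁ neg₂ = inj₁ (₋ , (begin
    ⊖ G (C₁ ++ʷ (P ++ʷ (C₂ ++ʷ rev P))) ≈⟨ -‿cong (G-++ C₁ _) ⟩
    ⊖ (G C₁ ⊕ (wSign C₁ · G (P ++ʷ (C₂ ++ʷ rev P)))) ≡⟨ cong (λ s → ⊖ (G C₁ ⊕ (s · G (P ++ʷ (C₂ ++ʷ rev P))))) neg₁ ⟩
    ⊖ (G C₁ ⊕ (⊖ G (P ++ʷ (C₂ ++ʷ rev P)))) ≈⟨ -‿cong (+-congˡ (-‿cong (G-detour P C₂ neg₂))) ⟩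
    ⊖ (G C₁ ⊕ (⊖ ((G P ⊕ G P) ⊕ (wSign P · G C₂))))
      ≈⟨ solve 1 (G C₁ ∷ G P ∷ G C₂ ∷ Vec.[]) (λ p → :- (#0 :+ (:- ((#1 :+ #1) :+ (p :· #2))))) (λ p → :- ((#0 :+ (:- (#1 :+ #1))) :+ (:- (p :· #2)))) (wSign P) ⟩
    ⊖ discrepancy (circ C₁ i₁) P (circ C₂ i₂) ∎))
  hc-gain (halfF e t i₁) P (circ C i₂) _ neg = inj₁ (₊ , (begin
    ((t · φ e) ⊕ (⊖ G W)) ⊕ (⊖ ((wSign W *ˢ t) · φ e)) ≡⟨ cong (λ s → ((t · φ e) ⊕ (⊖ G W)) ⊕ (⊖ ((s *ˢ t) · φ e))) (sign-detour P C neg) ⟩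
    ((t · φ e) ⊕ (⊖ G W)) ⊕ (⊖ ((₋ *ˢ t) · φ e)) ≈⟨ +-congʳ (+-congˡ (-‿cong (G-detour P C neg))) ⟩
    ((t · φ e) ⊕ (⊖ ((G P ⊕ G P) ⊕ (wSign P · G C)))) ⊕ (⊖ ((₋ *ˢ t) · φ e))
      ≈⟨ solve 2 (φ e ∷ G P ∷ G C ∷ Vec.[])
           (λ t p → ((t :· #0) :+ (:- ((#1 :+ #1) :+ (p :· #2)))) :+ (:- ((₋ *ˢ t) :· #0)))
           (λ t p → (((t :· #0) :+ (t :· #0)) :+ (:- (#1 :+ #1))) :+ (:- (p :· #2))) t (wSign P) ⟩
    discrepancy (halfF e t i₁) P (circ C i₂) ∎))
    where W = P ++ʷ (C ++ʷ rev P)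
  hc-gain (circ C i₁) P (halfF e t i₂) neg _ = inj₁ (₋ *ˢ wSign P , (begin
    ((t · φ e) ⊕ (⊖ G W)) ⊕ (⊖ ((wSign W *ˢ t) · φ e)) ≡⟨ cong (λ s → ((t · φ e) ⊕ (⊖ G W)) ⊕ (⊖ ((s *ˢ t) · φ e))) sign ⟩
    ((t · φ e) ⊕ (⊖ G W)) ⊕ (⊖ ((₋ *ˢ t) · φ e)) ≈⟨ +-congʳ (+-congˡ (-‿cong gain-W)) ⟩
    ((t · φ e) ⊕ (⊖ ((⊖ (wSign P · G P)) ⊕ (wSign P · (G C ⊕ (⊖ G P)))))) ⊕ (⊖ ((₋ *ˢ t) · φ e))
      ≈⟨ solve 2 (φ e ∷ G P ∷ G C ∷ Vec.[])
           (λ t p → ((t :· #0) :+ (:- ((:- (p :· #1)) :+ (p :· (#2 :+ (:- #1)))))) :+ (:- ((₋ *ˢ t) :· #0)))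
           (λ t p → (₋ *ˢ p) :· ((#2 :+ (:- (#1 :+ #1))) :+ (:- (p :· ((t :· #0) :+ (t :· #0)))))) t (wSign P) ⟩
    (₋ *ˢ wSign P) · discrepancy (circ C i₁) P (halfF e t i₂) ∎))
    where
    W = rev P ++ʷ (C ++ʷ P)
    sign : wSign W ≡ ₋
    sign rewrite wSign-++ (rev P) (C ++ʷ P) | wSign-++ C P | wSign-rev P | neg = sign-conj (wSign P)
    gain-W : G W ≈ (⊖ (wSign P · G P)) ⊕ (wSign P · (G C ⊕ (⊖ G P)))
    gain-W = begin
      G W ≈⟨ G-++ (rev P) _ ⟩
      G (rev P) ⊕ (wSign (rev P) · G (C ++ʷ P)) ≡⟨ cong (λ s → G (rev P) ⊕ (s · G (C ++ʷ P))) (wSign-rev P) ⟩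
      G (rev P) ⊕ (wSign P · G (C ++ʷ P)) ≈⟨ +-cong (G-rev P) (·-cong (wSign P) (G-++ C P)) ⟩
      (⊖ (wSign P · G P)) ⊕ (wSign P · (G C ⊕ (wSign C · G P))) ≡⟨ cong (λ s → (⊖ (wSign P · G P)) ⊕ (wSign P · (G C ⊕ (s · G P)))) neg ⟩
      (⊖ (wSign P · G P)) ⊕ (wSign P · (G C ⊕ (⊖ G P))) ∎
  hc-gain (halfF e t _) P (halfF f r _) _ _ = inj₂
    (solve 3 (φ e ∷ G P ∷ φ f ∷ Vec.[])
      (λ t p r → (((t :· #0) :+ (:- #1)) :+ (:- ((p *ˢ r) :· #2))) :+ (((t :· #0) :+ (:- #1)) :+ (:- ((p *ˢ r) :· #2))))
      (λ t p r → (((t :· #0) :+ (t :· #0)) :+ (:- (#1 :+ #1))) :+ (:- (p :· ((r :· #2) :+ (r :· #2))))) t (wSign P) r)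

  ·-zero : ∀ s → s · 0# ≈ 0#
  ·-zero s = solve 1 Vec.[] (λ s → s :· :0) (λ _ → :0) s

  zero+zero : 0# ⊕ 0# ≈ 0#
  zero+zero = +-identityˡ 0#

  neutral⇒balanced : ∀ {a b} (F₁ : FigureAt a) (P : Walk a b) (F₂ : FigureAt b) → figSign F₁ ≡ ₋ → figSign F₂ ≡ ₋ →
    hcGainAux F₁ P F₂ ≈ 0# → discrepancy F₁ P F₂ ≈ 0#
  neutral⇒balanced F₁ P F₂ n₁ n₂ h with hc-gain F₁ P F₂ n₁ n₂
  ... | inj₁ (s , eq) = begin
    D ≈⟨ solve 1 (D ∷ Vec.[]) (λ _ → #0) (λ s → s :· (s :· #0)) s ⟩
    s · (s · D) ≈⟨ ·-cong s (≈-trans (≈-sym eq) h) ⟩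
    s · 0# ≈⟨ ·-zero s ⟩
    0# ∎
    where D = discrepancy F₁ P F₂
  ... | inj₂ eq = ≈-trans (≈-sym eq) (≈-trans (+-cong h h) zero+zero)

  balanced⇒neutral : ∀ {a b} (F₁ : FigureAt a) (P : Walk a b) (F₂ : FigureAt b) → figSign F₁ ≡ ₋ → figSign F₂ ≡ ₋ →
    discrepancy F₁ P F₂ ≈ 0# → hcGainAux F₁ P F₂ ≈ 0#
  balanced⇒neutral F₁ P F₂ n₁ n₂ h with hc-gain F₁ P F₂ n₁ n₂
  ... | inj₁ (s , eq) = ≈-trans eq (≈-trans (·-cong s h) (·-zero s))
  ... | inj₂ eq = double-injective (≈-trans eq (≈-trans h (≈-sym zero+zero)))

  figGain-sat : ∀ {θ a} (f : FigureAt a) → figSign f ≡ ₋ → (∀ {e} → e ∈ᴸ figEdges f → Sat θ e) → figGain f ≈ θ a ⊕ θ a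
  figGain-sat {θ} {a} (circ W _) neg sat = begin
    G W ≈⟨ sat-walk W sat ⟩
    θ a ⊕ (⊖ (wSign W · θ a)) ≡⟨ cong (λ s → θ a ⊕ (⊖ (s · θ a))) neg ⟩
    θ a ⊕ (⊖ (⊖ θ a)) ≈⟨ solve 0 (θ a ∷ Vec.[]) (#0 :+ (:- (:- #0))) (#0 :+ #0) ⟩
    θ a ⊕ θ a ∎
  figGain-sat (halfF e t h) _ sat = +-cong (Sat.onHalf (sat (here refl)) h) (Sat.onHalf (sat (here refl)) h)

  discrepancy-sat : ∀ {θ a b} (F₁ : FigureAt a) (P : Walk a b) (F₂ : FigureAt b) → figSign F₁ ≡ ₋ → figSign F₂ ≡ ₋ →
    (∀ {e} → e ∈ᴸ figEdges F₁ ++ edges P ++ figEdges F₂ → Sat θ e) → discrepancy F₁ P F₂ ≈ 0#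
  discrepancy-sat {θ} {a} {b} F₁ P F₂ n₁ n₂ sat = begin
    (figGain F₁ ⊕ (⊖ (G P ⊕ G P))) ⊕ (⊖ (wSign P · figGain F₂))
      ≈⟨ +-cong (+-cong (figGain-sat F₁ n₁ (λ i → sat (∈-++⁺ˡ i))) (-‿cong (+-cong gp gp)))
           (-‿cong (·-cong (wSign P) (figGain-sat F₂ n₂ (λ i → sat (∈-++⁺ʳ (figEdges F₁) (∈-++⁺ʳ (edges P) i)))))) ⟩
    ((θ a ⊕ θ a) ⊕ (⊖ ((θ a ⊕ (⊖ (wSign P · θ b))) ⊕ (θ a ⊕ (⊖ (wSign P · θ b)))))) ⊕ (⊖ (wSign P · (θ b ⊕ θ b)))
      ≈⟨ solve 1 (θ a ∷ θ b ∷ Vec.[]) (λ p → ((#0 :+ #0) :+ (:- ((#0 :+ (:- (p :· #1))) :+ (#0 :+ (:- (p :· #1)))))) :+ (:- (p :· (#1 :+ #1)))) (λ _ → :0) (wSign P) ⟩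
    0# ∎
    where
    gp : G P ≈ θ a ⊕ (⊖ (wSign P · θ b))
    gp = sat-walk P (λ i → sat (∈-++⁺ʳ (figEdges F₁) (∈-++⁺ˡ i)))

  setOf⁺ : ∀ {xs e} → e ∈ᴸ xs → e ∈ setOf xs
  setOf⁺ {x ∷ xs} (here refl) = p⊆p∪q (setOf xs) (x∈⁅x⁆ x)
  setOf⁺ {x ∷ xs} (there i) = q⊆p∪q ⁅ x ⁆ (setOf xs) (setOf⁺ i)

  setOf⁻ : ∀ xs {e} → e ∈ setOf xs → e ∈ᴸ xs
  setOf⁻ [] i = ⊥-elim (∉⊥ i)
  setOf⁻ (x ∷ xs) i with x∈p∪q⁻ ⁅ x ⁆ (setOf xs) i
  ... | inj₁ j = here (x∈⁅y⁆⇒x≡y x j)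
  ... | inj₂ j = there (setOf⁻ xs j)

  within-setOf : ∀ {S} xs → setOf xs ⊆ S → Within S xs
  within-setOf xs i e∈ = i (setOf⁺ e∈)

  setOf-within : ∀ {S} xs → Within S xs → setOf xs ⊆ S
  setOf-within xs i e∈ = i (setOf⁻ xs e∈)

  sat-hyperbalanced : ∀ {θ S} → SatIn θ S → Hyperbalanced S
  sat-hyperbalanced {θ} {S} sat C _ C⊆S w eq = go w λ i → sat (C⊆S (subst (_ ∈_) eq (setOf⁺ i)))
    where
    go : ∀ w → (∀ {e} → e ∈ᴸ cwEdges w → Sat θ e) → cwGain w ≈ 0#
    go (posCirc {a} W _ pos) sat = begin
      ⊖ G W ≈⟨ -‿cong (sat-walk W sat) ⟩
      ⊖ (θ a ⊕ (⊖ (wSign W · θ a))) ≡⟨ cong (λ s → ⊖ (θ a ⊕ (⊖ (s · θ a)))) pos ⟩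
      ⊖ (θ a ⊕ (⊖ θ a)) ≈⟨ solve 0 (θ a ∷ Vec.[]) (:- (#0 :+ (:- #0))) :0 ⟩
      0# ∎
    go (looseC e l) sat = Sat.onLoose (sat (here refl)) l
    go (hcC h n₁ n₂) sat = balanced⇒neutral F₁ P F₂ n₁ n₂ (discrepancy-sat F₁ P F₂ n₁ n₂ sat)
      where
      open Handcuff h

  hyperbalanced-mono : ∀ {S T} → S ⊆ T → Hyperbalanced T → Hyperbalanced S
  hyperbalanced-mono S⊆T hb C c C⊆S = hb C c (λ i → S⊆T (C⊆S i))

  -- Switching and shifting the potential along the balanced component of v makes the
  -- relation at e hold without disturbing the other edges.
  extend-potential : ∀ {T e θ} → Drop (T - e) e → SatIn θ (T - e) → ∃[ θ′ ] SatIn θ′ T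
  extend-potential {T} {e} {θ} (mkDrop {v} {w} hop ¬sc ¬unb) satS = θ′ , sat′
    where
    S = T - e
    bump : Carrier → Fin n → Carrier
    bump c u with sc? S v ₊ u | sc? S v ₋ u
    ... | yes _ | _ = c
    ... | no _ | yes _ = ⊖ c
    ... | no _ | no _ = 0#
    bump-sc : ∀ c {s u} → SC S v s u → bump c u ≡ s · c
    bump-sc c {s} {u} d with sc? S v ₊ u | sc? S v ₋ u
    bump-sc c {₊} d | yes _ | _ = refl
    bump-sc c {₋} d | yes d′ | _ with sc-sign d d′
    ... | inj₂ unb = ⊥-elim (¬unb unb)
    bump-sc c {₊} d | no ¬d | _ = ⊥-elim (¬d d)
    bump-sc c {₋} d | no _ | yes _ = refl
    bump-sc c {₋} d | no _ | no ¬d = ⊥-elim (¬d d)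
    bump-far : ∀ c {u} → ¬ Joined S v u → bump c u ≡ 0#
    bump-far c {u} ¬j with sc? S v ₊ u | sc? S v ₋ u
    ... | yes d | _ = ⊥-elim (¬j (_ , d))
    ... | no _ | yes d = ⊥-elim (¬j (_ , d))
    ... | no _ | no _ = refl
    bump-hop : ∀ c {s u x} → SC S u s x → bump c u ≈ s · bump c x
    bump-hop c {s} {u} {x} d with joined? S v u
    ... | yes (r , d′) = begin
      bump c u ≡⟨ bump-sc c d′ ⟩
      r · c ≈⟨ solve 2 (c ∷ Vec.[]) (λ r s → r :· #0) (λ r s → s :· ((r *ˢ s) :· #0)) r s ⟩
      s · ((r *ˢ s) · c) ≡⟨ cong (s ·_) (bump-sc c (sc-trans d′ d)) ⟨
      s · bump c x ∎
    ... | no ¬j = begin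
      bump c u ≡⟨ bump-far c ¬j ⟩
      0# ≈⟨ ·-zero s ⟨
      s · 0# ≡⟨ cong (s ·_) (bump-far c (λ j → ¬j (joined-trans j (joined-sym (_ , d))))) ⟨
      s · bump c x ∎
    shift : Carrier → Fin n → Carrier
    shift c u = θ u ⊕ bump c u
    sat-shift : ∀ c {f} → f ∈ S → Sat (shift c) f
    sat-shift c {f} f∈ = record
      { onStep = λ {u} {t} {x} s → begin
          t · φ f ≈⟨ Sat.onStep (satS f∈) s ⟩
          θ u ⊕ (⊖ (σ f · θ x))
            ≈⟨ solve 1 (θ u ∷ θ x ∷ bump c x ∷ Vec.[]) (λ r → #0 :+ (:- (r :· #1))) (λ r → (#0 :+ (r :· #2)) :+ (:- (r :· (#1 :+ #2)))) (σ f) ⟩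
          (θ u ⊕ (σ f · bump c x)) ⊕ (⊖ (σ f · (θ x ⊕ bump c x))) ≈⟨ +-congʳ (+-congˡ (bump-hop c (sc-hop f∈ (step-hop {f} s)))) ⟨
          (θ u ⊕ bump c u) ⊕ (⊖ (σ f · (θ x ⊕ bump c x))) ∎
      ; onHalf = λ {u} {t} h → begin
          t · φ f ≈⟨ Sat.onHalf (satS f∈) h ⟩
          θ u ≈⟨ solve 0 (θ u ∷ Vec.[]) #0 (#0 :+ :0) ⟩
          θ u ⊕ 0# ≡⟨ cong (θ u ⊕_) (bump-far c (λ j → ¬unb (unb-resp j
                                                (sc-cast (half-sign {f} h) (sc-hop f∈ (half-hop {f} h)))))) ⟨
          θ u ⊕ bump c u ∎
      ; onLoose = Sat.onLoose (satS f∈) }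
    bump-v : ∀ c → bump c v ≡ c
    bump-v c = bump-sc c nil
    opp : ∀ a b → a *ˢ b ≡ ₋ → a ≡ ₋ *ˢ b
    opp ₊ ₋ _ = refl
    opp ₋ ₊ _ = refl
    sat-e : HopView (ends e) v w → ∃[ c ] Sat (shift c) e
    sat-e (isHalf t h eq) = c , sat-half {e = e} h (begin
      t · φ e ≈⟨ solve 0 ((t · φ e) ∷ θ v ∷ Vec.[]) #0 (#1 :+ (#0 :+ (:- #1))) ⟩
      θ v ⊕ c ≡⟨ cong (θ v ⊕_) (bump-v c) ⟨
      θ v ⊕ bump c v ∎)
      where c = (t · φ e) ⊕ (⊖ θ v)
    sat-e (isStep t s) with joined? S v w
    ... | no ¬j = c , sat-step {e = e} s (begin
      t · φ e
        ≈⟨ solve 1 ((t · φ e) ∷ θ v ∷ θ w ∷ Vec.[]) (λ r → #0) (λ r → (#1 :+ (#0 :+ (:- (#1 :+ (:- (r :· #2)))))) :+ (:- (r :· (#2 :+ :0)))) (σ e) ⟩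
      (θ v ⊕ c) ⊕ (⊖ (σ e · (θ w ⊕ 0#))) ≡⟨ cong₂ (λ y z → (θ v ⊕ y) ⊕ (⊖ (σ e · (θ w ⊕ z)))) (bump-v c) (bump-far c ¬j) ⟨
      (θ v ⊕ bump c v) ⊕ (⊖ (σ e · (θ w ⊕ bump c w))) ∎)
      where c = (t · φ e) ⊕ (⊖ (θ v ⊕ (⊖ (σ e · θ w))))
    ... | yes (r , d) with ≡-or-opposite r (σ e)
    ...   | inj₁ refl = ⊥-elim (¬sc d)
    ...   | inj₂ eq = c , sat-step {e = e} s (begin
      t · φ e
        ≈⟨ solve 1 ((t · φ e) ∷ θ v ∷ θ w ∷ Vec.[]) (λ r → #0) (λ r → (#0 :+ (:- (#1 :+ (:- (r :· #2))))) :+ (#1 :+ (:- (r :· #2)))) (σ e) ⟩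
      y ⊕ (θ v ⊕ (⊖ (σ e · θ w))) ≈⟨ +-congʳ (proj₂ two-inverse y) ⟨
      (c ⊕ c) ⊕ (θ v ⊕ (⊖ (σ e · θ w)))
        ≈⟨ solve 1 (c ∷ θ v ∷ θ w ∷ Vec.[]) (λ r → (#0 :+ #0) :+ (#1 :+ (:- (r :· #2)))) (λ r → (#1 :+ #0) :+ (:- (r :· (#2 :+ ((₋ *ˢ r) :· #0))))) (σ e) ⟩
      (θ v ⊕ c) ⊕ (⊖ (σ e · (θ w ⊕ ((₋ *ˢ σ e) · c))))
        ≡⟨ cong₂ (λ y z → (θ v ⊕ y) ⊕ (⊖ (σ e · (θ w ⊕ z)))) (bump-v c) (trans (bump-sc c d) (cong (_· c) (opp r (σ e) eq))) ⟨
      (θ v ⊕ bump c v) ⊕ (⊖ (σ e · (θ w ⊕ bump c w))) ∎)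
      where
      y = (t · φ e) ⊕ (⊖ (θ v ⊕ (⊖ (σ e · θ w))))
      c = proj₁ two-inverse ⊗ y
    chosen = sat-e (hop-view (ends e) hop)
    θ′ = shift (proj₁ chosen)
    sat′ : SatIn θ′ T
    sat′ f∈ with ∈-split e f∈
    ... | inj₁ refl = proj₂ chosen
    ... | inj₂ f∈S = sat-shift (proj₁ chosen) f∈S

  nullity-0-potential : ∀ S → Nullity S 0 → ∃[ θ ] SatIn θ S
  nullity-0-potential = subset-rec _ go
    where
    go : ∀ S → (∀ x → x ∈ S → Nullity (S - x) 0 → ∃[ θ ] SatIn θ (S - x)) → Nullity S 0 → ∃[ θ ] SatIn θ S
    go S rec N with empty-or-element S
    ... | inj₁ refl = (λ _ → 0#) , λ e∈ → ⊥-elim (∉⊥ e∈)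
    ... | inj₂ (e , e∈) with noDrop-or-drop (S - e) e
    ...   | inj₁ nd = ⊥-elim (nullity-0 e∈ nd N)
    ...   | inj₂ d = extend-potential d (proj₂ (rec e e∈ (nullity-drop⁻ e∈ d N)))

  nullity-0-hyperbalanced : ∀ {S} → Nullity S 0 → Hyperbalanced S
  nullity-0-hyperbalanced {S} N = sat-hyperbalanced (proj₂ (nullity-0-potential S N))

  -- Sign circuits through an edge

  record Reach (S : Subset m) (u : Fin n) (targets : List (Fin n)) : Set where
    field
      {z} : Fin n
      path : Walk u z
      isPath : IsPath path
      within : path ⊑ʷ S
      hit : z ∈ᴸ targets
      only : ∀ {y} → y ∈ᴸ verts path → y ∈ᴸ targets → y ≡ z

  reach : ∀ {S u x targets} → Joined S u x → x ∈ᴸ targets → Reach S u targets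
  reach {S} {targets = F} j x∈ = let mkPath W p i = joined-path j in proj₁ (go W p i x∈)
    where
    go : ∀ {u x} (W : Walk u x) → IsPath W → W ⊑ʷ S → x ∈ᴸ F →
      Σ[ R ∈ Reach S u F ] (∀ {y} → y ∈ᴸ verts (Reach.path R) → y ∈ᴸ verts W)
    go {u} W p i x∈ with u ∈ᴸ? F
    go W p i x∈ | yes u∈ = record
      { path = [] ; isPath = [] ∷ [] ; within = λ () ; hit = u∈ ; only = λ { (here eq) _ → eq } } , λ { (here refl) → start∈ W }
    go [] p i x∈ | no u∉ = ⊥-elim (u∉ x∈)
    go (step e t s W) p@(_ ∷ p′) i x∈ | no u∉ with go W p′ (λ j → i (there j)) x∈
    ... | R , sub = record
      { path = step e t s (Reach.path R) ; isPath = unique-∷ (λ u∈ → unique-∉ p (sub u∈)) (Reach.isPath R)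
      ; within = λ { (here refl) → i (here refl) ; (there j) → Reach.within R j } ; hit = Reach.hit R
      ; only = λ { (here refl) y∈ → ⊥-elim (u∉ y∈) ; (there j) y∈ → Reach.only R j y∈ } }
      , λ { (here eq) → here eq ; (there j) → there (sub j) }

  len-++ : ∀ {u w x} (A : Walk u w) (D : Walk w x) → len (A ++ʷ D) ≡ len A + len D
  len-++ [] D = refl
  len-++ (step _ _ _ A) D = cong suc (len-++ A D)

  record Rotation {a} (f : FigureAt a) (z : Fin n) : Set where
    field
      fig : FigureAt z
      edges⊆ : ∀ {e} → e ∈ᴸ figEdges fig → e ∈ᴸ figEdges f
      edges⊇ : ∀ {e} → e ∈ᴸ figEdges f → e ∈ᴸ figEdges fig
      verts⊆ : ∀ {x} → x ∈ᴸ figVerts fig → x ∈ᴸ figVerts f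
      verts⊇ : ∀ {x} → x ∈ᴸ figVerts f → x ∈ᴸ figVerts fig
      sameSign : figSign fig ≡ figSign f

  ++-swap : ∀ {A : Set} (xs ys : List A) {x} → x ∈ᴸ xs ++ ys → x ∈ᴸ ys ++ xs
  ++-swap xs ys i with ∈-++⁻ xs i
  ... | inj₁ j = ∈-++⁺ʳ ys j
  ... | inj₂ j = ∈-++⁺ˡ j

  unique-swap : ∀ {A : Set} (xs ys : List A) → Unique (xs ++ ys) → Unique (ys ++ xs)
  unique-swap xs ys u = let ux , uy , d = unique-++⁻ xs u in unique-++ uy ux (λ x p q → d x q p)

  rotate : ∀ {a} (f : FigureAt a) {z} → z ∈ᴸ figVerts f → Rotation f z
  rotate (halfF e t h) (here refl) = record
    { fig = halfF e t h ; edges⊆ = λ i → i ; edges⊇ = λ i → i ; verts⊆ = λ i → i ; verts⊇ = λ i → i ; sameSign = refl }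
  rotate (circ W c) z∈ with split-at W (init⊆verts W z∈)
  rotate (circ _ (ne , ue , uv)) z∈ | A , D , refl = record
    { fig = circ (D ++ʷ A)
        ( (λ eq → ne (trans (len-++ A D) (trans (ℕₚ.+-comm (len A) (len D)) (trans (sym (len-++ D A)) eq))))
        , subst Unique (sym (edges-++ D A)) (unique-swap (edges A) (edges D) (subst Unique (edges-++ A D) ue))
        , subst Unique (sym (init-++ D A)) (unique-swap (initVerts A) (initVerts D) (subst Unique (init-++ A D) uv)))
    ; edges⊆ = λ i → [ ∈-edges-++ʳ A D , ∈-edges-++ˡ A D ]′ (∈-edges-++⁻ D A i)
    ; edges⊇ = λ i → [ ∈-edges-++ʳ D A , ∈-edges-++ˡ D A ]′ (∈-edges-++⁻ A D i)
    ; verts⊆ = λ i → subst (_ ∈ᴸ_) (sym (init-++ A D)) (++-swap (initVerts D) (initVerts A) (subst (_ ∈ᴸ_) (init-++ D A) i))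
    ; verts⊇ = λ i → subst (_ ∈ᴸ_) (sym (init-++ D A)) (++-swap (initVerts A) (initVerts D) (subst (_ ∈ᴸ_) (init-++ A D) i))
    ; sameSign = trans (wSign-++ D A) (trans (Signₚ.*-comm (wSign D) (wSign A)) (sym (wSign-++ A D))) }

  init-path : ∀ {u w} (W : Walk u w) → Unique (initVerts W) → w ∉ᴸ initVerts W → IsPath W
  init-path [] _ _ = [] ∷ []
  init-path (step e t s W) u@(_ ∷ u′) w∉ = unique-∷
    (λ i → [ unique-∉ u , (λ { refl → w∉ (here refl) }) ]′ (verts⊆init W i)) (init-path W u′ (λ i → w∉ (there i)))

  start∈init : ∀ {u w} (W : Walk u w) → u ≢ w → u ∈ᴸ initVerts W
  start∈init [] ne = ⊥-elim (ne refl)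
  start∈init (step _ _ _ _) _ = here refl

  record Arcs {a} (W : Walk a a) (z : Fin n) : Set where
    field
      A : Walk a z
      D : Walk z a
      whole : W ≡ A ++ʷ D
      pathA : IsPath A
      pathD : IsPath D
      meet : ∀ {x} → x ∈ᴸ verts A → x ∈ᴸ verts D → x ≡ a ⊎ x ≡ z
      apart : ∀ e → e ∈ᴸ edges A → e ∈ᴸ edges D → ⊥

  arcs : ∀ {a} (W : Walk a a) → IsCircleWalk W → ∀ {z} → z ∈ᴸ initVerts W → a ≢ z → Arcs W z
  arcs {a} W (ne , ue , uv) {z} z∈ a≢z with split-at W (init⊆verts W z∈)
  ... | A , D , refl with unique-++⁻ (initVerts A) (subst Unique (init-++ A D) uv) | unique-++⁻ (edges A) (subst Unique (edges-++ A D) ue)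
  ...   | uA , uD , disj | _ , _ , eDisj = record
    { A = A ; D = D ; whole = refl
    ; pathA = init-path A uA (λ i → disj z i (start∈init D (λ eq → a≢z (sym eq))))
    ; pathD = init-path D uD (λ i → disj a (start∈init A a≢z) i)
    ; meet = λ i j → meet (verts⊆init A i) (verts⊆init D j) ; apart = eDisj }
    where
    meet : ∀ {x} → x ∈ᴸ initVerts A ⊎ x ≡ z → x ∈ᴸ initVerts D ⊎ x ≡ a → x ≡ a ⊎ x ≡ z
    meet (inj₁ i) (inj₁ j) = ⊥-elim (disj _ i j)
    meet (inj₂ eq) _ = inj₂ eq
    meet _ (inj₂ eq) = inj₁ eq

  edge-verts : ∀ {u w} (W : Walk u w) {e y z} → e ∈ᴸ edges W → Hop e y z → y ∈ᴸ verts W × z ∈ᴸ verts W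
  edge-verts W {e} i h with edge-ends W i
  ... | y , z , h′ , _ , y∈ , z∈ with hop-unique e h′ h
  ...   | inj₁ (refl , refl) = y∈ , z∈
  ...   | inj₂ (refl , refl) = z∈ , y∈

  base∈ : ∀ {a} (f : FigureAt a) → a ∈ᴸ figVerts f
  base∈ (circ [] (ne , _)) = ⊥-elim (ne refl)
  base∈ (circ (step _ _ _ _) _) = here refl
  base∈ (halfF _ _ _) = here refl

  fig-edge-verts : ∀ {a} (f : FigureAt a) {e y z} → e ∈ᴸ figEdges f → Hop e y z → y ∈ᴸ figVerts f × z ∈ᴸ figVerts f
  fig-edge-verts f@(circ W c) i h with edge-verts W i h
  ... | y∈ , z∈ = go (verts⊆init W y∈) , go (verts⊆init W z∈)
    where
    go : ∀ {x} → x ∈ᴸ initVerts W ⊎ x ≡ _ → x ∈ᴸ initVerts W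
    go (inj₁ j) = j
    go (inj₂ refl) = base∈ f
  fig-edge-verts (halfF e t eq) (here refl) h with subst (λ k → HopE k _ _) eq h
  ... | refl , refl = here refl , here refl

  path-edge : ∀ {u w} (W : Walk u w) → IsPath W → ∀ {e} → e ∈ᴸ edges W → ∃[ y ] ∃[ z ] (Hop e y z × y ≢ z)
  path-edge (step e t s W) p (here refl) = _ , _ , step-hop {e} s , λ { refl → unique-∉ p (start∈ W) }
  path-edge (step e t s W) (_ ∷ p) (there i) = path-edge W p i

  path-fig-disjoint : ∀ {u w a c} {P : Walk u w} → IsPath P → (f : FigureAt a) →
    (∀ {x} → x ∈ᴸ figVerts f → x ∈ᴸ verts P → x ≡ c) → ∀ e → e ∈ᴸ edges P → e ∈ᴸ figEdges f → ⊥
  path-fig-disjoint {P = P} p f meet e i j with path-edge P p i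
  ... | y , z , h , y≢z with edge-verts P i h | fig-edge-verts f j h
  ...   | y∈ , z∈ | y∈′ , z∈′ = y≢z (trans (meet y∈′ y∈) (sym (meet z∈′ z∈)))

  mkHandcuff : ∀ {a b} (F₁ : FigureAt a) (P : Walk a b) (F₂ : FigureAt b) → IsPath P →
    (∀ x → x ∈ᴸ figVerts F₁ → x ∈ᴸ verts P → x ≡ a) →
    (∀ x → x ∈ᴸ figVerts F₂ → x ∈ᴸ verts P → x ≡ b) →
    (∀ x → x ∈ᴸ figVerts F₁ → x ∈ᴸ figVerts F₂ → (x ≡ a × a ≡ b)) →
    (∀ e → e ∈ᴸ figEdges F₁ → e ∈ᴸ figEdges F₂ → ⊥) → Handcuff
  mkHandcuff {a} {b} F₁ P F₂ p d₁ d₂ d₁₂ disj = record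
    { a = a ; b = b ; F₁ = F₁ ; P = P ; F₂ = F₂ ; path = p ; dis₁ = d₁ ; dis₂ = d₂ ; dis₁₂ = d₁₂
    ; edgesDistinct = unique-++ (unique-fig F₁) (unique-++ (path-edges-unique P p) (unique-fig F₂) (path-fig-disjoint p F₂ (d₂ _)))
        λ e i j → [ (λ j′ → path-fig-disjoint p F₁ (d₁ _) e j′ i) , disj e i ]′ (∈-++⁻ (edges P) j) }
    where
    unique-fig : ∀ {a} (f : FigureAt a) → Unique (figEdges f)
    unique-fig (circ _ (_ , u , _)) = u
    unique-fig (halfF _ _ _) = [] ∷ []

  circ-force : ∀ {θ z e} (W : Walk z z) → IsCircleWalk W → e ∈ᴸ edges W → (∀ {g} → g ∈ᴸ edges W → g ≢ e → Sat θ g) →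
    G W ≈ θ z ⊕ (⊖ (wSign W · θ z)) → Sat θ e
  circ-force W (_ , ue , _) e∈ sat eq with split-once W ue e∈
  ... | record { split = edgeSplit A s D refl ; front⊆ = A⊆ ; back⊆ = D⊆ } = sat-from-walk A s D
    (λ i → sat (proj₁ (A⊆ i)) (proj₂ (A⊆ i))) (λ i → sat (proj₁ (D⊆ i)) (proj₂ (D⊆ i))) eq

  neg-fig-force : ∀ {θ z e} (f : FigureAt z) → figSign f ≡ ₋ → e ∈ᴸ figEdges f → (∀ {g} → g ∈ᴸ figEdges f → g ≢ e → Sat θ g) →
    figGain f ≈ θ z ⊕ θ z → Sat θ e
  neg-fig-force {θ} {z} (circ W c) neg e∈ sat eq = circ-force W c e∈ sat (begin
    G W ≈⟨ eq ⟩
    θ z ⊕ θ z ≈⟨ solve 0 (θ z ∷ Vec.[]) (#0 :+ #0) (#0 :+ (:- (:- #0))) ⟩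
    θ z ⊕ (⊖ (⊖ θ z)) ≡⟨ cong (λ s → θ z ⊕ (⊖ (s · θ z))) neg ⟨
    θ z ⊕ (⊖ (wSign W · θ z)) ∎)
  neg-fig-force (halfF e t h) _ (here refl) _ eq = sat-half {e = e} h (double-injective eq)

  pos-circ-force : ∀ {θ z e} (W : Walk z z) → IsCircleWalk W → wSign W ≡ ₊ → e ∈ᴸ edges W → (∀ {g} → g ∈ᴸ edges W → g ≢ e → Sat θ g) →
    wGain W ≈ 0# → Sat θ e
  pos-circ-force {θ} {z} W c pos e∈ sat eq = circ-force W c e∈ sat (begin
    G W ≈⟨ solve 0 (G W ∷ Vec.[]) #0 (:- (:- #0)) ⟩
    ⊖ wGain W ≈⟨ -‿cong eq ⟩
    ⊖ 0# ≈⟨ solve 0 (θ z ∷ Vec.[]) (:- :0) (#0 :+ (:- #0)) ⟩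
    θ z ⊕ (⊖ θ z) ≡⟨ cong (λ s → θ z ⊕ (⊖ (s · θ z))) pos ⟨
    θ z ⊕ (⊖ (wSign W · θ z)) ∎)

  record FundamentalCircuit (T : Subset m) (e : Fin m) : Set (κ ⊔ ℓ) where
    field
      circuit : CircuitWalk
      inside : Within T (cwEdges circuit)
      force : ∀ {θ} → SatIn θ (T - e) → cwGain circuit ≈ 0# → Sat θ e

  record Ear (T : Subset m) (e : Fin m) (v : Fin n) : Set (κ ⊔ ℓ) where
    field
      list : List (Fin m)
      isTH : IsThetaOrHandcuff (setOf list)
      inside : Within T list
      {a b} : Fin n
      f : FigureAt a
      f⊆ : f ⊑ setOf list
      v~f : Joined T v a
      f-neg : figSign f ≡ ₋
      g : FigureAt b
      g⊆ : g ⊑ setOf list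
      {x} : Fin m
      x∈g : x ∈ᴸ figEdges g
      x∉f : x ∉ᴸ figEdges f
      fundamental : FundamentalCircuit T e
      circuit⊆ : Within (setOf list) (cwEdges (FundamentalCircuit.circuit fundamental))

  pos-circuit : ∀ {T e a} (f : FigureAt a) → figSign f ≡ ₊ → f ⊑ T → e ∈ᴸ figEdges f →
    Σ[ C ∈ FundamentalCircuit T e ] cwEdges (FundamentalCircuit.circuit C) ≡ figEdges f
  pos-circuit {T} (circ W c) pos i e∈ = record
    { circuit = posCirc W c pos ; inside = i
    ; force = λ sat → pos-circ-force W c pos e∈ (λ g∈ g≢e → sat (x∈p∧x≢y⇒x∈p-y (i g∈) g≢e)) } , refl
  pos-circuit (halfF _ _ _) () _ _

  Meets : Subset m → Fin n → Fin m → Set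
  Meets S u g = ∃[ y ] ∃[ z ] (Hop g y z × Joined S u y)

  walk-near : ∀ {S u w} (W : Walk u w) → W ⊑ʷ S → ∀ {g} → g ∈ᴸ edges W → Meets S u g
  walk-near (step e t s W) i (here refl) = _ , _ , step-hop {e} s , _ , nil
  walk-near (step e t s W) i (there j) with walk-near W (λ k → i (there k)) j
  ... | y , z , h , r = y , z , h , joined-trans (_ , sc-hop (i (here refl)) (step-hop {e} s)) r

  fig-near : ∀ {S a} (f : FigureAt a) → f ⊑ S → ∀ {g} → g ∈ᴸ figEdges f → Meets S a g
  fig-near (circ W _) i j = walk-near W i j
  fig-near (halfF e t h) i (here refl) = _ , _ , half-hop {e} h , _ , nil

  walk-joined : ∀ {S u w} (W : Walk u w) → W ⊑ʷ S → ∀ {x} → x ∈ᴸ verts W → Joined S u x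
  walk-joined [] i (here refl) = _ , nil
  walk-joined (step e t s W) i (here refl) = _ , nil
  walk-joined (step e t s W) i (there j) = joined-trans (_ , sc-hop (i (here refl)) (step-hop {e} s)) (walk-joined W (λ k → i (there k)) j)

  fig-joined : ∀ {S a} (f : FigureAt a) → f ⊑ S → ∀ {x} → x ∈ᴸ figVerts f → Joined S a x
  fig-joined (circ W _) i j = walk-joined W i (init⊆verts W j)
  fig-joined (halfF e t h) i (here refl) = _ , nil

  disc-figure : ∀ {θ a b} (F₁ : FigureAt a) (P : Walk a b) (F₂ : FigureAt b) → figSign F₂ ≡ ₋ →
    (∀ {e} → e ∈ᴸ edges P → Sat θ e) → (∀ {e} → e ∈ᴸ figEdges F₂ → Sat θ e) →
    discrepancy F₁ P F₂ ≈ 0# → figGain F₁ ≈ θ a ⊕ θ a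
  disc-figure {θ} {a} {b} F₁ P F₂ n₂ satP sat₂ eq = begin
    figGain F₁
      ≈⟨ solve 1 (figGain F₁ ∷ G P ∷ figGain F₂ ∷ Vec.[]) (λ _ → #0) (λ p → ((#0 :+ (:- (#1 :+ #1))) :+ (:- (p :· #2))) :+ ((#1 :+ #1) :+ (p :· #2))) (wSign P) ⟩
    discrepancy F₁ P F₂ ⊕ ((G P ⊕ G P) ⊕ (wSign P · figGain F₂))
      ≈⟨ +-cong eq (+-cong (+-cong gp gp) (·-cong (wSign P) (figGain-sat F₂ n₂ sat₂))) ⟩
    0# ⊕ (((θ a ⊕ (⊖ (wSign P · θ b))) ⊕ (θ a ⊕ (⊖ (wSign P · θ b)))) ⊕ (wSign P · (θ b ⊕ θ b)))
      ≈⟨ solve 1 (θ a ∷ θ b ∷ Vec.[]) (λ p → :0 :+ (((#0 :+ (:- (p :· #1))) :+ (#0 :+ (:- (p :· #1)))) :+ (p :· (#1 :+ #1)))) (λ _ → #0 :+ #0) (wSign P) ⟩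
    θ a ⊕ θ a ∎
    where
    gp : G P ≈ θ a ⊕ (⊖ (wSign P · θ b))
    gp = sat-walk P satP

  disc-path : ∀ {θ a b} (F₁ : FigureAt a) (P : Walk a b) (F₂ : FigureAt b) → figSign F₁ ≡ ₋ → figSign F₂ ≡ ₋ →
    (∀ {e} → e ∈ᴸ figEdges F₁ → Sat θ e) → (∀ {e} → e ∈ᴸ figEdges F₂ → Sat θ e) →
    discrepancy F₁ P F₂ ≈ 0# → G P ≈ θ a ⊕ (⊖ (wSign P · θ b))
  disc-path {θ} {a} {b} F₁ P F₂ n₁ n₂ sat₁ sat₂ eq = double-injective (begin
    G P ⊕ G P
      ≈⟨ solve 1 (figGain F₁ ∷ G P ∷ figGain F₂ ∷ Vec.[]) (λ _ → #1 :+ #1) (λ p → (:- ((#0 :+ (:- (#1 :+ #1))) :+ (:- (p :· #2)))) :+ (#0 :+ (:- (p :· #2)))) (wSign P) ⟩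
    (⊖ discrepancy F₁ P F₂) ⊕ (figGain F₁ ⊕ (⊖ (wSign P · figGain F₂)))
      ≈⟨ +-cong (-‿cong eq) (+-cong (figGain-sat F₁ n₁ sat₁) (-‿cong (·-cong (wSign P) (figGain-sat F₂ n₂ sat₂)))) ⟩
    (⊖ 0#) ⊕ ((θ a ⊕ θ a) ⊕ (⊖ (wSign P · (θ b ⊕ θ b))))
      ≈⟨ solve 1 (θ a ∷ θ b ∷ Vec.[]) (λ p → (:- :0) :+ ((#0 :+ #0) :+ (:- (p :· (#1 :+ #1))))) (λ p → (#0 :+ (:- (p :· #1))) :+ (#0 :+ (:- (p :· #1)))) (wSign P) ⟩
    (θ a ⊕ (⊖ (wSign P · θ b))) ⊕ (θ a ⊕ (⊖ (wSign P · θ b))) ∎)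

  sign-cases : ∀ s → s ≡ ₊ ⊎ s ≡ ₋
  sign-cases ₊ = inj₁ refl
  sign-cases ₋ = inj₂ refl

  ear-handcuff : ∀ {T e v w a₀ z a′} → e ∈ T → Hop e v w →
    (f₀ : FigureAt a₀) → f₀ ⊑ T - e → figSign f₀ ≡ ₋ → a′ ∈ᴸ figVerts f₀ →
    (p₁ : Walk v z) (p₂ : Walk z a′) → IsPath (p₁ ++ʷ p₂) → (p₁ ++ʷ p₂) ⊑ʷ T - e →
    (∀ {x} → x ∈ᴸ verts (p₁ ++ʷ p₂) → x ∈ᴸ figVerts f₀ → x ≡ a′) →
    (q : Walk w z) → IsPath q → q ⊑ʷ T - e →
    (∀ {x} → x ∈ᴸ verts q → x ∈ᴸ figVerts f₀ ++ verts (p₁ ++ʷ p₂) → x ≡ z) → Ear T e v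
  ear-handcuff {T} {e} {v} {w} {a₀} {z} {a′} e∈T hop f₀ inf neg a′∈ p₁ p₂ pp inp p-only q pq inq q-only
    with path-++⁻ p₁ pp
  ... | pp₁ , pp₂ , meet = record
    { list = hcEdges h ; isTH = inj₂ (h , refl)
    ; inside = inside ; v~f = _ , walk-sc (p₁ ++ʷ p₂) (λ i → S⊆T (inp i))
    ; f = F₂ ; f⊆ = λ i → setOf⁺ (∈-++⁺ʳ (figEdges F₁) (∈-++⁺ʳ (edges p₂) i)) ; f-neg = neg₂
    ; g = F₁ ; g⊆ = λ i → setOf⁺ (∈-++⁺ˡ i) ; x∈g = e∈F₁ ; x∉f = λ i → x∉p-x T (inf (Rotation.edges⊆ R₂ i))
    ; fundamental = proj₁ fund ; circuit⊆ = λ i → setOf⁺ (proj₂ fund i) }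
    where
    S⊆T : T - e ⊆ T
    S⊆T = T-x⊆T
    P₀ = q ++ʷ revʷ p₁
    in₁′ : p₁ ⊑ʷ T - e
    in₁′ i = inp (∈-edges-++ˡ p₁ p₂ i)
    inP₀ : P₀ ⊑ʷ T - e
    inP₀ i = [ inq , (λ j → in₁′ (rev-edges p₁ j)) ]′ (∈-edges-++⁻ q (revʷ p₁) i)
    pP₀ : IsPath P₀
    pP₀ = path-++ pq (rev-path pp₁) (λ i j → q-only i (∈-++⁺ʳ (figVerts f₀) (verts-++ˡ p₁ p₂ (rev-verts p₁ j))))
    cl : Closing e P₀
    cl = closing hop P₀ pP₀ (λ i → x∉p-x T (inP₀ i))
    R₁ : Rotation (Closing.fig cl) z
    R₁ = rotate (Closing.fig cl) (Closing.figVerts⊇ cl (verts-++ˡ q (revʷ p₁) (end∈ q)))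
    R₂ : Rotation f₀ a′
    R₂ = rotate f₀ a′∈
    F₁ = Rotation.fig R₁
    F₂ = Rotation.fig R₂
    neg₂ : figSign F₂ ≡ ₋
    neg₂ = trans (Rotation.sameSign R₂) neg
    verts₁ : ∀ {x} → x ∈ᴸ figVerts F₁ → x ∈ᴸ verts q ⊎ x ∈ᴸ verts p₁
    verts₁ i with verts-++⁻ q (revʷ p₁) (Closing.figVerts⊆ cl (Rotation.verts⊆ R₁ i))
    ... | inj₁ j = inj₁ j
    ... | inj₂ j = inj₂ (rev-verts p₁ j)
    edges₁ : ∀ {g} → g ∈ᴸ figEdges F₁ → g ≡ e ⊎ g ∈ᴸ edges q ⊎ g ∈ᴸ edges p₁
    edges₁ i with subst (_ ∈ᴸ_) (Closing.figEdges≡ cl) (Rotation.edges⊆ R₁ i)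
    ... | here eq = inj₁ eq
    ... | there j with ∈-edges-++⁻ q (revʷ p₁) j
    ...   | inj₁ k = inj₂ (inj₁ k)
    ...   | inj₂ k = inj₂ (inj₂ (rev-edges p₁ k))
    e∈F₁ : e ∈ᴸ figEdges F₁
    e∈F₁ = Rotation.edges⊇ R₁ (subst (e ∈ᴸ_) (sym (Closing.figEdges≡ cl)) (here refl))
    in₁ : F₁ ⊑ T
    in₁ i with edges₁ i
    ... | inj₁ refl = e∈T
    ... | inj₂ (inj₁ j) = S⊆T (inq j)
    ... | inj₂ (inj₂ j) = S⊆T (in₁′ j)
    in₂ : p₂ ⊑ʷ T
    in₂ i = S⊆T (inp (∈-edges-++ʳ p₁ p₂ i))
    dis₁ : ∀ x → x ∈ᴸ figVerts F₁ → x ∈ᴸ verts p₂ → x ≡ z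
    dis₁ x i j = [ (λ k → q-only k (∈-++⁺ʳ (figVerts f₀) (verts-++ʳ p₁ p₂ j))) , (λ k → meet k j) ]′ (verts₁ i)
    dis₂ : ∀ x → x ∈ᴸ figVerts F₂ → x ∈ᴸ verts p₂ → x ≡ a′
    dis₂ x i j = p-only (verts-++ʳ p₁ p₂ j) (Rotation.verts⊆ R₂ i)
    dis₁₂ : ∀ x → x ∈ᴸ figVerts F₁ → x ∈ᴸ figVerts F₂ → x ≡ z × z ≡ a′
    dis₁₂ x i j with verts₁ i
    ... | inj₁ k with q-only k (∈-++⁺ˡ (Rotation.verts⊆ R₂ j))
    ...   | refl = refl , p-only (verts-++ˡ p₁ p₂ (end∈ p₁)) (Rotation.verts⊆ R₂ j)
    dis₁₂ x i j | inj₂ k with p-only (verts-++ˡ p₁ p₂ k) (Rotation.verts⊆ R₂ j)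
    ...   | refl with meet k (end∈ p₂)
    ...     | refl = refl , refl
    disj : ∀ g → g ∈ᴸ figEdges F₁ → g ∈ᴸ figEdges F₂ → ⊥
    disj g i j with edges₁ i
    ... | inj₁ refl = x∉p-x T (inf (Rotation.edges⊆ R₂ j))
    ... | inj₂ (inj₁ k) = path-fig-disjoint pq f₀ (λ x∈f x∈q → q-only x∈q (∈-++⁺ˡ x∈f)) g k (Rotation.edges⊆ R₂ j)
    ... | inj₂ (inj₂ k) = path-fig-disjoint pp₁ f₀ (λ x∈f x∈p → p-only (verts-++ˡ p₁ p₂ x∈p) x∈f) g k (Rotation.edges⊆ R₂ j)
    h = mkHandcuff F₁ p₂ F₂ pp₂ dis₁ dis₂ dis₁₂ disj
    inside : Within T (hcEdges h)
    inside = ∈-++⁻³ (figEdges F₁) (edges p₂) in₁ in₂ (λ k → S⊆T (inf (Rotation.edges⊆ R₂ k)))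
    fund : Σ[ C ∈ FundamentalCircuit T e ] (∀ {g} → g ∈ᴸ cwEdges (FundamentalCircuit.circuit C) → g ∈ᴸ hcEdges h)
    fund with sign-cases (figSign F₁)
    ... | inj₁ pos = let C , eq = pos-circuit F₁ pos in₁ e∈F₁ in C , λ i → ∈-++⁺ˡ (subst (_ ∈ᴸ_) eq i)
    ... | inj₂ neg₁ = record
      { circuit = hcC h neg₁ neg₂ ; inside = inside
      ; force = λ sat gain → neg-fig-force F₁ neg₁ e∈F₁ (λ i g≢e → sat (x∈p∧x≢y⇒x∈p-y (in₁ i) g≢e))
          (disc-figure F₁ p₂ F₂ neg₂ (λ i → sat (inp (∈-edges-++ʳ p₁ p₂ i))) (λ i → sat (inf (Rotation.edges⊆ R₂ i)))
            (neutral⇒balanced F₁ p₂ F₂ neg₁ neg₂ gain)) } , λ i → i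

  one-positive : ∀ a b c {x y} → x *ˢ y ≡ ₋ → a *ˢ (b *ˢ (y *ˢ c)) ≡ ₊ ⊎ a *ˢ (b *ˢ (x *ˢ c)) ≡ ₊
  one-positive a b c {₊} {₋} _ = aux a b c
    where
    aux : ∀ a b c → a *ˢ (b *ˢ (₋ *ˢ c)) ≡ ₊ ⊎ a *ˢ (b *ˢ c) ≡ ₊
    aux ₊ ₊ ₊ = inj₂ refl
    aux ₊ ₊ ₋ = inj₁ refl
    aux ₊ ₋ ₊ = inj₁ refl
    aux ₊ ₋ ₋ = inj₂ refl
    aux ₋ ₊ ₊ = inj₁ refl
    aux ₋ ₊ ₋ = inj₂ refl
    aux ₋ ₋ ₊ = inj₂ refl
    aux ₋ ₋ ₋ = inj₁ refl
  one-positive a b c {₋} {₊} _ = [ inj₂ , inj₁ ]′ (one-positive a b c {₊} {₋} refl)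

  ear-theta : ∀ {T e v w a′ z t} → e ∈ T → StepE (ends e) v t w →
    (W : Walk a′ a′) → IsCircleWalk W → wSign W ≡ ₋ → W ⊑ʷ T - e →
    (p : Walk v a′) → IsPath p → p ⊑ʷ T - e →
    (∀ {x} → x ∈ᴸ verts p → x ∈ᴸ initVerts W → x ≡ a′) →
    z ∈ᴸ initVerts W → z ∉ᴸ verts p →
    (q : Walk w z) → IsPath q → q ⊑ʷ T - e →
    (∀ {x} → x ∈ᴸ verts q → x ∈ᴸ initVerts W ⊎ x ∈ᴸ verts p → x ≡ z) → Ear T e v
  ear-theta {T} {e} {v} {w} {a′} {z} {t} e∈T s W cW neg inW p pp inp p-only z∈W z∉p q pq inq q-only
    with arcs W cW z∈W (λ eq → z∉p (subst (_∈ᴸ verts p) eq (end∈ p)))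
  ... | record { A = A ; D = D ; whole = whole ; pathA = pA ; pathD = pD ; meet = meet ; apart = apart } = record
    { list = thetaEdges th ; isTH = inj₁ (th , refl)
    ; inside = inside
    ; v~f = _ , walk-sc p (λ i → S⊆T (inp i))
    ; f = circ W cW ; f⊆ = λ i → setOf⁺ (W⊆ i) ; f-neg = neg
    ; g = Closing.fig cl ; g⊆ = λ i → setOf⁺ (cl⊆ i) ; x∈g = e∈cl ; x∉f = λ i → x∉p-x T (inW i)
    ; fundamental = proj₁ C ; circuit⊆ = λ i → setOf⁺ (cl⊆ (subst (_ ∈ᴸ_) (proj₂ C) i)) }
    where
    S⊆T : T - e ⊆ T
    S⊆T = T-x⊆T
    W-edge : ∀ {g} → g ∈ᴸ edges A ⊎ g ∈ᴸ edges D → g ∈ᴸ edges W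
    W-edge r = subst (λ W → _ ∈ᴸ edges W) (sym whole) ([ ∈-edges-++ˡ A D , ∈-edges-++ʳ A D ]′ r)
    W-vert : ∀ {x} → x ∈ᴸ verts A ⊎ x ∈ᴸ verts D → x ∈ᴸ initVerts W
    W-vert r with verts⊆init W (subst (λ W → _ ∈ᴸ verts W) (sym whole) ([ verts-++ˡ A D , verts-++ʳ A D ]′ r))
    ... | inj₁ i = i
    ... | inj₂ refl = base∈ (circ W cW)
    a′≢z : a′ ≢ z
    a′≢z eq = z∉p (subst (_∈ᴸ verts p) eq (end∈ p))
    P₃ = revʷ p ++ʷ step e t s q
    P₃-edge : ∀ {g} → g ∈ᴸ edges P₃ → g ∈ᴸ edges p ⊎ g ≡ e ⊎ g ∈ᴸ edges q
    P₃-edge i with ∈-edges-++⁻ (revʷ p) (step e t s q) i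
    ... | inj₁ j = inj₁ (rev-edges p j)
    ... | inj₂ (here eq) = inj₂ (inj₁ eq)
    ... | inj₂ (there j) = inj₂ (inj₂ j)
    P₃-vert : ∀ {x} → x ∈ᴸ verts P₃ → x ∈ᴸ verts p ⊎ x ∈ᴸ verts q
    P₃-vert i with verts-++⁻ (revʷ p) (step e t s q) i
    ... | inj₁ j = inj₁ (rev-verts p j)
    ... | inj₂ (here refl) = inj₁ (start∈ p)
    ... | inj₂ (there j) = inj₂ j
    pq-apart : ∀ {x} → x ∈ᴸ verts p → x ∈ᴸ verts q → ⊥
    pq-apart i j = z∉p (subst (_∈ᴸ verts p) (q-only j (inj₂ i)) i)
    pP₃ : IsPath P₃
    pP₃ = path-++ (rev-path pp) (unique-∷ (pq-apart (start∈ p)) pq)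
      λ { i (here eq) → eq ; i (there j) → ⊥-elim (pq-apart (rev-verts p i) j) }
    W-P₃ : ∀ {x} → x ∈ᴸ initVerts W → x ∈ᴸ verts P₃ → x ≡ a′ ⊎ x ≡ z
    W-P₃ i j = [ (λ k → inj₁ (p-only k i)) , (λ k → inj₂ (q-only k (inj₁ i))) ]′ (P₃-vert j)
    W-P₃-edge : ∀ g → g ∈ᴸ edges W → g ∈ᴸ edges P₃ → ⊥
    W-P₃-edge g i j with P₃-edge j
    ... | inj₁ k = path-fig-disjoint pp (circ W cW) (λ x∈W x∈p → p-only x∈p x∈W) g k i
    ... | inj₂ (inj₁ refl) = x∉p-x T (inW i)
    ... | inj₂ (inj₂ k) = path-fig-disjoint pq (circ W cW) (λ x∈W x∈q → q-only x∈q (inj₁ x∈W)) g k i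
    th : Theta
    th = record
      { x = a′ ; y = z ; x≢y = a′≢z ; P₁ = A ; P₂ = revʷ D ; P₃ = P₃
      ; path₁ = pA ; path₂ = rev-path pD ; path₃ = pP₃
      ; edgesDistinct = unique-++ (path-edges-unique A pA)
          (unique-++ (path-edges-unique (revʷ D) (rev-path pD)) (path-edges-unique P₃ pP₃) (λ g i j → W-P₃-edge g (W-edge (inj₂ (rev-edges D i))) j))
          λ g i j → [ (λ k → apart g i (rev-edges D k)) , W-P₃-edge g (W-edge (inj₁ i)) ]′ (∈-++⁻ (edges (revʷ D)) j)
      ; int₁₂ = λ x i j → meet i (rev-verts D j)
      ; int₁₃ = λ x i j → W-P₃ (W-vert (inj₁ i)) j
      ; int₂₃ = λ x i j → W-P₃ (W-vert (inj₂ (rev-verts D i))) j }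
    W⊆ : ∀ {g} → g ∈ᴸ edges W → g ∈ᴸ thetaEdges th
    W⊆ i with ∈-edges-++⁻ A D (subst (λ W → _ ∈ᴸ edges W) whole i)
    ... | inj₁ j = ∈-++⁺ˡ j
    ... | inj₂ j = ∈-++⁺ʳ (edges A) (∈-++⁺ˡ (rev-edges⁺ D j))
    P₃⊆ : ∀ {g} → g ∈ᴸ edges P₃ → g ∈ᴸ thetaEdges th
    P₃⊆ i = ∈-++⁺ʳ (edges A) (∈-++⁺ʳ (edges (revʷ D)) i)
    inside : Within T (thetaEdges th)
    inside = ∈-++⁻³ (edges A) (edges (revʷ D)) (λ i → S⊆T (inW (W-edge (inj₁ i)))) (λ i → S⊆T (inW (W-edge (inj₂ (rev-edges D i)))))
      λ i → [ (λ j → S⊆T (inp j)) , [ (λ { refl → e∈T }) , (λ j → S⊆T (inq j)) ]′ ]′ (P₃-edge i)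
    record Arc : Set where
      field
        Y : Walk z a′
        pathY : IsPath Y
        edgeY : ∀ {g} → g ∈ᴸ edges Y → g ∈ᴸ edges W
        vertY : ∀ {x} → x ∈ᴸ verts Y → x ∈ᴸ initVerts W
      P₀ : Walk w v
      P₀ = q ++ʷ (Y ++ʷ revʷ p)
      P₀-edge : ∀ {g} → g ∈ᴸ edges P₀ → g ∈ᴸ edges q ⊎ g ∈ᴸ edges W ⊎ g ∈ᴸ edges p
      P₀-edge i with ∈-edges-++⁻ q (Y ++ʷ revʷ p) i
      ... | inj₁ j = inj₁ j
      ... | inj₂ j with ∈-edges-++⁻ Y (revʷ p) j
      ...   | inj₁ k = inj₂ (inj₁ (edgeY k))
      ...   | inj₂ k = inj₂ (inj₂ (rev-edges p k))
      pP₀ : IsPath P₀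
      pP₀ = path-++ pq (path-++ pathY (rev-path pp) (λ i j → p-only (rev-verts p j) (vertY i)))
        λ i j → q-only i ([ (λ k → inj₁ (vertY k)) , (λ k → inj₂ (rev-verts p k)) ]′ (verts-++⁻ Y (revʷ p) j))
      close : Closing e P₀
      close = closing (step-hop {e} s) P₀ pP₀ λ i → x∉p-x T ([ inq , [ inW , inp ]′ ]′ (P₀-edge i))
      sign : figSign (Closing.fig close) ≡ σ e *ˢ (wSign q *ˢ (wSign Y *ˢ wSign p))
      sign rewrite Closing.figSign≡ close | wSign-++ q (Y ++ʷ revʷ p) | wSign-++ Y (revʷ p) | rev-sign p = refl
    arcD arcA : Arc
    arcD = record { Y = D ; pathY = pD ; edgeY = λ i → W-edge (inj₂ i) ; vertY = λ i → W-vert (inj₂ i) }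
    arcA = record { Y = revʷ A ; pathY = rev-path pA ; edgeY = λ i → W-edge (inj₁ (rev-edges A i)) ; vertY = λ i → W-vert (inj₁ (rev-verts A i)) }
    chosen : Σ[ Y ∈ Arc ] figSign (Closing.fig (Arc.close Y)) ≡ ₊
    chosen with one-positive (σ e) (wSign q) (wSign p) {wSign A} {wSign D} (trans (sym (wSign-++ A D)) (trans (cong wSign (sym whole)) neg))
    ... | inj₁ eq = arcD , trans (Arc.sign arcD) eq
    ... | inj₂ eq = arcA , trans (Arc.sign arcA) (trans (cong (λ r → σ e *ˢ (wSign q *ˢ (r *ˢ wSign p))) (rev-sign A)) eq)
    cl = Arc.close (proj₁ chosen)
    cl⊆ : ∀ {g} → g ∈ᴸ figEdges (Closing.fig cl) → g ∈ᴸ thetaEdges th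
    cl⊆ i with subst (_ ∈ᴸ_) (Closing.figEdges≡ cl) i
    ... | here refl = P₃⊆ (∈-edges-++ʳ (revʷ p) _ (here refl))
    ... | there j with Arc.P₀-edge (proj₁ chosen) j
    ...   | inj₁ k = P₃⊆ (∈-edges-++ʳ (revʷ p) _ (there k))
    ...   | inj₂ (inj₁ k) = W⊆ k
    ...   | inj₂ (inj₂ k) = P₃⊆ (∈-edges-++ˡ (revʷ p) _ (rev-edges⁺ p k))
    e∈cl : e ∈ᴸ figEdges (Closing.fig cl)
    e∈cl = subst (e ∈ᴸ_) (sym (Closing.figEdges≡ cl)) (here refl)
    C = pos-circuit (Closing.fig cl) (proj₂ chosen) (λ i → inside (cl⊆ i)) e∈cl

  ear-joined : ∀ {T e v w} → e ∈ T → Hop e v w → NegFigure (T - e) v → Joined (T - e) v w → Ear T e v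
  ear-joined {T} {e} {v} {w} e∈T hop (a₀ , mkFig f₀ inf , neg , v~a₀) v~w =
    go (reach v~a₀ (base∈ f₀))
    where
    S = T - e
    go : Reach S v (figVerts f₀) → Ear T e v
    go record { z = a′ ; path = p ; isPath = pp ; within = inp ; hit = a′∈ ; only = p-only } =
      go₂ (reach {targets = figVerts f₀ ++ verts p} (joined-trans (joined-sym v~w) v~a₀) (∈-++⁺ˡ (base∈ f₀)))
      where
      go₂ : Reach S w (figVerts f₀ ++ verts p) → Ear T e v
      go₂ record { z = z ; path = q ; isPath = pq ; within = inq ; hit = z∈ ; only = q-only } with z ∈ᴸ? verts p
      ... | yes z∈p with split-at p z∈p
      ...   | p₁ , p₂ , refl = ear-handcuff e∈T hop f₀ inf neg a′∈ p₁ p₂ pp inp p-only q pq inq q-only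
      go₂ record { z = z ; path = q ; isPath = pq ; within = inq ; hit = z∈ ; only = q-only } | no z∉p
        with hop-view (ends e) hop
      ... | isHalf t h refl = ⊥-elim (z∉p (subst (_∈ᴸ verts p) (q-only (start∈ q) (∈-++⁺ʳ (figVerts f₀) (start∈ p))) (start∈ p)))
      ... | isStep t s = go₃ (Rotation.fig R) refl
        where
        R = rotate f₀ a′∈
        z∈f₀ : z ∈ᴸ figVerts f₀
        z∈f₀ = [ (λ i → i) , (λ i → ⊥-elim (z∉p i)) ]′ (∈-++⁻ (figVerts f₀) z∈)
        go₃ : (f : FigureAt a′) → f ≡ Rotation.fig R → Ear T e v
        go₃ (halfF g r h) eq with subst (λ f → z ∈ᴸ figVerts f) (sym eq) (Rotation.verts⊇ R z∈f₀)
        ... | here refl = ⊥-elim (z∉p (end∈ p))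
        go₃ (circ W c) eq = ear-theta e∈T s W c
          (trans (cong figSign eq) (trans (Rotation.sameSign R) neg))
          (λ i → inf (Rotation.edges⊆ R (subst (λ f → _ ∈ᴸ figEdges f) eq i)))
          p pp inp (λ i j → p-only i (back j))
          (subst (λ f → z ∈ᴸ figVerts f) (sym eq) (Rotation.verts⊇ R z∈f₀)) z∉p
          q pq inq (λ i j → q-only i ([ (λ k → ∈-++⁺ˡ (back k)) , ∈-++⁺ʳ (figVerts f₀) ]′ j))
          where
          back : ∀ {x} → x ∈ᴸ initVerts W → x ∈ᴸ figVerts f₀
          back j = Rotation.verts⊆ R (subst (λ f → _ ∈ᴸ figVerts f) eq j)

  fig-nonempty : ∀ {a} (f : FigureAt a) → ∃[ e ] e ∈ᴸ figEdges f
  fig-nonempty (circ [] (ne , _)) = ⊥-elim (ne refl)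
  fig-nonempty (circ (step e _ _ _) _) = e , here refl
  fig-nonempty (halfF e _ _) = e , here refl

  ear-bridge : ∀ {T e v w} → e ∈ T → Hop e v w → NegFigure (T - e) v → NegFigure (T - e) w → ¬ Joined (T - e) v w → Ear T e v
  ear-bridge {T} {e} {v} {w} e∈T hop (a₁ , mkFig f₁ in₁ , neg₁ , v~a₁) (a₂ , mkFig f₂ in₂ , neg₂ , w~a₂) v≁w
    with hop-view (ends e) hop
  ... | isHalf t h refl = ⊥-elim (v≁w (_ , nil))
  ... | isStep t s = go (reach v~a₁ (base∈ f₁)) (reach w~a₂ (base∈ f₂))
    where
    S = T - e
    S⊆T : S ⊆ T
    S⊆T = T-x⊆T
    go : Reach S v (figVerts f₁) → Reach S w (figVerts f₂) → Ear T e v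
    go record { z = a ; path = p ; isPath = pp ; within = inp ; hit = a∈ ; only = p-only }
       record { z = b ; path = q ; isPath = pq ; within = inq ; hit = b∈ ; only = q-only } = record
      { list = hcEdges h ; isTH = inj₂ (h , refl) ; inside = inside
      ; v~f = _ , walk-sc p (λ i → S⊆T (inp i))
      ; f = F₁ ; f⊆ = λ i → setOf⁺ (∈-++⁺ˡ i) ; f-neg = n₁
      ; g = F₂ ; g⊆ = λ i → setOf⁺ (∈-++⁺ʳ (figEdges F₁) (∈-++⁺ʳ (edges P) i))
      ; x∈g = proj₂ (fig-nonempty F₂) ; x∉f = λ i → disj _ i (proj₂ (fig-nonempty F₂))
      ; fundamental = record
          { circuit = hcC h n₁ n₂ ; inside = inside
          ; force = λ sat gain → sat-from-walk (revʷ p) s q (λ i → sat (inp (rev-edges p i))) (λ i → sat (inq i))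
              (disc-path F₁ P F₂ n₁ n₂ (λ i → sat (in₁ (Rotation.edges⊆ R₁ i))) (λ i → sat (in₂ (Rotation.edges⊆ R₂ i)))
                (neutral⇒balanced F₁ P F₂ n₁ n₂ gain)) }
      ; circuit⊆ = setOf⁺ }
      where
      R₁ = rotate f₁ a∈
      R₂ = rotate f₂ b∈
      F₁ = Rotation.fig R₁
      F₂ = Rotation.fig R₂
      n₁ : figSign F₁ ≡ ₋
      n₁ = trans (Rotation.sameSign R₁) neg₁
      n₂ : figSign F₂ ≡ ₋
      n₂ = trans (Rotation.sameSign R₂) neg₂
      P = revʷ p ++ʷ step e t s q
      near₁ : ∀ {x} → x ∈ᴸ figVerts F₁ → Joined S v x
      near₁ i = joined-trans v~a₁ (fig-joined f₁ in₁ (Rotation.verts⊆ R₁ i))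
      near₂ : ∀ {x} → x ∈ᴸ figVerts F₂ → Joined S w x
      near₂ i = joined-trans w~a₂ (fig-joined f₂ in₂ (Rotation.verts⊆ R₂ i))
      clash : ∀ {x} → Joined S v x → Joined S w x → ⊥
      clash i j = v≁w (joined-trans i (joined-sym j))
      P-vert : ∀ {x} → x ∈ᴸ verts P → x ∈ᴸ verts p ⊎ x ∈ᴸ verts q
      P-vert i with verts-++⁻ (revʷ p) (step e t s q) i
      ... | inj₁ j = inj₁ (rev-verts p j)
      ... | inj₂ (here refl) = inj₁ (start∈ p)
      ... | inj₂ (there j) = inj₂ j
      pP : IsPath P
      pP = path-++ (rev-path pp) (unique-∷ (λ i → clash (_ , nil) (walk-joined q inq i)) pq)
        λ { i (here eq) → eq ; i (there j) → ⊥-elim (clash (walk-joined p inp (rev-verts p i)) (walk-joined q inq j)) }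
      dis₁ : ∀ x → x ∈ᴸ figVerts F₁ → x ∈ᴸ verts P → x ≡ a
      dis₁ x i j = [ (λ k → p-only k (Rotation.verts⊆ R₁ i)) , (λ k → ⊥-elim (clash (near₁ i) (walk-joined q inq k))) ]′ (P-vert j)
      dis₂ : ∀ x → x ∈ᴸ figVerts F₂ → x ∈ᴸ verts P → x ≡ b
      dis₂ x i j = [ (λ k → ⊥-elim (clash (walk-joined p inp k) (near₂ i))) , (λ k → q-only k (Rotation.verts⊆ R₂ i)) ]′ (P-vert j)
      disj : ∀ g → g ∈ᴸ figEdges F₁ → g ∈ᴸ figEdges F₂ → ⊥
      disj g i j with fig-near F₁ (λ k → in₁ (Rotation.edges⊆ R₁ k)) i
      ... | y , z , hp , _ = clash (near₁ (proj₁ (fig-edge-verts F₁ i hp))) (near₂ (proj₁ (fig-edge-verts F₂ j hp)))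
      h = mkHandcuff F₁ P F₂ pP dis₁ dis₂ (λ x i j → ⊥-elim (clash (near₁ i) (near₂ j))) disj
      inside : Within T (hcEdges h)
      inside = ∈-++⁻³ (figEdges F₁) (edges P) (λ j → S⊆T (in₁ (Rotation.edges⊆ R₁ j))) inP (λ j → S⊆T (in₂ (Rotation.edges⊆ R₂ j)))
        where
        inP : P ⊑ʷ T
        inP i with ∈-edges-++⁻ (revʷ p) (step e t s q) i
        ... | inj₁ j = S⊆T (inp (rev-edges p j))
        ... | inj₂ (here refl) = e∈T
        ... | inj₂ (there j) = S⊆T (inq j)

  ear : ∀ {T e v w} → e ∈ T → Hop e v w → NoDrop (T - e) e → Unb (T - e) v → Ear T e v
  ear {T} {e} {v} {w} e∈T hop nd unb with joined? (T - e) v w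
  ... | yes j = ear-joined e∈T hop (unb-figure unb) j
  ... | no ¬j with nd hop
  ...   | inj₁ c = ⊥-elim (¬j (_ , c))
  ...   | inj₂ (p , q) = ear-bridge e∈T hop (unb-figure p) (unb-figure q) ¬j

  record ClosedFigure (T : Subset m) (e : Fin m) (u : Fin n) : Set where
    field
      fig : FigureAt u
      inT : fig ⊑ T
      e∈ : e ∈ᴸ figEdges fig

  close-along : ∀ {T e u w} → e ∈ T → Hop e u w → (P : Path (T - e) w u) →
    Σ[ F ∈ ClosedFigure T e u ] figSign (ClosedFigure.fig F) ≡ σ e *ˢ wSign (Path.walk P)
  close-along {T} {e} e∈T hop (mkPath P p i) = record
    { fig = Closing.fig cl ; inT = λ k → in′ (subst (_ ∈ᴸ_) (Closing.figEdges≡ cl) k)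
    ; e∈ = subst (e ∈ᴸ_) (sym (Closing.figEdges≡ cl)) (here refl) } , Closing.figSign≡ cl
    where
    cl = closing hop P p (λ k → x∉p-x T (i k))
    in′ : ∀ {g} → g ∈ᴸ e ∷ edges P → g ∈ T
    in′ (here refl) = e∈T
    in′ (there k) = T-x⊆T (i k)

  closed-figure : ∀ {T e u w} → e ∈ T → Hop e u w → Joined (T - e) w u → ClosedFigure T e u
  closed-figure e∈T hop j = proj₁ (close-along e∈T hop (joined-path j))

  positive-figure : ∀ {T e u w} → e ∈ T → Hop e u w → SC (T - e) u (σ e) w → ¬ Unb (T - e) u →
    Σ[ F ∈ ClosedFigure T e u ] figSign (ClosedFigure.fig F) ≡ ₊
  positive-figure {e = e} e∈T hop c ¬unb with signed-path (λ d → ¬unb (unb-resp (_ , c) d)) (sc-sym c)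
  ... | P , eq = let F , sign = close-along e∈T hop P in F , trans sign (trans (cong (σ e *ˢ_) eq) (Signₚ.s*s≡+ (σ e)))

  fundamental-circuit : ∀ {T e} → e ∈ T → NoDrop (T - e) e → FundamentalCircuit T e
  fundamental-circuit {T} {e} e∈T nd with loose-or-hop e
  ... | inj₁ l = record
    { circuit = looseC e l ; inside = λ { (here refl) → e∈T } ; force = λ _ → sat-loose {e = e} l }
  ... | inj₂ (v , w , hop) with unb? (T - e) v
  ...   | yes unb = Ear.fundamental (ear e∈T hop nd unb)
  ...   | no ¬unb with nd hop
  ...     | inj₂ (unb , _) = ⊥-elim (¬unb unb)
  ...     | inj₁ c = let F , pos = positive-figure e∈T hop c ¬unb in
    proj₁ (pos-circuit (ClosedFigure.fig F) pos (ClosedFigure.inT F) (ClosedFigure.e∈ F))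

  -- Components

  hop-endsE : ∀ k {u w} → HopE k u w → u ∈ᴸ endVerts k × w ∈ᴸ endVerts k
  hop-endsE (link _ _ _ _ _) (inj₁ (refl , refl)) = here refl , there (here refl)
  hop-endsE (link _ _ _ _ _) (inj₂ (refl , refl)) = there (here refl) , here refl
  hop-endsE (loop _ _ _) (refl , refl) = here refl , here refl
  hop-endsE (half _ _) (refl , refl) = here refl , here refl

  ends-hopE : ∀ k {u} → u ∈ᴸ endVerts k → ∃[ w ] HopE k u w
  ends-hopE (link _ w _ _ _) (here refl) = w , inj₁ (refl , refl)
  ends-hopE (link v _ _ _ _) (there (here refl)) = v , inj₂ (refl , refl)
  ends-hopE (loop v _ _) (here refl) = v , refl , refl
  ends-hopE (half v _) (here refl) = v , refl , refl

  ends-joinedE : ∀ k {u w} → u ∈ᴸ endVerts k → w ∈ᴸ endVerts k → u ≡ w ⊎ HopE k u w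
  ends-joinedE (link _ _ _ _ _) (here refl) (here refl) = inj₁ refl
  ends-joinedE (link _ _ _ _ _) (here refl) (there (here refl)) = inj₂ (inj₁ (refl , refl))
  ends-joinedE (link _ _ _ _ _) (there (here refl)) (here refl) = inj₂ (inj₂ (refl , refl))
  ends-joinedE (link _ _ _ _ _) (there (here refl)) (there (here refl)) = inj₁ refl
  ends-joinedE (loop _ _ _) (here refl) (here refl) = inj₁ refl
  ends-joinedE (half _ _) (here refl) (here refl) = inj₁ refl

  conn⇒joined : ∀ {S u w} → Conn S u w → Joined S u w
  conn⇒joined done = _ , nil
  conn⇒joined ((e , e∈ , i , j) ◅ c) with ends-joinedE (ends e) i j
  ... | inj₁ refl = conn⇒joined c
  ... | inj₂ h = joined-trans (_ , sc-hop e∈ h) (conn⇒joined c)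

  joined⇒conn : ∀ {S u w} → Joined S u w → Conn S u w
  joined⇒conn (_ , c) = go c
    where
    go : ∀ {S u s w} → SC S u s w → Conn S u w
    go nil = done
    go (cons {e} e∈ h c) = (e , e∈ , hop-endsE (ends e) h) ◅ go c

  tabulate⁺ : ∀ {k} (f : Fin k → Bool) {x} → f x ≡ true → x ∈ Vec.tabulate f
  tabulate⁺ f {x} eq = Vecₚ.lookup⇒[]= x _ (trans (Vecₚ.lookup∘tabulate f x) eq)

  tabulate⁻ : ∀ {k} (f : Fin k → Bool) {x} → x ∈ Vec.tabulate f → f x ≡ true
  tabulate⁻ f {x} i = trans (sym (Vecₚ.lookup∘tabulate f x)) (Vecₚ.[]=⇒lookup i)

  any⁺ : ∀ {A : Set} (p : A → Bool) {xs x} → x ∈ᴸ xs → p x ≡ true → anyB p xs ≡ true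
  any⁺ p (here refl) eq rewrite eq = refl
  any⁺ p {y ∷ _} (there i) eq with p y
  ... | true = refl
  ... | false = any⁺ p i eq

  any⁻ : ∀ {A : Set} (p : A → Bool) xs → anyB p xs ≡ true → ∃[ x ] (x ∈ᴸ xs × p x ≡ true)
  any⁻ p (y ∷ xs) eq with p y in eq′
  ... | true = y , here refl , eq′
  ... | false = let x , i , r = any⁻ p xs eq in x , there i , r

  edgesAt⁺ : ∀ {S X e u w} → e ∈ S → Hop e u w → u ∈ X → e ∈ edgesAt S X
  edgesAt⁺ {S} {X} {e} e∈ h u∈ = x∈p∩q⁺ (e∈ , tabulate⁺ _ (any⁺ (Vec.lookup X) (proj₁ (hop-endsE (ends e) h)) (Vecₚ.[]=⇒lookup u∈)))

  edgesAt⁻ : ∀ {S X e} → e ∈ edgesAt S X → e ∈ S × ∃[ u ] ∃[ w ] (Hop e u w × u ∈ X)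
  edgesAt⁻ {S} {X} {e} i with x∈p∩q⁻ S _ i
  ... | e∈ , j with any⁻ (Vec.lookup X) (endVerts (ends e)) (tabulate⁻ _ j)
  ...   | u , u∈ , eq with ends-hopE (ends e) u∈
  ...     | w , h = e∈ , u , w , h , Vecₚ.lookup⇒[]= u X eq

  component : Subset m → Fin n → Subset n
  component S u = Vec.tabulate λ w → does (joined? S u w)

  component⁺ : ∀ {S u w} → Joined S u w → w ∈ component S u
  component⁺ {S} {u} {w} j = tabulate⁺ _ (dec-true (joined? S u w) j)

  component⁻ : ∀ {S u w} → w ∈ component S u → Joined S u w
  component⁻ {S} {u} {w} i with joined? S u w | tabulate⁻ _ i
  ... | yes j | _ = j

  self∈ : ∀ {S} u → u ∈ component S u
  self∈ u = component⁺ (_ , nil)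

  component-is : ∀ S u → IsComponent S (component S u)
  component-is S u = (u , self∈ u) , λ v w v∈ → mk⇔
    (λ w∈ → joined⇒conn (joined-trans (joined-sym (component⁻ v∈)) (component⁻ w∈)))
    (λ c → component⁺ (joined-trans (component⁻ v∈) (conn⇒joined c)))

  module _ {S X} (comp : IsComponent S X) where

    comp-joined : ∀ {u w} → u ∈ X → w ∈ X → Joined S u w
    comp-joined u∈ w∈ = conn⇒joined (Equivalence.to (proj₂ comp _ _ u∈) w∈)

    comp-closed : ∀ {u w} → u ∈ X → Joined S u w → w ∈ X
    comp-closed u∈ j = Equivalence.from (proj₂ comp _ _ u∈) (joined⇒conn j)

  component-unique : ∀ {S X Y u} → IsComponent S X → IsComponent S Y → u ∈ X → u ∈ Y → X ≡ Y
  component-unique cX cY u∈X u∈Y = ⊆-antisym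
    (λ w∈ → comp-closed cY u∈Y (comp-joined cX u∈X w∈)) (λ w∈ → comp-closed cX u∈X (comp-joined cY u∈Y w∈))

  fig-base∈ : ∀ {S X a} → IsComponent S X → (f : FigureAt a) → f ⊑ (edgesAt S X) → a ∈ X
  fig-base∈ {S} {X} comp f i with fig-nonempty f
  ... | e , e∈ with edgesAt⁻ (i e∈)
  ...   | _ , u , w , h , u∈ = comp-closed comp u∈
    (joined-sym (fig-joined f (λ j → proj₁ (edgesAt⁻ {S} {X} (i j))) (proj₁ (fig-edge-verts f e∈ h))))

  fig-at : ∀ {S X a} → IsComponent S X → (f : FigureAt a) → a ∈ X → f ⊑ S → f ⊑ (edgesAt S X)
  fig-at comp f a∈ i j with fig-near f i j
  ... | y , z , h , r = edgesAt⁺ (i j) h (comp-closed comp a∈ r)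

  signBalanced⇒¬unb : ∀ {S X u} → IsComponent S X → u ∈ X → SignBalanced (edgesAt S X) → ¬ Unb S u
  signBalanced⇒¬unb comp u∈ bal unb with unb-figure unb
  ... | a , mkFig f i , neg , j with trans (sym neg) (bal (a , f) (setOf-within (figEdges f) (fig-at comp f (comp-closed comp u∈ j) i)))
  ...   | ()

  ¬unb⇒signBalanced : ∀ {S X u} → IsComponent S X → u ∈ X → ¬ Unb S u → SignBalanced (edgesAt S X)
  ¬unb⇒signBalanced {S} {X} comp u∈ ¬unb (a , f) i with sign-cases (figSign f)
  ... | inj₁ pos = pos
  ... | inj₂ neg = ⊥-elim (¬unb (negFigure-unb (a , mkFig f (λ j → proj₁ (edgesAt⁻ {S} {X} (i (setOf⁺ j)))) , neg
    , comp-joined comp u∈ (fig-base∈ comp f (within-setOf (figEdges f) i)))))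

  lookup-injective : ∀ {A : Set} {xs : List A} → Unique xs → ∀ i j → List.lookup xs i ≡ List.lookup xs j → i ≡ j
  lookup-injective {xs = _ ∷ _} u zero zero eq = refl
  lookup-injective {xs = _ ∷ _} u zero (suc j) eq = ⊥-elim (unique-∉ u (subst (_∈ᴸ _) (sym eq) (∈-lookup j)))
  lookup-injective {xs = _ ∷ _} u (suc i) zero eq = ⊥-elim (unique-∉ u (subst (_∈ᴸ _) eq (∈-lookup i)))
  lookup-injective {xs = _ ∷ _} (_ ∷ u) (suc i) (suc j) eq = cong suc (lookup-injective u i j eq)

  transversal⇒number : ∀ {S L} → Transversal S L → NumBalancedComponents S (length L)
  transversal⇒number {S} {L} t = (λ i → component S (List.lookup L i)) , inj
    , (λ i → component-is S _ , ¬unb⇒signBalanced (component-is S _) (self∈ _) (balanced (∈-lookup i))) , onto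
    where
    open Transversal t
    inj : ∀ {i j} → component S (List.lookup L i) ≡ component S (List.lookup L j) → i ≡ j
    inj {i} {j} eq = lookup-injective unique i j
      (apart (∈-lookup i) (∈-lookup j) (component⁻ (subst (List.lookup L j ∈_) (sym eq) (self∈ _))))
    onto : ∀ X → IsComponent S X → SignBalanced (edgesAt S X) → ∃[ i ] component S (List.lookup L i) ≡ X
    onto X comp@((u , u∈) , _) bal with covers (signBalanced⇒¬unb comp u∈ bal)
    ... | w , w∈ , j = index w∈ , component-unique (component-is S _) comp
      (component⁺ (subst (λ z → Joined S z u) (lookup-index w∈) (joined-sym j))) u∈

  number⇒transversal : ∀ {S b} → NumBalancedComponents S b → ∃[ L ] (Transversal S L × length L ≡ b)
  number⇒transversal {S} {b} (f , inj , isC , onto) = List.tabulate rep , record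
    { unique = Uniqueₚ.tabulate⁺ λ {i} {j} eq → inj (component-unique (comp i) (comp j) (rep∈ i) (subst (_∈ f j) (sym eq) (rep∈ j)))
    ; balanced = λ u∈ → let i , eq = ∈-tabulate⁻ u∈ in
        subst (λ u → ¬ Unb S u) (sym eq) (signBalanced⇒¬unb (comp i) (rep∈ i) (proj₂ (isC i)))
    ; apart = λ u∈ w∈ j → apart′ (∈-tabulate⁻ u∈) (∈-tabulate⁻ w∈) j
    ; covers = λ {u} ¬unb → let i , eq = onto (component S u) (component-is S u) (¬unb⇒signBalanced (component-is S u) (self∈ u) ¬unb) in
        rep i , ∈-tabulate⁺ i , component⁻ (subst (rep i ∈_) eq (rep∈ i)) }
    , Listₚ.length-tabulate rep
    where
    comp : ∀ i → IsComponent S (f i)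
    comp i = proj₁ (isC i)
    rep : Fin b → Fin n
    rep i = proj₁ (proj₁ (comp i))
    rep∈ : ∀ i → rep i ∈ f i
    rep∈ i = proj₂ (proj₁ (comp i))
    apart′ : ∀ {u w} → ∃[ i ] u ≡ rep i → ∃[ j ] w ≡ rep j → Joined S u w → u ≡ w
    apart′ (i , refl) (j , refl) c = cong rep (inj (component-unique (comp i) (comp j) (comp-closed (comp i) (rep∈ i) c) (rep∈ j)))


  independent⁻ : ∀ {I} → Independent I → (Nullity I 0 × Hyperbalanced I) ⊎ (Nullity I 1 × Hyperfrustrated I)
  independent⁻ {I} (b , num , δ , δ-cases , eq) = cases δ-cases
    where
    nullity : ∀ {k} → δ ≡ k → Nullity I k
    nullity δ≡k = let L , t , len = number⇒transversal num in L , t , trans (cong (∣ I ∣ +_) len) (trans eq (cong (n +_) δ≡k))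
    cases : (δ ≡ 0 × Hyperbalanced I) ⊎ (δ ≡ 1 × Hyperfrustrated I) → (Nullity I 0 × Hyperbalanced I) ⊎ (Nullity I 1 × Hyperfrustrated I)
    cases (inj₁ (δ≡0 , hb)) = inj₁ (nullity δ≡0 , hb)
    cases (inj₂ (δ≡1 , hf)) = inj₂ (nullity δ≡1 , hf)

  independent-hb : ∀ {I} → Nullity I 0 → Hyperbalanced I → Independent I
  independent-hb (L , t , eq) hb = length L , transversal⇒number t , 0 , inj₁ (refl , hb) , eq

  independent-hf : ∀ {I} → Nullity I 1 → Hyperfrustrated I → Independent I
  independent-hf (L , t , eq) hf = length L , transversal⇒number t , 1 , inj₂ (refl , hf) , eq

  record TreeAt (B : Subset m) (u : Fin n) : Set where
    field
      spans : ∀ {w} → Joined E u w → Joined B u w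
      noFigure : ∀ {a} (f : FigureAt a) → f ⊑ B → ¬ Joined B u a

  record UnicycleAt (B : Subset m) (u : Fin n) : Set where
    field
      {a} : Fin n
      fig : FigureAt a
      inB : fig ⊑ B
      neg : figSign fig ≡ ₋
      joined : Joined B u a
      only : ∀ {b} (g : FigureAt b) → g ⊑ B → Joined B u b → setOf (figEdges g) ≡ setOf (figEdges fig)

  -- The conditions of case (I) at the component of u.
  record GoodAt (B : Subset m) (u : Fin n) : Set where
    field
      tree : ¬ Unb E u → TreeAt B u
      unicycle : Unb E u → UnicycleAt B u

  module _ {X} (compX : IsComp X) (B : Subset m) where

    Bₓ : Subset m
    Bₓ = B ∩ EC X

    T⊆B : Bₓ ⊆ B
    T⊆B i = proj₁ (x∈p∩q⁻ B (EC X) i)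

    ∈T : ∀ {e u w} → e ∈ B → Hop e u w → u ∈ X → e ∈ Bₓ
    ∈T e∈ h u∈ = x∈p∩q⁺ (e∈ , edgesAt⁺ ∈⊤ h u∈)

    joined-in : ∀ {u w} → u ∈ X → Joined B u w → Joined Bₓ u w
    joined-in u∈ (_ , c) = go u∈ c
      where
      go : ∀ {u s w} → u ∈ X → SC B u s w → Joined Bₓ u w
      go u∈ nil = _ , nil
      go u∈ (cons e∈ h c) = joined-trans (_ , sc-hop (∈T e∈ h u∈) h) (go (comp-closed compX u∈ (_ , sc-hop ∈⊤ h)) c)

    fig-in : ∀ {a} (f : FigureAt a) → a ∈ X → f ⊑ B → f ⊑ Bₓ
    fig-in f a∈ i j = x∈p∩q⁺ (i j , fig-at compX f a∈ (λ _ → ∈⊤) j)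

    fig-in-base : ∀ {a} (f : FigureAt a) → f ⊑ Bₓ → a ∈ X
    fig-in-base f i = fig-base∈ compX f (λ j → proj₂ (x∈p∩q⁻ B (EC X) (i j)))

    module _ {Y} (Y⊆X : Y ⊆ X) where

      component-out : IsComponent Bₓ Y → IsComponent B Y
      component-out comp = proj₁ comp , λ u w u∈ → mk⇔
        (λ w∈ → joined⇒conn (joined-mono T⊆B (comp-joined comp u∈ w∈)))
        (λ c → comp-closed comp u∈ (joined-in (Y⊆X u∈) (conn⇒joined c)))

      component-in : IsComponent B Y → IsComponent Bₓ Y
      component-in comp = proj₁ comp , λ u w u∈ → mk⇔
        (λ w∈ → joined⇒conn (joined-in (Y⊆X u∈) (comp-joined comp u∈ w∈)))
        (λ c → comp-closed comp u∈ (joined-mono T⊆B (conn⇒joined c)))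

      edgesAt-T : edgesAt Bₓ Y ≡ edgesAt B Y
      edgesAt-T = ⊆-antisym
        (λ i → let e∈ , _ , _ , h , u∈ = edgesAt⁻ {Bₓ} {Y} i in edgesAt⁺ (T⊆B e∈) h u∈)
        (λ i → let e∈ , _ , _ , h , u∈ = edgesAt⁻ {B} {Y} i in edgesAt⁺ (∈T e∈ h (Y⊆X u∈)) h u∈)

    component-⊆ : ∀ {Y u} → IsComponent B Y → u ∈ Y → u ∈ X → Y ⊆ X
    component-⊆ comp u∈Y u∈X w∈ = comp-closed compX u∈X (joined-mono ⊆⊤ (comp-joined comp u∈Y w∈))

  component-connected : ∀ {B Y} → IsComponent B Y → ConnectedOn Y (edgesAt B Y)
  component-connected {B} {Y} comp u w u∈ w∈ with comp-joined comp u∈ w∈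
  ... | _ , c = joined⇒conn (go u∈ c)
    where
    go : ∀ {u s w} → u ∈ Y → SC B u s w → Joined (edgesAt B Y) u w
    go u∈ nil = _ , nil
    go u∈ (cons e∈ h c) = joined-trans (_ , sc-hop (edgesAt⁺ e∈ h u∈) h) (go (comp-closed comp u∈ (_ , sc-hop e∈ h)) c)

  edgesAt-⊆ : ∀ {S X} → edgesAt S X ⊆ S
  edgesAt-⊆ {S} {X} i = proj₁ (edgesAt⁻ {S} {X} i)

  unicycleAt⁻ : ∀ {B Y u} → IsComponent B Y → u ∈ Y → SignUnbalancedUnicycle Y (edgesAt B Y) → UnicycleAt B u
  unicycleAt⁻ {B} {Y} comp u∈ ((a , f) , (conn , f⊆ , uniq) , neg) = record
    { fig = f ; inB = λ i → edgesAt-⊆ {B} {Y} (f⊆ (setOf⁺ i)) ; neg = neg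
    ; joined = comp-joined comp u∈ (fig-base∈ comp f (within-setOf (figEdges f) f⊆))
    ; only = λ {b} g i j → uniq (b , g) (setOf-within (figEdges g) (fig-at comp g (comp-closed comp u∈ j) i)) }

  unicycleAt⁺ : ∀ {B Y u} → IsComponent B Y → u ∈ Y → UnicycleAt B u → SignUnbalancedUnicycle Y (edgesAt B Y)
  unicycleAt⁺ {B} {Y} comp u∈ U = (a , fig)
    , (component-connected comp , setOf-within (figEdges fig) (fig-at comp fig (comp-closed comp u∈ joined) inB)
      , λ (b , g) i → only g (λ j → edgesAt-⊆ {B} {Y} (i (setOf⁺ j))) (comp-joined comp u∈ (fig-base∈ comp g (within-setOf (figEdges g) i)))) , neg
    where
    open UnicycleAt U

  goodComp⁻ : ∀ {B X u} → IsComp X → u ∈ X → GoodComp B X → GoodAt B u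
  goodComp⁻ {B} {X} {u} compX u∈ (bal , unbal) = record
    { tree = λ ¬unb → let conn , noF = bal (¬unb⇒signBalanced compX u∈ ¬unb) in record
        { spans = λ j → joined-mono (T⊆B compX B) (conn⇒joined (conn _ _ u∈ (comp-closed compX u∈ j)))
        ; noFigure = λ {a} f i j → noF (a , f) (setOf-within (figEdges f) (fig-in compX B f (comp-closed compX u∈ (joined-mono ⊆⊤ j)) i)) }
    ; unicycle = λ unb → let Y = component B u
                             Y⊆X = component-⊆ compX B (component-is B u) (self∈ u) u∈ in
        unicycleAt⁻ (component-is B u) (self∈ u) (subst (SignUnbalancedUnicycle Y) (edgesAt-T compX B Y⊆X)
          (unbal (λ b → signBalanced⇒¬unb compX u∈ b unb) Y (component-in compX B Y⊆X (component-is B u) , Y⊆X))) }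

  unicycles⁺ : ∀ {B X Y} → IsComp X → SubComponent X (B ∩ EC X) Y → (∀ {u} → u ∈ Y → UnicycleAt B u) →
    SignUnbalancedUnicycle Y (edgesAt (B ∩ EC X) Y)
  unicycles⁺ {B} {X} {Y} compX (compY , Y⊆X) U = subst (SignUnbalancedUnicycle Y) (sym (edgesAt-T compX B Y⊆X))
    (unicycleAt⁺ (component-out compX B Y⊆X compY) (proj₂ (proj₁ compY)) (U (proj₂ (proj₁ compY))))

  unb-component : ∀ {X u} → IsComp X → ¬ SignBalanced (EC X) → u ∈ X → Unb E u
  unb-component {u = u} compX ¬bal u∈ with unb? E u
  ... | yes p = p
  ... | no ¬p = ⊥-elim (¬bal (¬unb⇒signBalanced compX u∈ ¬p))

  goodComp⁺ : ∀ {B X} → IsComp X → (∀ {u} → u ∈ X → GoodAt B u) → GoodComp B X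
  goodComp⁺ {B} {X} compX good =
    (λ bal → (λ u w u∈ w∈ → joined⇒conn (joined-in compX B u∈ (TreeAt.spans (tree bal u∈) (comp-joined compX u∈ w∈))))
      , λ (a , f) i → let a∈ = fig-in-base compX B f (within-setOf (figEdges f) i) in
          TreeAt.noFigure (tree bal a∈) f (λ j → T⊆B compX B (i (setOf⁺ j))) (_ , nil))
    , λ ¬bal Y sub → unicycles⁺ compX sub λ u∈ → GoodAt.unicycle (good (proj₂ sub u∈)) (unb-component compX ¬bal (proj₂ sub u∈))
    where
    tree : SignBalanced (EC X) → ∀ {u} → u ∈ X → TreeAt B u
    tree bal u∈ = GoodAt.tree (good u∈) (signBalanced⇒¬unb compX u∈ bal)

  -- Bases

  Spanning : Subset m → Set
  Spanning B = ∀ {e} → e ∉ B → NoDrop B e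

  SpansAt : Subset m → Fin n → Set
  SpansAt B u = (¬ Unb E u → ∀ {w} → Joined E u w → Joined B u w) × (Unb E u → Unb B u)

  spansAt-spanning : ∀ {B} → (∀ u → SpansAt B u) → Spanning B
  spansAt-spanning {B} spans {e} _ {u} {w} h with unb? E u
  ... | yes unb = inj₂ (proj₂ (spans u) unb , proj₂ (spans w) (unb-resp (_ , sc-sym (sc-hop ∈⊤ h)) unb))
  ... | no ¬unb with proj₁ (spans u) ¬unb (_ , sc-hop ∈⊤ h)
  ...   | s , c with sc-sign (sc-mono ⊆⊤ c) (sc-hop ∈⊤ h)
  ...     | inj₁ refl = inj₁ c
  ...     | inj₂ unb = ⊥-elim (¬unb unb)

  unicycleAt-unb : ∀ {B u} → UnicycleAt B u → Unb B u
  unicycleAt-unb U = negFigure-unb (a , mkFig fig inB , neg , joined)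
    where
    open UnicycleAt U

  goodAt-spans : ∀ {B u} → GoodAt B u → SpansAt B u
  goodAt-spans good = (λ ¬unb → TreeAt.spans (GoodAt.tree good ¬unb)) , λ unb → unicycleAt-unb (GoodAt.unicycle good unb)

  same-edges : ∀ {a b} (g : FigureAt a) (f : FigureAt b) → setOf (figEdges g) ≡ setOf (figEdges f) →
    ∀ {e} → e ∈ᴸ figEdges g → e ∈ᴸ figEdges f
  same-edges g f eq i = setOf⁻ (figEdges f) (subst (_ ∈_) eq (setOf⁺ i))

  share-joined : ∀ {S a b e} (f : FigureAt a) (g : FigureAt b) → f ⊑ S → g ⊑ S →
    e ∈ᴸ figEdges f → e ∈ᴸ figEdges g → Joined S a b
  share-joined f g inf ing i j with fig-near f inf i
  ... | y , z , h , a~y = joined-trans a~y (joined-sym (fig-joined g ing (proj₁ (fig-edge-verts g j h))))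

  spanned-minus : ∀ {B e} → NoDrop (B - e) e → ∀ {u s x} → SC B u s x → SC (B - e) u s x ⊎ (Unb (B - e) u × Unb (B - e) x)
  spanned-minus nd = sc-spanned λ f∈ f∉ → subst (NoDrop _) (sym (∉-split f∈ f∉)) nd

  tree-acyclic : ∀ {B e v w} → ¬ Unb E v → TreeAt B v → e ∈ B → Hop e v w → ¬ NoDrop (B - e) e
  tree-acyclic ¬unb t e∈ h nd with nd h
  ... | inj₂ (unb , _) = ¬unb (sc-mono ⊆⊤ unb)
  ... | inj₁ c = TreeAt.noFigure t (ClosedFigure.fig closed) (ClosedFigure.inT closed) (_ , nil)
    where closed = closed-figure e∈ h (_ , sc-sym c)

  unicycle-acyclic : ∀ {B e v w} → UnicycleAt B v → e ∈ B → Hop e v w → ¬ NoDrop (B - e) e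
  unicycle-acyclic {B} {e} {v} {w} U e∈ hop nd
    with unb-figure ([ (λ c → c) , proj₁ ]′ (spanned-minus nd (unicycleAt-unb U)))
  ... | a₁ , mkFig f₁ in₁ , _ , v~a₁ = [ (λ c → open-ends (_ , c)) , (λ (_ , unb) → second (unb-figure unb)) ]′ (nd hop)
    where
    open UnicycleAt U
    S⊆B : B - e ⊆ B
    S⊆B = T-x⊆T
    eq₁ = only f₁ (λ i → S⊆B (in₁ i)) (joined-mono S⊆B v~a₁)
    open-ends : ¬ Joined (B - e) v w
    open-ends j = x∉p-x B (in₁ (same-edges fig f₁ (sym eq₁) (same-edges (ClosedFigure.fig closed) fig (only (ClosedFigure.fig closed) (ClosedFigure.inT closed) (_ , nil)) (ClosedFigure.e∈ closed))))
      where closed = closed-figure e∈ hop (joined-sym j)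
    second : NegFigure (B - e) w → ⊥
    second (a₂ , mkFig f₂ in₂ , _ , w~a₂) = open-ends (joined-trans v~a₁ (joined-trans
      (share-joined f₁ f₂ in₁ in₂ x∈ (same-edges fig f₂ (sym eq₂) (same-edges f₁ fig eq₁ x∈))) (joined-sym w~a₂)))
      where
      eq₂ = only f₂ (λ i → S⊆B (in₂ i)) (joined-trans (_ , sc-hop e∈ hop) (joined-mono S⊆B w~a₂))
      x∈ = proj₂ (fig-nonempty f₁)

  good-acyclic : ∀ {B e v w} → GoodAt B v → e ∈ B → Hop e v w → ¬ NoDrop (B - e) e
  good-acyclic {B} {e} {v} good with unb? E v
  ... | yes unb = unicycle-acyclic (GoodAt.unicycle good unb)
  ... | no ¬unb = tree-acyclic ¬unb (GoodAt.tree good ¬unb)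

  good-nullity : ∀ {B} → (∀ u → GoodAt B u) → NoLoose B → Nullity B 0
  good-nullity {B} good noLoose = nullity-extend (λ i → ⊥-elim (∉⊥ i)) (λ x∈ _ → acyclic x∈ (loose-or-hop _)) nullity-∅
    where
    acyclic : ∀ {x} → x ∈ B → IsLoose x ⊎ ∃[ v ] ∃[ w ] Hop x v w → ¬ NoDrop (B - x) x
    acyclic x∈ (inj₁ l) = ⊥-elim (noLoose _ x∈ l)
    acyclic x∈ (inj₂ (v , w , h)) = good-acyclic (good v) x∈ h

  ⊆-minus : ∀ {B B′ : Subset m} {x} → B ⊆ B′ → x ∉ B → B ⊆ B′ - x
  ⊆-minus {B} i x∉ y∈ = x∈p∧x≢y⇒x∈p-y (i y∈) λ eq → x∉ (subst (_∈ B) eq y∈)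

  maximal : ∀ {B B′ : Subset m} → B ⊆ B′ → (∀ {x} → x ∈ B′ → x ∉ B → ⊥) → B′ ≡ B
  maximal {B} {B′} B⊆B′ h with full-or-missing B′ B
  ... | inj₁ B′⊆B = ⊆-antisym B′⊆B B⊆B′
  ... | inj₂ (x , x∈ , x∉) = ⊥-elim (h x∈ x∉)

  basis-hb : ∀ {B} → Hyperbalanced E → Spanning B → Nullity B 0 → IsBasis B
  basis-hb {B} hb sp N = independent-hb N (hyperbalanced-mono ⊆⊤ hb) , λ B′ B⊆B′ ind → maximal B⊆B′ λ {x} x∈ x∉ →
    [ (λ (N′ , _) → nullity-0 x∈ (noDrop-mono (⊆-minus B⊆B′ x∉) (sp x∉)) N′) , (λ (_ , hf) → hf (hyperbalanced-mono ⊆⊤ hb)) ]′ (independent⁻ ind)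

  basis-hf : ∀ {B} → Hyperfrustrated B → Spanning B → Nullity B 1 → IsBasis B
  basis-hf {B} hf sp N = independent-hf N hf , λ B′ B⊆B′ ind → maximal B⊆B′ λ {x} x∈ x∉ →
    [ (λ (_ , hb) → hf (hyperbalanced-mono B⊆B′ hb))
    , (λ (N′ , _) → hf (hyperbalanced-mono (⊆-minus B⊆B′ x∉)
        (nullity-0-hyperbalanced (nullity-1 x∈ (noDrop-mono (⊆-minus B⊆B′ x∉) (sp x∉)) N′)))) ]′ (independent⁻ ind)

  Far : Subset m → Fin m → Fin n → Set
  Far B e u = ∀ {y z} → Hop e y z → ¬ Joined B u y

  far-joined : ∀ {B e u w} → Far B e u → Joined B u w → Joined (B - e) u w
  far-joined {B} {e} {u} far (_ , c) = go (_ , nil) c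
    where
    go : ∀ {x s w} → Joined B u x → SC B x s w → Joined (B - e) x w
    go j nil = _ , nil
    go j (cons {f} f∈ h c) with ∈-split e f∈
    ... | inj₁ refl = ⊥-elim (far h j)
    ... | inj₂ f∈′ = joined-trans (_ , sc-hop f∈′ h) (go (joined-trans j (_ , sc-hop f∈ h)) c)

  far-fig : ∀ {B e u a} → Far B e u → (f : FigureAt a) → f ⊑ B → Joined B u a → f ⊑ B - e
  far-fig far f i j = within-minus i λ e∈ → let y , z , h , r = fig-near f i e∈ in far h (joined-trans j r)

  unicycleAt-minus : ∀ {B e u} → Far B e u → UnicycleAt B u → UnicycleAt (B - e) u
  unicycleAt-minus far U = record
    { fig = fig ; inB = far-fig far fig inB joined ; neg = neg ; joined = far-joined far joined
    ; only = λ g i j → only g (λ k → T-x⊆T (i k)) (joined-mono T-x⊆T j) }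
    where
    open UnicycleAt U

  unicycleAt-plus : ∀ {B e u} → Far B e u → UnicycleAt (B - e) u → UnicycleAt B u
  unicycleAt-plus far U = record
    { fig = fig ; inB = λ i → T-x⊆T (inB i) ; neg = neg ; joined = joined-mono T-x⊆T joined
    ; only = λ g i j → only g (far-fig far g i j) (far-joined far j) }
    where
    open UnicycleAt U

  goodAt-minus : ∀ {B e u} → Far B e u → GoodAt B u → GoodAt (B - e) u
  goodAt-minus far good = record
    { tree = λ ¬unb → record
        { spans = λ j → far-joined far (TreeAt.spans (GoodAt.tree good ¬unb) j)
        ; noFigure = λ f i j → TreeAt.noFigure (GoodAt.tree good ¬unb) f (λ k → T-x⊆T (i k)) (joined-mono T-x⊆T j) }
    ; unicycle = λ unb → unicycleAt-minus far (GoodAt.unicycle good unb) }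

  goodAt-plus : ∀ {B e u} → Far B e u → GoodAt (B - e) u → GoodAt B u
  goodAt-plus far good = record
    { tree = λ ¬unb → record
        { spans = λ j → joined-mono T-x⊆T (TreeAt.spans (GoodAt.tree good ¬unb) j)
        ; noFigure = λ f i j → TreeAt.noFigure (GoodAt.tree good ¬unb) f (far-fig far f i j) (far-joined far j) }
    ; unicycle = λ unb → unicycleAt-plus far (GoodAt.unicycle good unb) }

  figure-noDrop : ∀ {S a} (f : FigureAt a) → figSign f ≡ ₊ → f ⊑ S → ∀ {e} → e ∈ᴸ figEdges f → NoDrop (S - e) e
  figure-noDrop f pos i e∈ h with figure-cut f i e∈ h
  ... | s , c , sign = inj₁ (sc-cast (sign pos) c)

  figures-noDrop : ∀ {S a b} (f : FigureAt a) → figSign f ≡ ₋ → f ⊑ S → (g : FigureAt b) → g ⊑ S →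
    Joined S a b → ∀ {x} → x ∈ᴸ figEdges g → x ∉ᴸ figEdges f → NoDrop (S - x) x
  figures-noDrop {S} f neg inf g ing a~b {x} x∈g x∉f {y} {z} h = inj₂ (unb (proj₁ yz∈) , unb (proj₂ yz∈))
    where
    yz∈ = fig-edge-verts g x∈g h
    unb : ∀ {y} → y ∈ᴸ figVerts g → Unb (S - x) y
    unb y∈ = negFigure-unb (_ , mkFig f (within-minus inf x∉f) , neg
      , joined-cut g ing x∈g (joined-sym (joined-trans a~b (fig-joined g ing y∈))))

  module _ {S} (N : Nullity S 0) where

    no-positive : ∀ {a} (f : FigureAt a) → f ⊑ S → figSign f ≡ ₋
    no-positive f i with sign-cases (figSign f)
    ... | inj₂ neg = neg
    ... | inj₁ pos = let e , e∈ = fig-nonempty f in ⊥-elim (nullity-0 (i e∈) (figure-noDrop f pos i e∈) N)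

    one-figure : ∀ {a b} (f : FigureAt a) → f ⊑ S → (g : FigureAt b) → g ⊑ S → Joined S a b →
      ∀ {x} → x ∈ᴸ figEdges g → x ∈ᴸ figEdges f
    one-figure f inf g ing a~b {x} x∈g with x ∈ᴸ? figEdges f
    ... | yes x∈f = x∈f
    ... | no x∉f = ⊥-elim (nullity-0 (ing x∈g) (figures-noDrop f (no-positive f inf) inf g ing a~b x∈g x∉f) N)

    same-figure : ∀ {a b} (f : FigureAt a) → f ⊑ S → (g : FigureAt b) → g ⊑ S → Joined S a b →
      setOf (figEdges g) ≡ setOf (figEdges f)
    same-figure f inf g ing a~b = ⊆-antisym
      (setOf-within (figEdges g) (λ i → setOf⁺ (one-figure f inf g ing a~b i)))
      (setOf-within (figEdges f) (λ i → setOf⁺ (one-figure g ing f inf (joined-sym a~b) i)))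

    nullity-0-noLoose : NoLoose S
    nullity-0-noLoose e e∈ l = nullity-0 e∈ (λ h → ⊥-elim (loose-no-hop {e} l h)) N

    module _ (sp : Spanning S) where

      spanned : ∀ {u s x} → SC E u s x → SC S u s x ⊎ (Unb S u × Unb S x)
      spanned = sc-spanned λ _ e∉ → sp e∉

      spanning-good : ∀ u → GoodAt S u
      spanning-good u = record
        { tree = λ ¬unb → record
            { spans = λ (_ , c) → [ (λ d → _ , d) , (λ (unb , _) → ⊥-elim (¬unb (sc-mono ⊆⊤ unb))) ]′ (spanned c)
            ; noFigure = λ f i j → ¬unb (sc-mono ⊆⊤ (negFigure-unb (_ , mkFig f i , no-positive f i , j))) }
        ; unicycle = λ unb → uni (unb-figure ([ (λ c → c) , proj₁ ]′ (spanned unb))) }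
        where
        uni : NegFigure S u → UnicycleAt S u
        uni (a , mkFig f i , neg , j) = record
          { fig = f ; inB = i ; neg = neg ; joined = j
          ; only = λ g ing r → same-figure f i g ing (joined-trans (joined-sym j) r) }

  ∣setOf∣ : ∀ xs → ∣ setOf xs ∣ ≤ length xs
  ∣setOf∣ [] = ℕₚ.≤-reflexive (∣⊥∣≡0 m)
  ∣setOf∣ (x ∷ xs) = ℕₚ.≤-trans (add x (setOf xs)) (s≤s (∣setOf∣ xs))
    where
    add : ∀ x S → ∣ ⁅ x ⁆ ∪ S ∣ ≤ suc ∣ S ∣
    add x S = ℕₚ.≤-trans (ℕₚ.≤-reflexive (∣p∣≡1+∣p-x∣ (p⊆p∪q S (x∈⁅x⁆ x)))) (s≤s (p⊆q⇒∣p∣≤∣q∣ λ y∈ →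
      let y∈′ , y≢x = ∈-─⁻ (⁅ x ⁆ ∪ S) y∈ in [ (λ i → ⊥-elim (y≢x (x∈⁅y⁆⇒x≡y x i))) , (λ i → i) ]′ (x∈p∪q⁻ ⁅ x ⁆ S y∈′)))

  -- Thetas and handcuffs are connected and have at most one more edge than vertices.
  record Core (H : Subset m) : Set where
    field
      root : Fin n
      vs : List (Fin n)
      unique : Unique vs
      size : ∣ H ∣ ≤ suc (length vs)
      rooted : ∀ {u} → u ∈ᴸ vs → Joined H root u
      touches : ∀ {g} → g ∈ H → Meets H root g

  tailVerts : ∀ {u w} → Walk u w → List (Fin n)
  tailVerts [] = []
  tailVerts (step _ _ _ W) = verts W

  interior : ∀ {u w} → Walk u w → List (Fin n)
  interior [] = []
  interior (step _ _ _ W) = initVerts W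

  tail∈ : ∀ {u w} (W : Walk u w) {x} → x ∈ᴸ tailVerts W → x ∈ᴸ verts W
  tail∈ (step _ _ _ W) i = there i

  tail-path : ∀ {u w} (W : Walk u w) → IsPath W → Unique (tailVerts W) × u ∉ᴸ tailVerts W
  tail-path [] _ = [] , λ ()
  tail-path (step _ _ _ W) p@(_ ∷ p′) = p′ , unique-∉ p

  length-verts : ∀ {u w} (W : Walk u w) → length (verts W) ≡ suc (length (edges W))
  length-verts [] = refl
  length-verts (step _ _ _ W) = cong suc (length-verts W)

  length-init : ∀ {u w} (W : Walk u w) → length (initVerts W) ≡ length (edges W)
  length-init [] = refl
  length-init (step _ _ _ W) = cong suc (length-init W)

  length-tail : ∀ {u w} (W : Walk u w) → length (tailVerts W) ≡ length (edges W)
  length-tail [] = refl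
  length-tail (step _ _ _ W) = length-verts W

  length-interior : ∀ {u w} (W : Walk u w) → u ≢ w → suc (length (interior W)) ≡ length (edges W)
  length-interior [] ne = ⊥-elim (ne refl)
  length-interior (step _ _ _ W) _ = cong suc (length-init W)

  init-path⁻ : ∀ {u w} (W : Walk u w) → IsPath W → Unique (initVerts W) × w ∉ᴸ initVerts W
  init-path⁻ [] _ = [] , λ ()
  init-path⁻ (step e t s W) p@(_ ∷ p′) with init-path⁻ W p′
  ... | u , w∉ = unique-∷ (λ i → unique-∉ p (init⊆verts W i)) u
    , λ { (here refl) → unique-∉ p (end∈ W) ; (there i) → w∉ i }

  interior-path : ∀ {u w} (W : Walk u w) → IsPath W → Unique (interior W) × u ∉ᴸ interior W × w ∉ᴸ interior W
  interior-path [] _ = [] , (λ ()) , λ ()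
  interior-path (step e t s W) p@(_ ∷ p′) with init-path⁻ W p′
  ... | u , w∉ = u , (λ i → unique-∉ p (init⊆verts W i)) , w∉

  interior∈ : ∀ {u w} (W : Walk u w) {x} → x ∈ᴸ interior W → x ∈ᴸ verts W
  interior∈ (step _ _ _ W) i = there (init⊆verts W i)

  figTail : ∀ {a} → FigureAt a → List (Fin n)
  figTail (circ W _) = interior W
  figTail (halfF _ _ _) = []

  figVerts-head : ∀ {a} (f : FigureAt a) → figVerts f ≡ a ∷ figTail f
  figVerts-head (circ [] (ne , _)) = ⊥-elim (ne refl)
  figVerts-head (circ (step _ _ _ _) _) = refl
  figVerts-head (halfF _ _ _) = refl

  figVerts-unique : ∀ {a} (f : FigureAt a) → Unique (figVerts f)
  figVerts-unique (circ _ (_ , _ , u)) = u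
  figVerts-unique (halfF _ _ _) = [] ∷ []

  figVerts-length : ∀ {a} (f : FigureAt a) → length (figVerts f) ≡ length (figEdges f)
  figVerts-length (circ W _) = length-init W
  figVerts-length (halfF _ _ _) = refl

  length-++₃ : ∀ {A : Set} (xs ys zs : List A) → length (xs ++ ys ++ zs) ≡ length xs + (length ys + length zs)
  length-++₃ xs ys zs = trans (Listₚ.length-++ xs) (cong (length xs +_) (Listₚ.length-++ ys))

  handcuff-core : (h : Handcuff) → Core (setOf (hcEdges h))
  handcuff-core h = record
    { root = a ; vs = vs
    ; unique = unique-++ (figVerts-unique F₁) (unique-++ (proj₁ tailP) uniq₂ dis-P₂) dis-₁
    ; size = ℕₚ.≤-trans (∣setOf∣ (hcEdges h)) (ℕₚ.≤-reflexive size)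
    ; rooted = ∈-++⁻³ (figVerts F₁) (tailVerts P) (fig-joined F₁ in₁) (λ i → walk-joined P inP (tail∈ P i))
        (λ i → joined-trans a~b (fig-joined F₂ in₂ (tail⊆ i)))
    ; touches = λ i → ∈-++⁻³ (figEdges F₁) (edges P) (fig-near F₁ in₁) (walk-near P inP)
        (λ j → let y , z , hp , r = fig-near F₂ in₂ j in y , z , hp , joined-trans a~b r) (setOf⁻ (hcEdges h) i) }
    where
    open Handcuff h
    vs = figVerts F₁ ++ tailVerts P ++ figTail F₂
    in₁ : F₁ ⊑ setOf (hcEdges h)
    in₁ i = setOf⁺ (∈-++⁺ˡ i)
    inP : P ⊑ʷ setOf (hcEdges h)
    inP i = setOf⁺ (∈-++⁺ʳ (figEdges F₁) (∈-++⁺ˡ i))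
    in₂ : F₂ ⊑ setOf (hcEdges h)
    in₂ i = setOf⁺ (∈-++⁺ʳ (figEdges F₁) (∈-++⁺ʳ (edges P) i))
    a~b : Joined (setOf (hcEdges h)) a b
    a~b = _ , walk-sc P inP
    tailP = tail-path P path
    uniqF₂ : Unique (b ∷ figTail F₂)
    uniqF₂ = subst Unique (figVerts-head F₂) (figVerts-unique F₂)
    uniq₂ : Unique (figTail F₂)
    uniq₂ with uniqF₂
    ... | _ ∷ u = u
    tail⊆ : ∀ {x} → x ∈ᴸ figTail F₂ → x ∈ᴸ figVerts F₂
    tail⊆ i = subst (_ ∈ᴸ_) (sym (figVerts-head F₂)) (there i)
    dis-P₂ : ∀ x → x ∈ᴸ tailVerts P → x ∈ᴸ figTail F₂ → ⊥
    dis-P₂ x i j with dis₂ x (tail⊆ j) (tail∈ P i)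
    ... | refl = unique-∉ uniqF₂ j
    dis-₁ : ∀ x → x ∈ᴸ figVerts F₁ → x ∈ᴸ tailVerts P ++ figTail F₂ → ⊥
    dis-₁ x i j with ∈-++⁻ (tailVerts P) j
    ... | inj₁ k with dis₁ x i (tail∈ P k)
    ...   | refl = proj₂ tailP k
    dis-₁ x i j | inj₂ k with dis₁₂ x i (tail⊆ k)
    ...   | refl , a≡b = unique-∉ uniqF₂ (subst (_∈ᴸ figTail F₂) a≡b k)
    size : length (hcEdges h) ≡ suc (length vs)
    size rewrite length-++₃ (figEdges F₁) (edges P) (figEdges F₂) | length-++₃ (figVerts F₁) (tailVerts P) (figTail F₂)
        | figVerts-length F₁ | length-tail P
      | trans (sym (figVerts-length F₂)) (cong length (figVerts-head F₂)) | ℕₚ.+-suc (length (edges P)) (length (figTail F₂))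
        | ℕₚ.+-suc (length (figEdges F₁)) (length (edges P) + length (figTail F₂)) = refl

  theta-core : (t : Theta) → Core (setOf (thetaEdges t))
  theta-core t = record
    { root = x ; vs = vs
    ; unique = unique-++ path₁ (unique-++ (proj₁ i₂) (proj₁ i₃) dis₂₃) dis₁
    ; size = ℕₚ.≤-trans (∣setOf∣ (thetaEdges t)) (ℕₚ.≤-reflexive size)
    ; rooted = ∈-++⁻³ (verts P₁) (interior P₂) (walk-joined P₁ in₁) (λ i → walk-joined P₂ in₂ (interior∈ P₂ i))
        (λ i → walk-joined P₃ in₃ (interior∈ P₃ i))
    ; touches = λ i → ∈-++⁻³ (edges P₁) (edges P₂) (walk-near P₁ in₁) (walk-near P₂ in₂) (walk-near P₃ in₃) (setOf⁻ (thetaEdges t) i) }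
    where
    open Theta t
    vs = verts P₁ ++ interior P₂ ++ interior P₃
    in₁ : P₁ ⊑ʷ setOf (thetaEdges t)
    in₁ i = setOf⁺ (∈-++⁺ˡ i)
    in₂ : P₂ ⊑ʷ setOf (thetaEdges t)
    in₂ i = setOf⁺ (∈-++⁺ʳ (edges P₁) (∈-++⁺ˡ i))
    in₃ : P₃ ⊑ʷ setOf (thetaEdges t)
    in₃ i = setOf⁺ (∈-++⁺ʳ (edges P₁) (∈-++⁺ʳ (edges P₂) i))
    i₂ = interior-path P₂ path₂
    i₃ = interior-path P₃ path₃
    ends∉ : ∀ {P : Walk x y} → x ∉ᴸ interior P × y ∉ᴸ interior P → ∀ {z} → z ∈ᴸ interior P → z ≡ x ⊎ z ≡ y → ⊥
    ends∉ (x∉ , _) i (inj₁ refl) = x∉ i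
    ends∉ (_ , y∉) i (inj₂ refl) = y∉ i
    dis₂₃ : ∀ z → z ∈ᴸ interior P₂ → z ∈ᴸ interior P₃ → ⊥
    dis₂₃ z i j = ends∉ {P₂} (proj₂ i₂) i (int₂₃ z (interior∈ P₂ i) (interior∈ P₃ j))
    dis₁ : ∀ z → z ∈ᴸ verts P₁ → z ∈ᴸ interior P₂ ++ interior P₃ → ⊥
    dis₁ z i j with ∈-++⁻ (interior P₂) j
    ... | inj₁ k = ends∉ {P₂} (proj₂ i₂) k (int₁₂ z i (interior∈ P₂ k))
    ... | inj₂ k = ends∉ {P₃} (proj₂ i₃) k (int₁₃ z i (interior∈ P₃ k))
    size : length (thetaEdges t) ≡ suc (length vs)
    size rewrite length-++₃ (edges P₁) (edges P₂) (edges P₃) | length-++₃ (verts P₁) (interior P₂) (interior P₃)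
      | length-verts P₁ | sym (length-interior P₂ x≢y) | sym (length-interior P₃ x≢y)
      | ℕₚ.+-suc (length (interior P₂)) (length (interior P₃))
      | ℕₚ.+-suc (length (edges P₁)) (suc (length (interior P₂) + length (interior P₃)))
      | ℕₚ.+-suc (length (edges P₁)) (length (interior P₂) + length (interior P₃)) = refl

  thetaOrHandcuff-core : ∀ {H} → IsThetaOrHandcuff H → Core H
  thetaOrHandcuff-core (inj₁ (t , refl)) = theta-core t
  thetaOrHandcuff-core (inj₂ (h , refl)) = handcuff-core h

  core-fig-joined : ∀ {H} (C : Core H) → ∀ {a} (f : FigureAt a) → f ⊑ H → Joined H (Core.root C) a
  core-fig-joined C f i with fig-nonempty f
  ... | e , e∈ with Core.touches C (i e∈)
  ...   | y , z , h , j = joined-trans j (joined-sym (fig-joined f i (proj₁ (fig-edge-verts f e∈ h))))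

  core-nullity : ∀ {H} (C : Core H) → ∀ {a} (f : FigureAt a) → f ⊑ H → figSign f ≡ ₋ → ∀ {k} → Nullity H k → k ≤ 1
  core-nullity {H} C f i neg {k} (L , t , eq) = ℕₚ.+-cancelˡ-≤ n k 1 (ℕₚ.≤-trans
    (ℕₚ.≤-trans (ℕₚ.≤-reflexive (sym eq)) (ℕₚ.≤-trans (ℕₚ.+-monoˡ-≤ (length L) (Core.size C))
      (ℕₚ.≤-trans (s≤s (ℕₚ.≤-reflexive (sym (Listₚ.length-++ (Core.vs C))))) (s≤s (unique-length disjointList)))))
    (ℕₚ.≤-reflexive (ℕₚ.+-comm 1 n)))
    where
    disjointList : Unique (Core.vs C ++ L)
    disjointList = unique-++ (Core.unique C) (Transversal.unique t) λ u p q →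
      Transversal.balanced t q (negFigure-unb (_ , mkFig f i , neg , joined-trans (joined-sym (Core.rooted C p)) (core-fig-joined C f i)))

  good-everywhere : ∀ {B} → (∀ X → IsComp X → GoodComp B X) → ∀ u → GoodAt B u
  good-everywhere comps u = goodComp⁻ (component-is E u) (self∈ u) (comps _ (component-is E u))

  insert-minus : ∀ {B : Subset m} {e} → e ∉ B → (⁅ e ⁆ ∪ B) - e ≡ B
  insert-minus {B} {e} e∉ = ⊆-antisym
    (λ i → let j , ne = ∈-─⁻ (⁅ e ⁆ ∪ B) i in [ (λ k → ⊥-elim (ne (x∈⁅y⁆⇒x≡y e k))) , (λ k → k) ]′ (x∈p∪q⁻ ⁅ e ⁆ B j))
    (⊆-minus (q⊆p∪q ⁅ e ⁆ B) e∉)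

  e∈insert : ∀ {B : Subset m} e → e ∈ ⁅ e ⁆ ∪ B
  e∈insert {B} e = p⊆p∪q B (x∈⁅x⁆ e)

  circuit-neutral : ∀ {S} → Hyperbalanced S → (w : CircuitWalk) → Within S (cwEdges w) → cwGain w ≈ 0#
  circuit-neutral hb w i = hb (setOf (cwEdges w)) (w , refl) (setOf-within (cwEdges w) i) w refl

  insert-∉-basis : ∀ {B e} → IsBasis B → e ∉ B → ¬ Independent (⁅ e ⁆ ∪ B)
  insert-∉-basis {B} {e} (_ , max) e∉ ind = e∉ (subst (e ∈_) (max (⁅ e ⁆ ∪ B) (q⊆p∪q ⁅ e ⁆ B) ind) (e∈insert e))

  basis-spanning : ∀ {B} → IsBasis B → Spanning B
  basis-spanning {B} basis {e} e∉ with noDrop-or-drop B e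
  ... | inj₁ nd = nd
  ... | inj₂ d = ⊥-elim (insert-∉-basis basis e∉ (cases (independent⁻ (proj₁ basis))))
    where
    T = ⁅ e ⁆ ∪ B
    nullity-T : ∀ {k} → Nullity B k → Nullity T k
    nullity-T N = nullity-drop (e∈insert e) (subst (λ S → Drop S e) (sym (insert-minus e∉)) d)
      (subst (λ S → Nullity S _) (sym (insert-minus e∉)) N)
    cases : (Nullity B 0 × Hyperbalanced B) ⊎ (Nullity B 1 × Hyperfrustrated B) → Independent T
    cases (inj₁ (N , _)) = independent-hb (nullity-T N) (nullity-0-hyperbalanced (nullity-T N))
    cases (inj₂ (N , hf)) = independent-hf (nullity-T N) λ hb → hf (hyperbalanced-mono (q⊆p∪q ⁅ e ⁆ B) hb)

  -- Adding to a basis of nullity 0 an edge off the potential of the basis would give a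
  -- hyperfrustrated independent set.
  basis-nullity-0 : ∀ {B} → IsBasis B → Nullity B 0 → ¬ Hyperfrustrated E
  basis-nullity-0 {B} basis N hf with nullity-0-potential B N
  ... | θ , sat = ¬¬-∀ (Sat θ) ¬¬sat λ all → hf (sat-hyperbalanced (λ {e} _ → all e))
    where
    ¬¬sat : ∀ e → ¬ ¬ Sat θ e
    ¬¬sat e ¬sat with e ∈? B
    ... | yes e∈ = ¬sat (sat e∈)
    ... | no e∉ = insert-∉-basis basis e∉ (independent-hf (nullity-noDrop (e∈insert e) nd N′) hfT)
      where
      T = ⁅ e ⁆ ∪ B
      eq : T - e ≡ B
      eq = insert-minus e∉
      nd : NoDrop (T - e) e
      nd = subst (λ S → NoDrop S e) (sym eq) (basis-spanning basis e∉)
      N′ : Nullity (T - e) 0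
      N′ = subst (λ S → Nullity S 0) (sym eq) N
      C = fundamental-circuit (e∈insert e) nd
      open FundamentalCircuit C
      hfT : Hyperfrustrated T
      hfT hb = ¬sat (force (λ {f} f∈ → sat (subst (f ∈_) eq f∈)) (circuit-neutral hb circuit inside))

  basis⇒condI : ∀ {B} → Hyperbalanced E → IsBasis B → CondI B
  basis⇒condI {B} hb basis = [ (λ (N , _) → (λ X compX → goodComp⁺ compX (λ _ → spanning-good N (basis-spanning basis) _)) , nullity-0-noLoose N)
    , (λ (_ , hf) → ⊥-elim (hf (hyperbalanced-mono ⊆⊤ hb))) ]′ (independent⁻ (proj₁ basis))

  condI⇒basis : ∀ {B} → Hyperbalanced E → CondI B → IsBasis B
  condI⇒basis hb (comps , noLoose) = basis-hb hb (spansAt-spanning (λ u → goodAt-spans (good u))) (good-nullity good noLoose)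
    where good = good-everywhere comps

  fig-circle : ∀ {a} (f : FigureAt a) → figSign f ≡ ₊ → IsCircle (setOf (figEdges f))
  fig-circle {a} (circ W c) _ = a , W , c , refl

  loose-set : ∀ e → setOf (e ∷ []) ≡ ⁅ e ⁆
  loose-set e = ∪-identityʳ ⁅ e ⁆

  other-component-good : ∀ {B X u} → (∀ X′ → IsComp X′ → X′ ≢ X → GoodComp B X′) → u ∉ X → GoodAt B u
  other-component-good {X = X} {u} others u∉ = goodComp⁻ (component-is E u) (self∈ u)
    (others _ (component-is E u) (λ eq → u∉ (subst (u ∈_) eq (self∈ u))))

  excLoose⇒basis : ∀ {B} → ExcLoose B → IsBasis B
  excLoose⇒basis {B} (comps , e , e∈ , l , ¬neutral , uniq) = basis-hf
    (λ hb → ¬neutral (hb ⁅ e ⁆ (looseC e l , loose-set e) (λ {x} x∈ → subst (_∈ B) (sym (x∈⁅y⁆⇒x≡y e x∈)) e∈)))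
    (spansAt-spanning (λ u → goodAt-spans (good u)))
    (nullity-noDrop e∈ (λ h → ⊥-elim (loose-no-hop {e} l h)) (good-nullity
      (λ u → goodAt-minus (λ h → ⊥-elim (loose-no-hop {e} l h)) (good u))
      λ x x∈ lx → x∉p-x B (subst (_∈ B - e) (uniq x (T-x⊆T x∈) lx) x∈)))
    where good = good-everywhere comps

  excBalanced⇒basis : ∀ {B} → ExcBalanced B → IsBasis B
  excBalanced⇒basis {B} (noLoose , X , compX , bal , _ , ((a , f) , (conn , f⊆ , uniq) , pos , _ , ¬neutral) , others) = basis-hf
    (λ hb → let C , eq = pos-circuit f pos inB e∈ in
      ¬neutral (hb (setOf (figEdges f)) (FundamentalCircuit.circuit C , cong setOf eq) (setOf-within (figEdges f) inB)))
    (spansAt-spanning spans)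
    (nullity-noDrop (inB e∈) (figure-noDrop f pos inB e∈) (good-nullity good′ λ x x∈ → noLoose x (T-x⊆T x∈)))
    where
    inT : f ⊑ (B ∩ EC X)
    inT = within-setOf (figEdges f) f⊆
    inB : f ⊑ B
    inB i = T⊆B compX B (inT i)
    a∈ : a ∈ X
    a∈ = fig-in-base compX B f inT
    e = proj₁ (fig-nonempty f)
    e∈ = proj₂ (fig-nonempty f)
    ¬unb : ∀ {u} → u ∈ X → ¬ Unb E u
    ¬unb u∈ = signBalanced⇒¬unb compX u∈ bal
    joined-X : ∀ {u w} → u ∈ X → Joined E u w → Joined B u w
    joined-X u∈ j = joined-mono (T⊆B compX B) (conn⇒joined (conn _ _ u∈ (comp-closed compX u∈ j)))
    spans : ∀ u → SpansAt B u
    spans u with u ∈? X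
    ... | yes u∈ = (λ _ → joined-X u∈) , λ unb → ⊥-elim (¬unb u∈ unb)
    ... | no u∉ = goodAt-spans (other-component-good others u∉)
    good′ : ∀ u → GoodAt (B - e) u
    good′ u with u ∈? X
    ... | yes u∈ = record
      { tree = λ _ → record
          { spans = λ j → joined-cut f inB e∈ (joined-X u∈ j)
          ; noFigure = λ {b} g i j → x∉p-x B (i (same-edges f g (sym (uniq (b , g) (setOf-within (figEdges g)
              (fig-in compX B g (comp-closed compX u∈ (joined-mono ⊆⊤ j)) (λ k → T-x⊆T (i k)))))) e∈)) }
      ; unicycle = λ unb → ⊥-elim (¬unb u∈ unb) }
    ... | no u∉ = goodAt-minus
      (λ h j → u∉ (comp-closed compX (comp-closed compX a∈ (fig-joined f (λ _ → ∈⊤) (proj₁ (fig-edge-verts f e∈ h)))) (joined-sym (joined-mono ⊆⊤ j))))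
      (other-component-good others u∉)

  excUnbalanced⇒basis : ∀ {B} → ExcUnbalanced B → IsBasis B
  excUnbalanced⇒basis {B} (noLoose , X , compX , ¬bal
    , (Y , (compTY , Y⊆X) , (_ , (H , th , H⊆ , ((a , f) , f⊆H , neg) , figs) , (C , isC , C⊆ , ¬neutral)) , otherY) , others)
    = basis-hf hf (spansAt-spanning spans) nullity-B
    where
    T₀ = B ∩ EC X
    compY : IsComponent B Y
    compY = component-out compX B Y⊆X compTY
    B₀⊆B : edgesAt T₀ Y ⊆ B
    B₀⊆B i = T⊆B compX B (edgesAt-⊆ {T₀} {Y} i)
    H⊆B : H ⊆ B
    H⊆B i = B₀⊆B (H⊆ i)
    hf : Hyperfrustrated B
    hf hb = ¬neutral (hb C isC (λ i → B₀⊆B (C⊆ i)))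
    good : ∀ u → u ∉ Y → GoodAt B u
    good u u∉Y with u ∈? X
    ... | no u∉X = other-component-good others u∉X
    ... | yes u∈X = record
      { tree = λ ¬unb → ⊥-elim (¬unb (unb-component compX ¬bal u∈X))
      ; unicycle = λ _ → unicycleAt⁻ (component-is B u) (self∈ u) (subst (SignUnbalancedUnicycle Y′) (edgesAt-T compX B Y′⊆X)
          (otherY Y′ (component-in compX B Y′⊆X (component-is B u) , Y′⊆X) (λ eq → u∉Y (subst (u ∈_) eq (self∈ u))))) }
      where
      Y′ = component B u
      Y′⊆X : Y′ ⊆ X
      Y′⊆X = component-⊆ compX B (component-is B u) (self∈ u) u∈X
    inH : f ⊑ H
    inH = within-setOf (figEdges f) f⊆H
    spans : ∀ u → SpansAt B u
    spans u with u ∈? Y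
    ... | no u∉ = goodAt-spans (good u u∉)
    ... | yes u∈ = (λ ¬unb → ⊥-elim (¬unb (unb-component compX ¬bal (Y⊆X u∈)))) , λ _ →
      negFigure-unb (a , mkFig f (λ i → H⊆B (inH i)) , neg , comp-joined compY u∈ (fig-base∈ compY f
        (λ i → subst (_ ∈_) (edgesAt-T compX B Y⊆X) (H⊆ (inH i)))))
    core = thetaOrHandcuff-core th
    acyclic : ∀ {x} → x ∈ B → x ∉ H → ¬ NoDrop (B - x) x
    acyclic {x} x∈ x∉ nd with loose-or-hop x
    ... | inj₁ l = noLoose x x∈ l
    ... | inj₂ (v , w , h) with v ∈? Y
    ...   | no v∉ = good-acyclic (good v v∉) x∈ h nd
    ...   | yes v∈ = [ (λ c → open-ends (_ , c)) , (λ (p , q) → both (unb-figure p) (unb-figure q)) ]′ (nd h)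
      where
      S⊆B : B - x ⊆ B
      S⊆B = T-x⊆T
      figures-H : ∀ {b} (g : FigureAt b) → g ⊑ B → Joined B v b → g ⊑ H
      figures-H {b} g i j = within-setOf (figEdges g) (figs (b , g) (setOf-within (figEdges g)
        (λ k → subst (_ ∈_) (sym (edgesAt-T compX B Y⊆X)) (fig-at compY g (comp-closed compY v∈ j) i k))))
      open-ends : ¬ Joined (B - x) v w
      open-ends j = x∉ (figures-H (ClosedFigure.fig closed) (ClosedFigure.inT closed) (_ , nil) (ClosedFigure.e∈ closed))
        where closed = closed-figure x∈ h (joined-sym j)
      both : NegFigure (B - x) v → NegFigure (B - x) w → ⊥
      both (a₁ , mkFig f₁ in₁ , _ , v~a₁) (a₂ , mkFig f₂ in₂ , _ , w~a₂) = open-ends (joined-trans v~a₁ (joined-trans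
        (joined-mono (⊆-minus H⊆B x∉) (joined-trans
          (joined-sym (core-fig-joined core f₁ (figures-H f₁ (λ i → S⊆B (in₁ i)) (joined-mono S⊆B v~a₁))))
          (core-fig-joined core f₂ (figures-H f₂ (λ i → S⊆B (in₂ i)) (joined-trans (_ , sc-hop x∈ h) (joined-mono S⊆B w~a₂))))))
        (joined-sym w~a₂)))
    nullity-one : ∀ {k} → k ≤ 1 → Nullity B k → Nullity B 1
    nullity-one z≤n N = ⊥-elim (hf (nullity-0-hyperbalanced N))
    nullity-one (s≤s z≤n) N = N
    nullity-B : Nullity B 1
    nullity-B = let k , N = nullity-exists H in nullity-one (core-nullity core f inH neg N) (nullity-extend H⊆B acyclic N)

  condII⇒basis : ∀ {B} → CondII B → IsBasis B
  condII⇒basis (inj₁ exc) = excLoose⇒basis exc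
  condII⇒basis (inj₂ (inj₁ exc)) = excBalanced⇒basis exc
  condII⇒basis (inj₂ (inj₂ exc)) = excUnbalanced⇒basis exc

  -- B is a hyperfrustrated basis and e an edge whose removal leaves a basis of the frame matroid.
  module Removable {B} (basis : IsBasis B) (N₁ : Nullity B 1) (hf : Hyperfrustrated B)
    {e} (e∈ : e ∈ B) (nd : NoDrop (B - e) e) where

    N₀ : Nullity (B - e) 0
    N₀ = nullity-1 e∈ nd N₁

    spanning : Spanning (B - e)
    spanning {g} g∉ h with g ∈? B
    ... | yes g∈ = subst (NoDrop (B - e)) (sym (∉-split g∈ g∉)) nd h
    ... | no g∉B with basis-spanning basis g∉B h
    ...   | inj₁ c = spanned-minus nd c
    ...   | inj₂ (p , q) = inj₂ ([ (λ c → c) , proj₁ ]′ (spanned-minus nd p) , [ (λ c → c) , proj₁ ]′ (spanned-minus nd q))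

    θ = proj₁ (nullity-0-potential (B - e) N₀)

    θ-sat : SatIn θ (B - e)
    θ-sat = proj₂ (nullity-0-potential (B - e) N₀)

    ¬sat : ¬ Sat θ e
    ¬sat s = hf (sat-hyperbalanced λ f∈ → [ (λ { refl → s }) , θ-sat ]′ (∈-split e f∈))

    non-neutral : (C : FundamentalCircuit B e) → ¬ Neutral (setOf (cwEdges (FundamentalCircuit.circuit C)))
    non-neutral C neutral = ¬sat (FundamentalCircuit.force C θ-sat (neutral (FundamentalCircuit.circuit C) refl))

    good : ∀ u → GoodAt (B - e) u
    good = spanning-good N₀ spanning

    noLoose′ : NoLoose (B - e)
    noLoose′ = nullity-0-noLoose N₀

    excLoose : IsLoose e → ExcLoose B
    excLoose l = (λ X compX → goodComp⁺ compX (λ {u} _ → goodAt-plus (λ h → ⊥-elim (loose-no-hop {e} l h)) (good u)))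
      , e , e∈ , l , (λ neutral → ¬sat (sat-loose {e = e} l (neutral (looseC e l) (loose-set e))))
      , λ x x∈ lx → [ (λ eq → eq) , (λ x∈′ → ⊥-elim (noLoose′ x x∈′ lx)) ]′ (∈-split e x∈)

    module AtHop {v w} (hop : Hop e v w) where

      noLoose : NoLoose B
      noLoose x x∈ lx with ∈-split e x∈
      ... | inj₁ refl = loose-no-hop {e} lx hop
      ... | inj₂ x∈′ = noLoose′ x x∈′ lx

      X : Subset n
      X = component E v

      compX : IsComp X
      compX = component-is E v

      ends-joined : ∀ {y z} → Hop e y z → Joined B v y
      ends-joined h with hop-unique e hop h
      ... | inj₁ (refl , _) = _ , nil
      ... | inj₂ (refl , _) = _ , sc-hop e∈ hop

      others : ∀ X′ → IsComp X′ → X′ ≢ X → GoodComp B X′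
      others X′ compX′ X′≢X = goodComp⁺ compX′ λ {u} u∈ → goodAt-plus
        (λ h j → X′≢X (component-unique compX′ compX (comp-closed compX′ u∈ (joined-mono ⊆⊤ j)) (component⁺ (joined-mono ⊆⊤ (ends-joined h))))) (good u)

      excBalanced : ¬ Unb E v → ExcBalanced B
      excBalanced ¬unb = noLoose , X , compX , bal
        , (λ noFigure → noFigure (v , f) (setOf-within (figEdges f) (fig-at compX f (self∈ v) (λ _ → ∈⊤))))
        , ((v , f) , (connected , setOf-within (figEdges f) (fig-in compX B f (self∈ v) inB) , uniq) , pos , fig-circle f pos
          , λ neutral → let C , eq = pos-circuit f pos inB (ClosedFigure.e∈ (proj₁ found)) in
              non-neutral C (subst Neutral (cong setOf (sym eq)) neutral))
        , others
        where
        bal : SignBalanced (EC X)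
        bal = ¬unb⇒signBalanced compX (self∈ v) ¬unb
        ¬unb′ : ¬ Unb (B - e) v
        ¬unb′ c = ¬unb (sc-mono ⊆⊤ c)
        found : Σ[ F ∈ ClosedFigure B e v ] figSign (ClosedFigure.fig F) ≡ ₊
        found = [ (λ c → positive-figure e∈ hop c ¬unb′) , (λ (unb , _) → ⊥-elim (¬unb′ unb)) ]′ (nd hop)
        f = ClosedFigure.fig (proj₁ found)
        pos = proj₂ found
        inB : f ⊑ B
        inB = ClosedFigure.inT (proj₁ found)
        connected : ConnectedOn X (B ∩ EC X)
        connected u w u∈ w∈ = joined⇒conn (joined-in compX B u∈ (joined-mono T-x⊆T
          (TreeAt.spans (GoodAt.tree (good u) (signBalanced⇒¬unb compX u∈ bal)) (comp-joined compX u∈ w∈))))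
        positives : ∀ {a b} (g : FigureAt a) (h : FigureAt b) → figSign g ≡ ₊ → figSign h ≡ ₊ → g ⊑ B → h ⊑ B →
          ∀ {x} → x ∈ᴸ figEdges g → x ∈ᴸ figEdges h
        positives g h pg ph ing inh {x} x∈ with x ∈ᴸ? figEdges h
        ... | yes x∈h = x∈h
        ... | no x∉h with trans (sym ph) (no-positive (nullity-1 (ing x∈) (figure-noDrop g pg ing x∈) N₁) h (within-minus inh x∉h))
        ...   | ()
        uniq : ∀ g → figSet g ⊆ B ∩ EC X → figSet g ≡ figSet (v , f)
        uniq (b , g) i = ⊆-antisym
          (setOf-within (figEdges g) (λ j → setOf⁺ (positives g f pg pos ing inB j)))
          (setOf-within (figEdges f) (λ j → setOf⁺ (positives f g pos pg inB ing j)))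
          where
          pg : figSign g ≡ ₊
          pg = bal (b , g) (λ j → proj₂ (x∈p∩q⁻ B (EC X) (i j)))
          ing : g ⊑ B
          ing j = T⊆B compX B (i (setOf⁺ j))

      excUnbalanced : Unb E v → ExcUnbalanced B
      excUnbalanced unb = noLoose , X , compX , (λ bal → signBalanced⇒¬unb compX (self∈ v) bal unb)
        , (Y , (component-in compX B Y⊆X compY , Y⊆X)
          , subst (SpecialComponent Y) (sym (edgesAt-T compX B Y⊆X)) special
          , λ Y′ sub Y′≢Y → unicycles⁺ compX sub λ {u} u∈ → unicycleAt-plus
              (λ h j → let compY′ = component-out compX B (proj₂ sub) (proj₁ sub) in
                 Y′≢Y (component-unique compY′ compY (comp-closed compY′ u∈ (joined-trans j (joined-sym (ends-joined h)))) (self∈ v)))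
              (GoodAt.unicycle (good u) (unb-resp (comp-joined compX (proj₂ sub u∈) (self∈ v)) unb)))
        , others
        where
        Y = component B v
        compY : IsComponent B Y
        compY = component-is B v
        Y⊆X : Y ⊆ X
        Y⊆X = component-⊆ compX B compY (self∈ v) (self∈ v)
        unb′ : Unb (B - e) v
        unb′ = [ (λ c → c) , proj₁ ]′ (spanned N₀ spanning unb)
        theEar = ear e∈ hop nd unb′
        open Ear theEar
        H = setOf list
        core = thetaOrHandcuff-core isTH
        H⊆B : H ⊆ B
        H⊆B = setOf-within list inside
        H⊆ : H ⊆ edgesAt B Y
        H⊆ i = let y , z , h , r = Core.touches core i in edgesAt⁺ (H⊆B i) h
          (component⁺ (joined-trans v~f (joined-mono H⊆B (joined-trans (joined-sym (core-fig-joined core f f⊆)) r))))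
        inH : ∀ {b} (k : FigureAt b) → k ⊑ H → k ⊑ (edgesAt B Y)
        inH k i j = H⊆ (i j)
        figures : ∀ k → figSet k ⊆ edgesAt B Y → figSet k ⊆ H
        figures (b , k) i {y} y∈ with y ∈? H
        ... | yes y∈H = y∈H
        ... | no y∉H = ⊥-elim (x∉f (one-figure (nullity-1 (ink y∈k) (figures-noDrop f f-neg (λ j → H⊆B (f⊆ j)) k ink f~k y∈k (λ j → y∉H (f⊆ j))) N₁)
            f (within-minus (λ j → H⊆B (f⊆ j)) (λ j → y∉H (f⊆ j))) g (within-minus (λ j → H⊆B (g⊆ j)) (λ j → y∉H (g⊆ j)))
            (joined-cut k ink y∈k f~g) x∈g))
          where
          ink : k ⊑ B
          ink j = edgesAt-⊆ {B} {Y} (i (setOf⁺ j))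
          y∈k : y ∈ᴸ figEdges k
          y∈k = setOf⁻ (figEdges k) y∈
          f-base = fig-base∈ compY f (inH f f⊆)
          f~k = comp-joined compY f-base (fig-base∈ compY k (within-setOf (figEdges k) i))
          f~g = comp-joined compY f-base (fig-base∈ compY g (inH g g⊆))
        special : SpecialComponent Y (edgesAt B Y)
        special = component-connected compY
          , (H , isTH , H⊆ , ((_ , f) , setOf-within (figEdges f) f⊆ , f-neg) , figures)
          , (setOf (cwEdges circuit) , (circuit , refl) , (λ i → H⊆ (setOf-within (cwEdges circuit) circuit⊆ i)) , non-neutral fundamental)
          where
          open FundamentalCircuit fundamental using (circuit)

  basis⇒condII : ∀ {B} → Hyperfrustrated E → IsBasis B → CondII B
  basis⇒condII {B} hfE basis = [ (λ (N , _) → ⊥-elim (basis-nullity-0 basis N hfE)) , (λ (N , hf) → main N hf) ]′ (independent⁻ (proj₁ basis))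
    where
    main : Nullity B 1 → Hyperfrustrated B → CondII B
    main N hf = exc (loose-or-hop e)
      where
      e = proj₁ (nullity-removable B N)
      open Removable basis N hf (proj₁ (proj₂ (nullity-removable B N))) (proj₂ (proj₂ (nullity-removable B N)))
      exc : IsLoose e ⊎ ∃[ v ] ∃[ w ] Hop e v w → CondII B
      exc (inj₁ l) = inj₁ (excLoose l)
      exc (inj₂ (v , w , hop)) with unb? E v
      ... | yes unb = inj₂ (inj₂ (AtHop.excUnbalanced hop unb))
      ... | no ¬unb = inj₂ (inj₁ (AtHop.excBalanced hop ¬unb))

theorem7p5 : ∀ {c ℓ} (F : Field c ℓ) → CharNot2 F →
    ∀ {n m : ℕ} (Υ : GainSignedGraph F n m) (B : Subset m) →
    (GS.Hyperbalanced F Υ (GS.E F Υ) → (GS.IsBasis F Υ B ⇔ GS.CondI F Υ B))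
    × (GS.Hyperfrustrated F Υ (GS.E F Υ) → (GS.IsBasis F Υ B ⇔ GS.CondII F Υ B))
theorem7p5 F char≠2 Υ B =
  (λ hb → mk⇔ (basis⇒condI hb) (condI⇒basis hb)) , λ hf → mk⇔ (basis⇒condII hf) condII⇒basis
  where
  open Main F char≠2 Υ
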